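{- Let $n\ge1$, $a_1,\ldots,a_n$ positive integers, $\lambda=\sum a_i\omega_i$. A vertex of the type $C$ FFLV polytope $P_\lambda$ is simple if and only if it has the form $\varphi^{ -1}(x(E))$ for some $E\in\mathbf R^C_s$.
   Context: $U=\mathbb R^{n^2}$ has coordinates $x_{i,j}$, $1\le i<j\le 2n+1-i$. A type $C$ Dyck path is a sequence $d=((i_1,j_1),\ldots,(i_N,j_N))$ of such pairs with $j_1-i_1=1$, each $(i_{k+1},j_{k+1})$ equal to $(i_k+1,j_k)$ or $(i_k,j_k+1)$, and $j_N-i_N=1$ or $i_N+j_N=2n+1$; $S(x,d)=\sum_{(i,j)\in d}x_{i,j}$; $M(\lambda,d)=a_{i_1}+\ldots+a_{i_N}$ if $j_N-i_N=1$, else $a_{i_1}+\ldots+a_n$. $P_\lambda=\{x\in U:x\ge0,\ S(x,d)\le M(\lambda,d)\ \forall d\}$. A vertex is simple if the tangent cone at it is simplicial and unimodular. Let $U_A=\mathbb R^{n(2n-1)}$ with coordinates $x_{i,j}$, $1\le i<j\le 2n$, and $\varphi:U\to U_A$ the injective linear map with $\varphi(x)_{i,j}=x_{i,j}$ if $i+j<2n+1$, $2x_{i,j}$ if $i+j=2n+1$, $x_{2n+1-j,2n+1-i}$ if $i+j>2n+1$. Let $(\bar a_1,\ldots,\bar a_{2n-1})=(a_1,\ldots,a_{n-1},2a_n,a_{n-1},\ldots,a_1)$. For $i<j\le 2n$ let $d^{i,j}=((i,i+1),\ldots,(i,j),(i+1,j),\ldots,(j-1,j))$ and for $y\in U_A$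 let $S(y,d^{i,j})$ be the sum of the coordinates of $y$ along $d^{i,j}$. Let $R$ be the set of segments $[i,j]$, integers $1\le i<j\le 2n$; for $E\subset R$, $x(E)\in U_A$ is the unique point with $x(E)_{i,j}=0$ for $[i,j]\notin E$ and $S(x(E),d^{i,j})=\bar a_i+\ldots+\bar a_{j-1}$ for $[i,j]\in E$. $\mathbf R_p$ is the set of $E\subset R$ such that the intersection of any two segments of $E$ with nonempty intersection lies in $E$; $E$ is symmetric if $[2n+1-j,2n+1-i]\in E$ implies $[i,j]\in E$. $\mathbf R^C_s$ is the set of symmetric $E\in\mathbf R_p$ such that any two segments $[i,j],[k,l]\in E$ with $i+j\le 2n+1$ and $k+l\le 2n+1$ either do not intersect or one contains the other. (For symmetric $E$, $x(E)\in\varphi(U)$.)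
   Formalization: The polytope, its vertices and the tangent cones are taken in the rational space ℚ^{n²} instead of ℝ^{n²}; since the polytope is rational, its vertices and their simplicity are the same. -}

module Defs where

open import Data.Nat as ℕ using (ℕ; zero; suc; _∸_; _<ᵇ_; _≡ᵇ_)
open import Data.Integer as ℤ using (ℤ)
open import Data.Rational as ℚ using (ℚ; 0ℚ; _/_)
open import Data.Bool using (Bool; true; false; if_then_else_)
open import Data.Fin using (Fin) renaming (zero to fzero; suc to fsuc)
open import Data.List using (List; []; _∷_; map; upTo; foldr; _++_)
open import Data.Product using (_×_; _,_; Σ; ∃)
open import Data.Sum using (_⊎_)
open import Data.Unit using (⊤)
open import Data.Empty using (⊥)
open import Relation.Binary.PropositionalEquality using (_≡_)
open import Relation.Nullary using (¬_)

-- Convention: points of U (and of U_A) are functions ℕ → ℕ → ℚ, (i , j) ↦ x_{i,j};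
-- coordinates outside the index set are required to be 0 (see InU).
Pt : Set
Pt = ℕ → ℕ → ℚ

PtZ : Set
PtZ = ℕ → ℕ → ℤ

toℚ : ℤ → ℚ
toℚ z = z / 1

ℕtoℚ : ℕ → ℚ
ℕtoℚ k = ℤ.+ k / 1

sumℚ : List ℚ → ℚ
sumℚ = foldr ℚ._+_ 0ℚ

sumFin : (m : ℕ) → (Fin m → ℚ) → ℚ
sumFin zero    f = 0ℚ
sumFin (suc m) f = f fzero ℚ.+ sumFin m (λ k → f (fsuc k))

-- the list lo, lo+1, ..., hi  (empty if hi < lo)
range : ℕ → ℕ → List ℕ
range lo hi = map (lo ℕ.+_) (upTo (suc hi ∸ lo))

InRange : ℕ → ℕ → ℕ → Set
InRange n i j = (1 ℕ.≤ i) × (i ℕ.< j) × (i ℕ.+ j ℕ.≤ 2 ℕ.* n ℕ.+ 1)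

InU : ℕ → Pt → Set
InU n x = ∀ i j → ¬ InRange n i j → x i j ≡ 0ℚ

Step : ℕ × ℕ → ℕ × ℕ → Set
Step (i , j) (i' , j') = (i' ≡ suc i × j' ≡ j) ⊎ (i' ≡ i × j' ≡ suc j)

-- a type C Dyck path is written as p ∷ ps (nonempty);
-- Path n p ps : consecutive steps, all entries in range; lastP gives (i_N , j_N)
lastP : ℕ × ℕ → List (ℕ × ℕ) → ℕ × ℕ
lastP p []       = p
lastP p (q ∷ qs) = lastP q qs

StepsFrom : ℕ → ℕ × ℕ → List (ℕ × ℕ) → Set
StepsFrom n (i , j) []       = InRange n i j
StepsFrom n (i , j) (q ∷ qs) = InRange n i j × Step (i , j) q × StepsFrom n q qs

EndOK : ℕ → ℕ × ℕ → Set
EndOK n (i , j) = (j ≡ suc i) ⊎ (i ℕ.+ j ≡ 2 ℕ.* n ℕ.+ 1)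

IsDyckC : ℕ → ℕ × ℕ → List (ℕ × ℕ) → Set
IsDyckC n (i₁ , j₁) ps =
  (j₁ ≡ suc i₁) × StepsFrom n (i₁ , j₁) ps × EndOK n (lastP (i₁ , j₁) ps)

S : Pt → List (ℕ × ℕ) → ℚ
S x d = sumℚ (map (λ { (i , j) → x i j }) d)

aSum : (ℕ → ℕ) → ℕ → ℕ → ℚ
aSum a lo hi = sumℚ (map (λ k → ℕtoℚ (a k)) (range lo hi))

M : ℕ → (ℕ → ℕ) → ℕ × ℕ → List (ℕ × ℕ) → ℚ
M n a (i₁ , j₁) ps with lastP (i₁ , j₁) ps
... | (iN , jN) = if jN ≡ᵇ suc iN then aSum a i₁ iN else aSum a i₁ n

InP : ℕ → (ℕ → ℕ) → Pt → Set
InP n a x =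
  InU n x
  × (∀ i j → InRange n i j → 0ℚ ℚ.≤ x i j)
  × (∀ p ps → IsDyckC n p ps → S x (p ∷ ps) ℚ.≤ M n a p ps)

IsVertex : ℕ → (ℕ → ℕ) → Pt → Set
IsVertex n a v =
  InP n a v
  × (∀ y z t → InP n a y → InP n a z → 0ℚ ℚ.< t → t ℚ.< ℚ.1ℚ
       → (∀ i j → v i j ≡ t ℚ.* y i j ℚ.+ (ℚ.1ℚ ℚ.- t) ℚ.* z i j)
       → ∀ i j → y i j ≡ z i j)

InTangentCone : ℕ → (ℕ → ℕ) → Pt → Pt → Set
InTangentCone n a v w =
  Σ ℚ λ t → Σ Pt λ p → (0ℚ ℚ.≤ t) × InP n a p × (∀ i j → w i j ≡ t ℚ.* (p i j ℚ.- v i j))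

lin : (m : ℕ) → (Fin m → ℚ) → (Fin m → PtZ) → ℕ → ℕ → ℚ
lin m c r i j = sumFin m (λ k → c k ℚ.* toℚ (r k i j))

-- simple vertex: the tangent cone is simplicial (generated by linearly
-- independent vectors r_1..r_m, taken integral) and unimodular (these
-- generators form a ℤ-basis of the lattice ℤ^{n²} ∩ span(r)).
IsSimple : ℕ → (ℕ → ℕ) → Pt → Set
IsSimple n a v =
  Σ ℕ λ m → Σ (Fin m → PtZ) λ r →
    (∀ (c : Fin m → ℚ) → (∀ i j → lin m c r i j ≡ 0ℚ) → ∀ k → c k ≡ 0ℚ)
    × (∀ (w : Pt) →
         (InTangentCone n a v w →
            Σ (Fin m → ℚ) λ c → (∀ k → 0ℚ ℚ.≤ c k) × (∀ i j → w i j ≡ lin m c r i j))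
       × ((Σ (Fin m → ℚ) λ c → (∀ k → 0ℚ ℚ.≤ c k) × (∀ i j → w i j ≡ lin m c r i j))
            → InTangentCone n a v w))
    × (∀ (z : PtZ) →
         (Σ (Fin m → ℚ) λ c → ∀ i j → toℚ (z i j) ≡ lin m c r i j) →
         Σ (Fin m → ℤ) λ e → ∀ i j → toℚ (z i j) ≡ lin m (λ k → toℚ (e k)) r i j)

φ : ℕ → Pt → Pt
φ n x i j =
  if i ℕ.+ j <ᵇ 2 ℕ.* n ℕ.+ 1 then x i j
  else if i ℕ.+ j ≡ᵇ 2 ℕ.* n ℕ.+ 1 then ℕtoℚ 2 ℚ.* x i j
  else x (2 ℕ.* n ℕ.+ 1 ∸ j) (2 ℕ.* n ℕ.+ 1 ∸ i)

abar : ℕ → (ℕ → ℕ) → ℕ → ℕ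
abar n a k =
  if k <ᵇ n then a k
  else if k ≡ᵇ n then 2 ℕ.* a n
  else a (2 ℕ.* n ∸ k)

abarSum : ℕ → (ℕ → ℕ) → ℕ → ℕ → ℚ
abarSum n a lo hi = sumℚ (map (λ k → ℕtoℚ (abar n a k)) (range lo hi))

dA : ℕ → ℕ → List (ℕ × ℕ)
dA i j = map (λ k → (i , k)) (range (suc i) j)
         ++ map (λ k → (k , j)) (range (suc i) (j ∸ 1))

InR : ℕ → ℕ → ℕ → Set
InR n i j = (1 ℕ.≤ i) × (i ℕ.< j) × (j ℕ.≤ 2 ℕ.* n)

-- a subset E ⊆ R is given by its (decidable) indicator E i j, required to
-- vanish outside R
Seg : Set
Seg = ℕ → ℕ → Bool

SubR : ℕ → Seg → Set
SubR n E = ∀ i j → E i j ≡ true → InR n i j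

IsXE : ℕ → (ℕ → ℕ) → Seg → Pt → Set
IsXE n a E y =
  (∀ i j → InR n i j → E i j ≡ false → y i j ≡ 0ℚ)
  × (∀ i j → E i j ≡ true → S y (dA i j) ≡ abarSum n a i (j ∸ 1))

InRp : ℕ → Seg → Set
InRp n E = SubR n E ×
  (∀ i j k l → E i j ≡ true → E k l ≡ true →
     ℕ._⊔_ i k ℕ.≤ ℕ._⊓_ j l → E (ℕ._⊔_ i k) (ℕ._⊓_ j l) ≡ true)

Symmetric : ℕ → Seg → Set
Symmetric n E = ∀ i j → E (2 ℕ.* n ℕ.+ 1 ∸ j) (2 ℕ.* n ℕ.+ 1 ∸ i) ≡ true → InR n i j → E i j ≡ true

InRCs : ℕ → Seg → Set
InRCs n E = InRp n E × Symmetric n E ×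
  (∀ i j k l → E i j ≡ true → E k l ≡ true →
     i ℕ.+ j ℕ.≤ 2 ℕ.* n ℕ.+ 1 → k ℕ.+ l ℕ.≤ 2 ℕ.* n ℕ.+ 1 →
     (ℕ._⊓_ j l ℕ.< ℕ._⊔_ i k)
     ⊎ ((k ℕ.≤ i × j ℕ.≤ l) ⊎ (i ℕ.≤ k × l ℕ.≤ j)))

{-# OPTIONS --safe #-}
-- Let F be the support of v. A point lies in P exactly when it admits a potential π on the index pairs, increasing
-- by at least x along every chain and pinched between the partial sums of a at the ends of the chain; a direction
-- lies in the tangent cone as soon as the derivative of such a potential exists (Certificate).
--
-- If the cone is simplicial, every zero of v is positive on exactly one generator. Since v is extremal, each p ∈ F
-- is reached by tight links in F from the start of its row and reaches the end of its column; two exchangeable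
-- zeros, two touching segments, or a valley (a relation f₁₁ + f₂₂ = f₁₂ + f₂₁ between tight chains) contradict
-- simpliciality. Hence the hook through each p ∈ F is tight, F is laminar, and F contains the central segment
-- [K - j, j] with each [i, j], j > n (record Good).
--
-- Conversely these conditions make the only tight chains hooks, so the cone is cut out by the n² functionals
-- x_p (p ∉ F) and minus the hook sum (p ∈ F). They are unitriangular for inclusion of segments, whence a unimodular
-- dual basis, each element of which lies in the cone. Finally Good v says that E = supp (φ v) witnesses
-- φ v = x(E), because the type A hook sum of φ v at [i, j], j > n, is the sum of the type C hook sums of v
-- at [i, j] and at [K - j, j].

module Submission where

open import Defs
open import Data.Nat as ℕ using (ℕ; zero; suc; _∸_; _≤_; _<_; s≤s; z≤n)
import Data.Nat.Properties as ℕ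
open import Data.Integer as ℤ using (ℤ)
open import Data.Rational as ℚ using (ℚ; 0ℚ; 1ℚ; _+_; _*_; _-_; -_) renaming (_≤_ to _≤ℚ_; _<_ to _<ℚ_)
import Data.Rational.Properties as ℚ
import Data.Rational.Unnormalised as ℚᵘ
import Data.Rational.Unnormalised.Properties as ℚᵘ
import Data.Integer.Properties as ℤ
open import Data.Bool using (true; false; if_then_else_; T)
open import Data.Fin using (Fin) renaming (zero to fzero; suc to fsuc)
import Data.Fin.Properties as Fin
open import Data.Product.Properties using (≡-dec)
open import Data.List using (List; []; _∷_; map; upTo; applyUpTo; _++_; cartesianProduct; filter; length; lookup)
open import Data.List.Membership.Propositional using (_∈_; lose)
open import Data.List.Membership.Propositional.Properties using (∈-cartesianProduct⁺; ∈-upTo⁺; ∈-map⁺; ∈-++⁺ˡ; ∈-++⁺ʳ; ∈-filter⁺; ∈-filter⁻; ∈-lookup)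
open import Data.List.Relation.Unary.Unique.Propositional using (Unique; []; _∷_)
import Data.List.Relation.Unary.Unique.Propositional.Properties as Unique
open import Data.List.Relation.Unary.All as All using (All; []; _∷_)
open import Data.List.Relation.Unary.All.Properties using () renaming (++⁺ to All-++)
open import Data.List.Relation.Unary.Any using (any?; satisfied; index)
open import Data.List.Relation.Unary.Any.Properties using (lookup-index)
open import Data.List.Properties using (map-applyUpTo)
open import Data.Maybe.Base using (Maybe; just; nothing)
open import Data.Product using (_×_; _,_; Σ; ∃; proj₁; proj₂)
open import Data.Sum using (_⊎_; inj₁; inj₂; [_,_]′)
open import Data.Empty using (⊥; ⊥-elim)
open import Data.Unit using (tt)
open import Function using (_∘_; id; case_of_)
open import Function.Bundles using (_⇔_; mk⇔)
open import Level using (0ℓ)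
open import Relation.Nullary using (¬_; Dec; yes; no)
open import Relation.Nullary.Decidable using (_×-dec_; _⊎-dec_; ¬?; ⌊_⌋; decidable-stable)
open import Relation.Binary using (tri<; tri≈; tri>)
open import Relation.Binary.PropositionalEquality
import Tactic.RingSolver as RS
import Tactic.RingSolver.Core.AlmostCommutativeRing as ACR

-- The path inequalities are exponentially many, and a simplicial cone is given only through unknown
-- generators. The longest-path potential trades the paths for one inequality per node and one per
-- pair p ≺ q, so that membership of a direction in the tangent cone becomes a local check at the
-- tight pairs. The generators are reached through explicit indicator directions: to raise an entry
-- at potential level θ, lower by one every member of F that leaves (or every one that enters) at θ.
-- A tight chain through the raised entry contains exactly one of them, unless it starts (or ends)
-- at that entry. Hooks are singled out by the bounds. A bound depends only on the row where a chain
-- starts and the column where it ends, and among chains through p it is smallest when these are the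
-- row and the column of p. The bound stops growing once the column passes n; central segments
-- compensate for this loss of strictness.

ℚ-ring : ACR.AlmostCommutativeRing 0ℓ 0ℓ
ℚ-ring = ACR.fromCommutativeRing ℚ.+-*-commutativeRing zero?
  where
  zero? : ∀ x → Maybe (0ℚ ≡ x)
  zero? x with 0ℚ ℚ.≟ x
  ... | yes p = just p
  ... | no  _ = nothing

-- Ordered-field arithmetic, indicators, and a common small ε.

by≤ : ∀ {x y p q} → x ≤ℚ y → q + x ≡ p + y → p ≤ℚ q
by≤ {x} {y} {p} {q} x≤y eq = subst₂ _≤ℚ_ (l p x) (trans (cong (_- x) (sym eq)) (l q x))
  (ℚ.+-monoˡ-≤ (- x) (ℚ.+-monoʳ-≤ p x≤y))
  where
  l : ∀ p x → p + x - x ≡ p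
  l = RS.solve-∀ ℚ-ring

by< : ∀ {x y p q} → x <ℚ y → q + x ≡ p + y → p <ℚ q
by< {x} {y} {p} {q} x<y eq = subst₂ _<ℚ_ (l p x) (trans (cong (_- x) (sym eq)) (l q x))
  (ℚ.+-monoˡ-< (- x) (ℚ.+-monoʳ-< p x<y))
  where
  l : ∀ p x → p + x - x ≡ p
  l = RS.solve-∀ ℚ-ring

infixl 6 _⊕_
_⊕_ : ∀ {a b c d} → a ≤ℚ b → c ≤ℚ d → a + c ≤ℚ b + d
_⊕_ = ℚ.+-mono-≤

≤-eq : ∀ {a b} → a ≡ b → a ≤ℚ b
≤-eq = ℚ.≤-reflexive

<-irr : ∀ {a} → ¬ a <ℚ a
<-irr = ℚ.<-irrefl refl

≤⇒≯ : ∀ {a b} → a ≤ℚ b → ¬ b <ℚ a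
≤⇒≯ a≤b b<a = <-irr (ℚ.<-≤-trans b<a a≤b)

≤∧≢⇒< : ∀ {a b} → a ≤ℚ b → ¬ a ≡ b → a <ℚ b
≤∧≢⇒< {a} {b} a≤b a≢b with ℚ.<-cmp a b
... | tri< a<b _ _ = a<b
... | tri≈ _ a≡b _ = ⊥-elim (a≢b a≡b)
... | tri> _ _ b<a = ⊥-elim (≤⇒≯ a≤b b<a)

0<⇒≢0 : ∀ {a} → 0ℚ <ℚ a → ¬ a ≡ 0ℚ
0<⇒≢0 p refl = <-irr p

a≤a+b : ∀ {a b} → 0ℚ ≤ℚ b → a ≤ℚ a + b
a≤a+b {a} {b} h = by≤ h (l a b)
  where
  l : ∀ a b → (a + b) + 0ℚ ≡ a + b
  l = RS.solve-∀ ℚ-ring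

a<a+b : ∀ {a b} → 0ℚ <ℚ b → a <ℚ a + b
a<a+b {a} {b} h = by< h (l a b)
  where
  l : ∀ a b → (a + b) + 0ℚ ≡ a + b
  l = RS.solve-∀ ℚ-ring

a≤b⇒0≤b-a : ∀ {a b} → a ≤ℚ b → 0ℚ ≤ℚ b - a
a≤b⇒0≤b-a {a} {b} h = by≤ h (l a b)
  where
  l : ∀ a b → (b - a) + a ≡ 0ℚ + b
  l = RS.solve-∀ ℚ-ring

a<b⇒0<b-a : ∀ {a b} → a <ℚ b → 0ℚ <ℚ b - a
a<b⇒0<b-a {a} {b} h = by< h (l a b)
  where
  l : ∀ a b → (b - a) + a ≡ 0ℚ + b
  l = RS.solve-∀ ℚ-ring

+-cancel-≤ : ∀ {c a b} → c + a ≤ℚ c + b → a ≤ℚ b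
+-cancel-≤ {c} {a} {b} h = by≤ h (l a b c)
  where
  l : ∀ a b c → b + (c + a) ≡ a + (c + b)
  l = RS.solve-∀ ℚ-ring

*-nonneg : ∀ {a b} → 0ℚ ≤ℚ a → 0ℚ ≤ℚ b → 0ℚ ≤ℚ a * b
*-nonneg {a} {b} p q = ℚ.nonNegative⁻¹ (a * b)
  where
  instance
    ia : ℚ.NonNegative a
    ia = ℚ.nonNegative p
    ib : ℚ.NonNegative b
    ib = ℚ.nonNegative q
    iab : ℚ.NonNegative (a * b)
    iab = ℚ.nonNeg*nonNeg⇒nonNeg a b

*-pos : ∀ {a b} → 0ℚ <ℚ a → 0ℚ <ℚ b → 0ℚ <ℚ a * b
*-pos {a} {b} p q = ℚ.positive⁻¹ (a * b)
  where
  instance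
    ia : ℚ.Positive a
    ia = ℚ.positive p
    ib : ℚ.Positive b
    ib = ℚ.positive q
    iab : ℚ.Positive (a * b)
    iab = ℚ.pos*pos⇒pos a b

*-nonneg-nonpos : ∀ {a b} → 0ℚ ≤ℚ a → b ≤ℚ 0ℚ → a * b ≤ℚ 0ℚ
*-nonneg-nonpos {a} {b} p q = by≤ (*-nonneg p (a≤b⇒0≤b-a q)) (l a b)
  where
  l : ∀ a b → 0ℚ + 0ℚ ≡ a * b + a * (0ℚ - b)
  l = RS.solve-∀ ℚ-ring

*-mono : ∀ {e a b} → 0ℚ ≤ℚ e → a ≤ℚ b → e * a ≤ℚ e * b
*-mono {e} {a} {b} p q = by≤ (*-nonneg p (a≤b⇒0≤b-a q)) (l e a b)
  where
  l : ∀ e a b → e * b + 0ℚ ≡ e * a + e * (b - a)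
  l = RS.solve-∀ ℚ-ring

inverse : ∀ {a} → 0ℚ <ℚ a → Σ ℚ λ b → 0ℚ <ℚ b × a * b ≡ 1ℚ
inverse {a} p = ℚ.1/ a , ℚ.positive⁻¹ (ℚ.1/ a) , ℚ.*-inverseʳ a
  where
  instance
    ia : ℚ.Positive a
    ia = ℚ.positive p
    ja : ℚ.NonZero a
    ja = ℚ.pos⇒nonZero a
    ka : ℚ.Positive (ℚ.1/ a)
    ka = ℚ.1/pos⇒pos a

0<1 : 0ℚ <ℚ 1ℚ
0<1 = ℚ.positive⁻¹ 1ℚ

*-cancel-0 : ∀ {a b} → 0ℚ <ℚ a → a * b ≡ 0ℚ → b ≡ 0ℚ
*-cancel-0 {a} {b} p e with inverse p
... | c , _ , ac = trans (sym (ℚ.*-identityˡ b)) (trans (cong (_* b) (sym ac))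
  (trans (l a b c) (trans (cong (c *_) e) (ℚ.*-zeroʳ c))))
  where
  l : ∀ a b c → a * c * b ≡ c * (a * b)
  l = RS.solve-∀ ℚ-ring

if-yes : ∀ {A : Set} {b} {x y : A} → T b → (if b then x else y) ≡ x
if-yes {b = true} _ = refl

if-no : ∀ {A : Set} {b} {x y : A} → ¬ T b → (if b then x else y) ≡ y
if-no {b = true}  ¬t = ⊥-elim (¬t tt)
if-no {b = false} _  = refl

⌊⌋-true : ∀ {P : Set} (d : Dec P) → P → ⌊ d ⌋ ≡ true
⌊⌋-true (yes _) _ = refl
⌊⌋-true (no ¬p) p = ⊥-elim (¬p p)

⌊⌋-true⁻ : ∀ {P : Set} (d : Dec P) → ⌊ d ⌋ ≡ true → P
⌊⌋-true⁻ (yes p) _ = p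

𝟙 : ∀ {p} {P : Set p} → Dec P → ℚ
𝟙 (yes _) = 1ℚ
𝟙 (no _)  = 0ℚ

𝟙-yes : ∀ {p} {P : Set p} (d : Dec P) → P → 𝟙 d ≡ 1ℚ
𝟙-yes (yes _) _ = refl
𝟙-yes (no ¬p) p = ⊥-elim (¬p p)

𝟙-no : ∀ {p} {P : Set p} (d : Dec P) → ¬ P → 𝟙 d ≡ 0ℚ
𝟙-no (yes p) ¬p = ⊥-elim (¬p p)
𝟙-no (no _)  _  = refl

0≤𝟙 : ∀ {p} {P : Set p} (d : Dec P) → 0ℚ ≤ℚ 𝟙 d
0≤𝟙 (yes _) = ℚ.<⇒≤ 0<1
0≤𝟙 (no _)  = ℚ.≤-refl

𝟙≤1 : ∀ {p} {P : Set p} (d : Dec P) → 𝟙 d ≤ℚ 1ℚ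
𝟙≤1 (yes _) = ℚ.≤-refl
𝟙≤1 (no _)  = ℚ.<⇒≤ 0<1

𝟙-mono : ∀ {p q} {P : Set p} {Q : Set q} (d : Dec P) (e : Dec Q) → (P → Q) → 𝟙 d ≤ℚ 𝟙 e
𝟙-mono (yes p) e f = ≤-eq (sym (𝟙-yes e (f p)))
𝟙-mono (no _)  e f = 0≤𝟙 e

𝟙-cong : ∀ {p q} {P : Set p} {Q : Set q} (d : Dec P) (e : Dec Q) → (P → Q) → (Q → P) → 𝟙 d ≡ 𝟙 e
𝟙-cong d e f g = ℚ.≤-antisym (𝟙-mono d e f) (𝟙-mono e d g)

-- An inequality with gap `g` whose defect grows at rate `δ` survives a perturbation of size ε.
-- Nothing is asked at `g` = 0: tight inequalities are settled by comparing derivatives instead.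
Slack : ℚ → ℚ × ℚ → Set
Slack ε (g , δ) = 0ℚ <ℚ g → ε * δ ≤ℚ g

slack-mono : ∀ {ε ε′} → 0ℚ ≤ℚ ε′ → ε′ ≤ℚ ε → ∀ {gδ} → Slack ε gδ → Slack ε′ gδ
slack-mono {ε} {ε′} 0≤ε′ ε′≤ε {g , δ} s 0<g with ℚ.≤-total 0ℚ δ
... | inj₁ 0≤δ = ℚ.≤-trans (subst₂ _≤ℚ_ (ℚ.*-comm δ ε′) (ℚ.*-comm δ ε) (*-mono 0≤δ ε′≤ε)) (s 0<g)
... | inj₂ δ≤0 = ℚ.≤-trans (*-nonneg-nonpos 0≤ε′ δ≤0) (ℚ.<⇒≤ 0<g)

slack₁ : ∀ gδ → Σ ℚ λ ε → 0ℚ <ℚ ε × Slack ε gδ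
slack₁ (g , δ) with 0ℚ ℚ.<? δ | 0ℚ ℚ.<? g
... | no δ≯0 | _ = 1ℚ , 0<1 , λ 0<g →
  ℚ.≤-trans (*-nonneg-nonpos (ℚ.<⇒≤ 0<1) (ℚ.≮⇒≥ δ≯0)) (ℚ.<⇒≤ 0<g)
... | yes _ | no g≯0 = 1ℚ , 0<1 , λ 0<g → ⊥-elim (g≯0 0<g)
... | yes 0<δ | yes 0<g with inverse 0<δ
... | c , 0<c , δc = g * c , *-pos 0<g 0<c , λ _ →
  ≤-eq (trans (l g c δ) (trans (cong (g *_) δc) (ℚ.*-identityʳ g)))
  where
  l : ∀ g c δ → g * c * δ ≡ g * (δ * c)
  l = RS.solve-∀ ℚ-ring

common-slack : (L : List (ℚ × ℚ)) → Σ ℚ λ ε → 0ℚ <ℚ ε × All (Slack ε) L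
common-slack [] = 1ℚ , 0<1 , []
common-slack (x ∷ L) with slack₁ x | common-slack L
... | ε₁ , p₁ , s₁ | ε₂ , p₂ , s₂ with ℚ.≤-total ε₁ ε₂
... | inj₁ le = ε₁ , p₁ , s₁ ∷ All.map (slack-mono (ℚ.<⇒≤ p₁) le) s₂
... | inj₂ le = ε₂ , p₂ , slack-mono (ℚ.<⇒≤ p₂) le s₁ ∷ s₂

-- Sums over integer intervals.

sumI : (ℕ → ℚ) → ℕ → ℕ → ℚ
sumI f lo zero    = 0ℚ
sumI f lo (suc k) = f lo + sumI f (suc lo) k

-- The upper bound hi is excluded.
Sum : (ℕ → ℚ) → ℕ → ℕ → ℚ
Sum f lo hi = sumI f lo (hi ∸ lo)

sumI-cong : ∀ {f g} lo k → (∀ c → lo ≤ c → c < lo ℕ.+ k → f c ≡ g c) → sumI f lo k ≡ sumI g lo k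
sumI-cong lo zero h = refl
sumI-cong lo (suc k) h = cong₂ _+_ (h lo ℕ.≤-refl (ℕ.m<m+n lo (s≤s z≤n)))
  (sumI-cong (suc lo) k λ c l u → h c (ℕ.<⇒≤ l) (subst (c <_) (sym (ℕ.+-suc lo k)) u))

sumI-snoc : ∀ f lo k → sumI f lo (suc k) ≡ sumI f lo k + f (lo ℕ.+ k)
sumI-snoc f lo zero = trans (ℚ.+-comm (f lo) 0ℚ) (cong (λ z → 0ℚ + f z) (sym (ℕ.+-identityʳ lo)))
sumI-snoc f lo (suc k) = trans (cong (f lo +_) (sumI-snoc f (suc lo) k))
  (trans (sym (ℚ.+-assoc (f lo) (sumI f (suc lo) k) (f (suc lo ℕ.+ k))))
         (cong (λ z → f lo + sumI f (suc lo) k + f z) (sym (ℕ.+-suc lo k))))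

sumℚ-range : ∀ f lo hi → sumℚ (map f (range lo hi)) ≡ sumI f lo (suc hi ∸ lo)
sumℚ-range f lo hi = go f (λ c → lo ℕ.+ c) lo (λ c → refl) (suc hi ∸ lo)
  where
  go : ∀ f (g : ℕ → ℕ) lo → (∀ c → lo ℕ.+ c ≡ g c) → ∀ k →
       sumℚ (map f (map g (upTo k))) ≡ sumI f lo k
  go f g lo e k = trans (cong (sumℚ ∘ map f) (map-applyUpTo id g k)) (go′ g lo e k)
    where
    go′ : ∀ (g : ℕ → ℕ) lo → (∀ c → lo ℕ.+ c ≡ g c) → ∀ k →
          sumℚ (map f (applyUpTo g k)) ≡ sumI f lo k
    go′ g lo e zero = refl
    go′ g lo e (suc k) = cong₂ _+_ (cong f (trans (sym (e 0)) (ℕ.+-identityʳ lo)))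
      (go′ (g ∘ suc) (suc lo) (λ c → trans (sym (ℕ.+-suc lo c)) (e (suc c))) k)

Sum-empty : ∀ f {lo hi} → hi ≤ lo → Sum f lo hi ≡ 0ℚ
Sum-empty f {lo} {hi} h = cong (sumI f lo) (ℕ.m≤n⇒m∸n≡0 h)

Sum-cons : ∀ f {lo hi} → lo < hi → Sum f lo hi ≡ f lo + Sum f (suc lo) hi
Sum-cons f {lo} {suc hi} (s≤s h) = cong (sumI f lo) (ℕ.+-∸-assoc 1 h)

Sum-snoc : ∀ f {lo hi} → lo ≤ hi → Sum f lo (suc hi) ≡ Sum f lo hi + f hi
Sum-snoc f {lo} {hi} h = trans (cong (sumI f lo) (ℕ.+-∸-assoc 1 h))
  (trans (sumI-snoc f lo (hi ∸ lo)) (cong (λ z → Sum f lo hi + f z) (ℕ.m+[n∸m]≡n h)))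

Sum-cong : ∀ {f g} lo hi → (∀ c → lo ≤ c → c < hi → f c ≡ g c) → Sum f lo hi ≡ Sum g lo hi
Sum-cong {f} {g} lo hi h with ℕ.≤-total lo hi
... | inj₁ lo≤hi = sumI-cong lo (hi ∸ lo) λ c l u → h c l (subst (c <_) (ℕ.m+[n∸m]≡n lo≤hi) u)
... | inj₂ hi≤lo = trans (Sum-empty f hi≤lo) (sym (Sum-empty g hi≤lo))

Sum-split : ∀ f {lo m hi} → lo ≤ m → m ≤ hi → Sum f lo hi ≡ Sum f lo m + Sum f m hi
Sum-split f {lo} {m} {hi} l≤m m≤h = subst (λ z → Sum f lo z ≡ Sum f lo m + Sum f m z) (ℕ.m+[n∸m]≡n m≤h) (go (hi ∸ m))
  where
  go : ∀ k → Sum f lo (m ℕ.+ k) ≡ Sum f lo m + Sum f m (m ℕ.+ k)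
  go zero rewrite ℕ.+-identityʳ m = trans (sym (ℚ.+-identityʳ _)) (cong (Sum f lo m +_) (sym (Sum-empty f {m} {m} ℕ.≤-refl)))
  go (suc k) rewrite ℕ.+-suc m k =
    trans (Sum-snoc f (ℕ.≤-trans l≤m (ℕ.m≤m+n m k)))
    (trans (cong (_+ f (m ℕ.+ k)) (go k))
    (trans (ℚ.+-assoc (Sum f lo m) (Sum f m (m ℕ.+ k)) (f (m ℕ.+ k)))
           (cong (Sum f lo m +_) (sym (Sum-snoc f (ℕ.m≤m+n m k))))))

Sum-zero : ∀ {f} lo hi → (∀ c → lo ≤ c → c < hi → f c ≡ 0ℚ) → Sum f lo hi ≡ 0ℚ
Sum-zero {f} lo hi h = trans (Sum-cong lo hi h) (go lo (hi ∸ lo))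
  where
  go : ∀ lo k → sumI (λ _ → 0ℚ) lo k ≡ 0ℚ
  go lo zero = refl
  go lo (suc k) = trans (ℚ.+-identityˡ _) (go (suc lo) k)

Sum-nonneg : ∀ {f} lo hi → (∀ c → lo ≤ c → c < hi → 0ℚ ≤ℚ f c) → 0ℚ ≤ℚ Sum f lo hi
Sum-nonneg {f} lo zero h = ≤-eq (sym (Sum-empty f {lo} {0} z≤n))
Sum-nonneg {f} lo (suc hi) h with lo ℕ.≤? hi
... | yes l = subst (0ℚ ≤ℚ_) (sym (Sum-snoc f l))
  (ℚ.≤-trans (Sum-nonneg lo hi λ c a b → h c a (ℕ.m<n⇒m<1+n b)) (a≤a+b (h hi l ℕ.≤-refl)))
... | no l = ≤-eq (sym (Sum-empty f (ℕ.≰⇒> l)))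

Sum-terms-zero : ∀ {f} lo hi → (∀ c → 0ℚ ≤ℚ f c) → Sum f lo hi ≤ℚ 0ℚ → ∀ c → lo ≤ c → c < hi → f c ≡ 0ℚ
Sum-terms-zero {f} lo hi h s c l u = ℚ.≤-antisym (ℚ.≤-trans (ℚ.≤-trans (a≤a+b (Sum-nonneg (suc c) hi λ c _ _ → h c))
  (subst (f c + Sum f (suc c) hi ≤ℚ_) e (a≤a+b (Sum-nonneg lo c λ c _ _ → h c)))) s) (h c)
  where
  e : f c + Sum f (suc c) hi + Sum f lo c ≡ Sum f lo hi
  e = trans (ℚ.+-comm (f c + Sum f (suc c) hi) (Sum f lo c)) (sym (trans (Sum-split f l (ℕ.<⇒≤ u)) (cong (Sum f lo c +_) (Sum-cons f u))))

Sum-lin : ∀ f g h α β lo hi → (∀ c → h c ≡ α * f c + β * g c) → Sum h lo hi ≡ α * Sum f lo hi + β * Sum g lo hi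
Sum-lin f g h α β lo hi e = go lo (hi ∸ lo)
  where
  l : ∀ α β a b c d → (α * a + β * b) + (α * c + β * d) ≡ α * (a + c) + β * (b + d)
  l = RS.solve-∀ ℚ-ring
  go : ∀ lo k → sumI h lo k ≡ α * sumI f lo k + β * sumI g lo k
  go lo zero = sym (trans (cong₂ _+_ (ℚ.*-zeroʳ α) (ℚ.*-zeroʳ β)) refl)
  go lo (suc k) = trans (cong₂ _+_ (e lo) (go (suc lo) k)) (l α β (f lo) (g lo) (sumI f (suc lo) k) (sumI g (suc lo) k))

-- Index pairs, the chain order and hooks.

X : Set
X = ℕ × ℕ

row col : X → ℕ
row = proj₁
col = proj₂

infix 8 _∙_
_∙_ : Pt → X → ℚ
x ∙ p = x (row p) (col p)

infix 4 _≼_ _≺_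
_≼_ : X → X → Set
p ≼ q = row p ≤ row q × col p ≤ col q

_≺_ : X → X → Set
p ≺ q = p ≼ q × (row p < row q ⊎ col p < col q)

_≺?_ : ∀ p q → Dec (p ≺ q)
p ≺? q = ((row p ℕ.≤? row q) ×-dec (col p ℕ.≤? col q)) ×-dec ((row p ℕ.<? row q) ⊎-dec (col p ℕ.<? col q))

≺-irrefl : ∀ {p} → ¬ p ≺ p
≺-irrefl (_ , h) = [ ℕ.<-irrefl refl , ℕ.<-irrefl refl ]′ h

≺-≼-trans : ∀ {p q r} → p ≺ q → q ≼ r → p ≺ r
≺-≼-trans ((a , b) , c) (d , e) = (ℕ.≤-trans a d , ℕ.≤-trans b e) ,
  [ (λ h → inj₁ (ℕ.<-≤-trans h d)) , (λ h → inj₂ (ℕ.<-≤-trans h e)) ]′ c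

≺-row : ∀ {p q} → row p < row q → col p ≤ col q → p ≺ q
≺-row h h′ = (ℕ.<⇒≤ h , h′) , inj₁ h

≺-col : ∀ {p q} → row p ≤ row q → col p < col q → p ≺ q
≺-col h h′ = (h , ℕ.<⇒≤ h′) , inj₂ h′

S-lin : ∀ (x y z : Pt) α β t → (∀ i j → z i j ≡ α * x i j + β * y i j) →
        S z t ≡ α * S x t + β * S y t
S-lin x y z α β [] h = sym (trans (cong₂ _+_ (ℚ.*-zeroʳ α) (ℚ.*-zeroʳ β)) refl)
S-lin x y z α β ((i , j) ∷ t) h = trans (cong₂ _+_ (h i j) (S-lin x y z α β t h))
  (l α β (x i j) (y i j) (S x t) (S y t))
  where
  l : ∀ α β a b c d → (α * a + β * b) + (α * c + β * d) ≡ α * (a + c) + β * (b + d)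
  l = RS.solve-∀ ℚ-ring

S-++ : ∀ x s t → S x (s ++ t) ≡ S x s + S x t
S-++ x [] t = sym (ℚ.+-identityˡ _)
S-++ x (p ∷ s) t = trans (cong (x ∙ p +_) (S-++ x s t)) (sym (ℚ.+-assoc (x ∙ p) (S x s) (S x t)))

S-zero : ∀ x t → All (λ p → x ∙ p ≡ 0ℚ) t → S x t ≡ 0ℚ
S-zero x [] [] = refl
S-zero x (p ∷ t) (e ∷ es) = trans (cong₂ _+_ e (S-zero x t es)) refl

-- `hook x (i , j)` is the sum along d^{i,j} (see `S-dA`). For points of U the column entries past
-- the antidiagonal are 0, so the same formula is also the sum along the type C path that stops
-- there.
rowSum colSum hook : Pt → X → ℚ
rowSum x p = Sum (x (row p)) (suc (row p)) (col p)
colSum x p = Sum (λ c → x c (col p)) (suc (row p)) (col p)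
hook x p = rowSum x p + x ∙ p + colSum x p

ℕtoℚ-nonneg : ∀ k → 0ℚ ≤ℚ ℕtoℚ k
ℕtoℚ-nonneg k = ℚ.nonNegative⁻¹ (ℕtoℚ k) {{ℚ.normalize-nonNeg k 1}}

ℕtoℚ-pos : ∀ {k} → 1 ≤ k → 0ℚ <ℚ ℕtoℚ k
ℕtoℚ-pos {suc k} _ = ℚ.positive⁻¹ (ℕtoℚ (suc k)) {{ℚ.normalize-pos (suc k) 1}}

⊔-+-lub : ∀ p q s {e} → p + s ≤ℚ e → q + s ≤ℚ e → (p ℚ.⊔ q) + s ≤ℚ e
⊔-+-lub p q s {e} h₁ h₂ with ℚ.⊔-sel p q
... | inj₁ eq = subst (λ z → z + s ≤ℚ e) (sym eq) h₁
... | inj₂ eq = subst (λ z → z + s ≤ℚ e) (sym eq) h₂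

-- A strict inequality is saved by the slack, an equality by the order of the derivatives.
tilt : ∀ {ε} x y δ γ → 0ℚ ≤ℚ ε → x ≤ℚ y → (x ≡ y → δ ≤ℚ γ) → Slack ε (y - x , δ - γ) → x + ε * δ ≤ℚ y + ε * γ
tilt {ε} x y δ γ 0≤ε x≤y eq sl with x ℚ.≟ y
... | yes refl = ℚ.+-monoʳ-≤ x (*-mono 0≤ε (eq refl))
... | no x≢y = by≤ (sl (a<b⇒0<b-a (≤∧≢⇒< x≤y x≢y))) (l ε x y δ γ)
  where
  l : ∀ ε x y δ γ → (y + ε * γ) + ε * (δ - γ) ≡ (x + ε * δ) + (y - x)
  l = RS.solve-∀ ℚ-ring

-- Finite sums with nonnegative terms.

sumFin-cong : ∀ m {f g : Fin m → ℚ} → (∀ k → f k ≡ g k) → sumFin m f ≡ sumFin m g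
sumFin-cong zero    h = refl
sumFin-cong (suc m) h = cong₂ _+_ (h fzero) (sumFin-cong m (h ∘ fsuc))

sumFin-zero : ∀ m {f : Fin m → ℚ} → (∀ k → f k ≡ 0ℚ) → sumFin m f ≡ 0ℚ
sumFin-zero zero    h = refl
sumFin-zero (suc m) h = trans (cong₂ _+_ (h fzero) (sumFin-zero m (h ∘ fsuc))) refl

sumFin-lin : ∀ m α β (f g : Fin m → ℚ) →
  sumFin m (λ k → α * f k + β * g k) ≡ α * sumFin m f + β * sumFin m g
sumFin-lin zero α β f g = sym (trans (cong₂ _+_ (ℚ.*-zeroʳ α) (ℚ.*-zeroʳ β)) refl)
sumFin-lin (suc m) α β f g = trans (cong ((α * f fzero + β * g fzero) +_) (sumFin-lin m α β (f ∘ fsuc) (g ∘ fsuc)))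
  (l α β (f fzero) (g fzero) (sumFin m (f ∘ fsuc)) (sumFin m (g ∘ fsuc)))
  where
  l : ∀ α β a b c d → (α * a + β * b) + (α * c + β * d) ≡ α * (a + c) + β * (b + d)
  l = RS.solve-∀ ℚ-ring

sumFin-nonneg : ∀ m {f : Fin m → ℚ} → (∀ k → 0ℚ ≤ℚ f k) → 0ℚ ≤ℚ sumFin m f
sumFin-nonneg zero    h = ℚ.≤-refl
sumFin-nonneg (suc m) h = h fzero ⊕ sumFin-nonneg m (h ∘ fsuc)

sumFin-single : ∀ m (f : Fin m → ℚ) k → (∀ k′ → ¬ k ≡ k′ → f k′ ≡ 0ℚ) → sumFin m f ≡ f k
sumFin-single (suc m) f fzero h = trans (cong (f fzero +_) (sumFin-zero m λ k → h (fsuc k) λ ())) (ℚ.+-identityʳ _)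
sumFin-single (suc m) f (fsuc k) h = trans (cong₂ _+_ (h fzero λ ())
  (sumFin-single m (f ∘ fsuc) k λ k′ ne → h (fsuc k′) (ne ∘ Fin.suc-injective))) (ℚ.+-identityˡ _)

term≤sumFin : ∀ m {f : Fin m → ℚ} → (∀ k → 0ℚ ≤ℚ f k) → ∀ k → f k ≤ℚ sumFin m f
term≤sumFin (suc m) h fzero = a≤a+b (sumFin-nonneg m (h ∘ fsuc))
term≤sumFin (suc m) {f} h (fsuc k) = ℚ.≤-trans (term≤sumFin m (h ∘ fsuc) k)
  (subst (sumFin m (f ∘ fsuc) ≤ℚ_) (ℚ.+-comm _ (f fzero)) (a≤a+b (h fzero)))

two-terms≤sumFin : ∀ m {f : Fin m → ℚ} → (∀ k → 0ℚ ≤ℚ f k) → ∀ k k′ → ¬ k ≡ k′ → f k + f k′ ≤ℚ sumFin m f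
two-terms≤sumFin (suc m) h fzero fzero ne = ⊥-elim (ne refl)
two-terms≤sumFin (suc m) {f} h fzero (fsuc k′) ne = ℚ.+-monoʳ-≤ (f fzero) (term≤sumFin m (h ∘ fsuc) k′)
two-terms≤sumFin (suc m) {f} h (fsuc k) fzero ne = subst (_≤ℚ sumFin (suc m) f) (ℚ.+-comm (f fzero) (f (fsuc k)))
  (ℚ.+-monoʳ-≤ (f fzero) (term≤sumFin m (h ∘ fsuc) k))
two-terms≤sumFin (suc m) {f} h (fsuc k) (fsuc k′) ne = ℚ.≤-trans (two-terms≤sumFin m (h ∘ fsuc) k k′ (ne ∘ cong fsuc))
  (subst (sumFin m (f ∘ fsuc) ≤ℚ_) (ℚ.+-comm _ (f fzero)) (a≤a+b (h fzero)))

sumFin-zero-terms : ∀ m {f : Fin m → ℚ} → (∀ k → 0ℚ ≤ℚ f k) → sumFin m f ≡ 0ℚ → ∀ k → f k ≡ 0ℚ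
sumFin-zero-terms m {f} h e k = ℚ.≤-antisym (subst (f k ≤ℚ_) e (term≤sumFin m h k)) (h k)

sumFin-pos-term : ∀ m {f : Fin m → ℚ} → 0ℚ <ℚ sumFin m f → Σ (Fin m) λ k → 0ℚ <ℚ f k
sumFin-pos-term zero h = ⊥-elim (<-irr h)
sumFin-pos-term (suc m) {f} h with 0ℚ ℚ.<? f fzero
... | yes p = fzero , p
... | no ¬p with sumFin-pos-term m {f ∘ fsuc} (ℚ.<-≤-trans h
        (subst (sumFin (suc m) f ≤ℚ_) (ℚ.+-identityˡ (sumFin m (f ∘ fsuc))) (ℚ.+-monoˡ-≤ (sumFin m (f ∘ fsuc)) (ℚ.≮⇒≥ ¬p))))
... | k , q = fsuc k , q

nonneg-pos-cases : ∀ {a} → 0ℚ ≤ℚ a → a ≡ 0ℚ ⊎ 0ℚ <ℚ a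
nonneg-pos-cases {a} h with a ℚ.≟ 0ℚ
... | yes e = inj₁ e
... | no ne = inj₂ (≤∧≢⇒< h (ne ∘ sym))

nonneg∧≯0⇒≡0 : ∀ {a} → 0ℚ ≤ℚ a → ¬ 0ℚ <ℚ a → a ≡ 0ℚ
nonneg∧≯0⇒≡0 h h′ = ℚ.≤-antisym (ℚ.≮⇒≥ h′) h

pos-factor : ∀ {a b} → 0ℚ ≤ℚ a → 0ℚ <ℚ a * b → 0ℚ <ℚ a × 0ℚ <ℚ b
pos-factor {a} {b} 0≤a 0<ab with nonneg-pos-cases 0≤a
... | inj₁ refl = ⊥-elim (<-irr (subst (0ℚ <ℚ_) (ℚ.*-zeroˡ b) 0<ab))
... | inj₂ 0<a with 0ℚ ℚ.<? b
... | yes 0<b = 0<a , 0<b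
... | no ¬0<b = ⊥-elim (≤⇒≯ (*-nonneg-nonpos 0≤a (ℚ.≮⇒≥ ¬0<b)) 0<ab)

_≟ₓ_ : (p q : X) → Dec (p ≡ q)
_≟ₓ_ = ≡-dec ℕ._≟_ ℕ._≟_

δ : X → Pt
δ z i j = 𝟙 (z ≟ₓ (i , j))

S-mono : ∀ {x y : Pt} t → (∀ i j → x i j ≤ℚ y i j) → S x t ≤ℚ S y t
S-mono []            h = ℚ.≤-refl
S-mono ((i , j) ∷ t) h = h i j ⊕ S-mono t h

upper-bound : (L : List ℚ) → Σ ℚ λ H → 0ℚ ≤ℚ H × All (_≤ℚ H) L
upper-bound [] = 0ℚ , ℚ.≤-refl , []
upper-bound (x ∷ L) with upper-bound L
... | H , 0≤H , hs = x ℚ.⊔ H , ℚ.≤-trans 0≤H (ℚ.p≤q⊔p x H) , ℚ.p≤p⊔q x H ∷ All.map (λ h → ℚ.≤-trans h (ℚ.p≤q⊔p x H)) hs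

-- Integrality.

IsInt : ℚ → Set
IsInt x = Σ ℤ λ z → toℚ z ≡ x

private
  toℚᵘ-toℚ : ∀ z → ℚ.toℚᵘ (toℚ z) ℚᵘ.≃ ℚᵘ.mkℚᵘ z 0
  toℚᵘ-toℚ z = ℚ.toℚᵘ-fromℚᵘ (ℚᵘ.mkℚᵘ z 0)

toℚ-+ : ∀ x y → toℚ (x ℤ.+ y) ≡ toℚ x + toℚ y
toℚ-+ x y = ℚ.toℚᵘ-injective (ℚᵘ.≃-trans (toℚᵘ-toℚ (x ℤ.+ y))
  (ℚᵘ.≃-trans (ℚᵘ.*≡* (cong (ℤ._* ℤ.+ 1) (cong₂ ℤ._+_ (sym (ℤ.*-identityʳ x)) (sym (ℤ.*-identityʳ y)))))
  (ℚᵘ.≃-sym (ℚᵘ.≃-trans (ℚ.toℚᵘ-homo-+ (toℚ x) (toℚ y)) (ℚᵘ.+-cong (toℚᵘ-toℚ x) (toℚᵘ-toℚ y))))))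

toℚ-neg : ∀ x → toℚ (ℤ.- x) ≡ - toℚ x
toℚ-neg x = ℚ.toℚᵘ-injective (ℚᵘ.≃-trans (toℚᵘ-toℚ (ℤ.- x))
  (ℚᵘ.≃-sym (ℚᵘ.≃-trans (ℚ.toℚᵘ-homo‿- (toℚ x)) (ℚᵘ.-‿cong (toℚᵘ-toℚ x)))))

int-+ : ∀ {x y} → IsInt x → IsInt y → IsInt (x + y)
int-+ (x , refl) (y , refl) = x ℤ.+ y , toℚ-+ x y

int-neg : ∀ {x} → IsInt x → IsInt (- x)
int-neg (x , refl) = ℤ.- x , toℚ-neg x

int-0 : IsInt 0ℚ
int-0 = ℤ.+ 0 , refl

int-𝟙 : ∀ {P : Set} (d : Dec P) → IsInt (𝟙 d)
int-𝟙 (yes _) = ℤ.+ 1 , refl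
int-𝟙 (no _)  = int-0

int-Sum : ∀ {f} → (∀ c → IsInt (f c)) → ∀ lo hi → IsInt (Sum f lo hi)
int-Sum {f} h lo hi = go lo (hi ∸ lo)
  where
  go : ∀ lo k → IsInt (sumI f lo k)
  go lo zero    = int-0
  go lo (suc k) = int-+ (h lo) (go (suc lo) k)

choose : ∀ {P : Set} → Dec P → ℚ → ℚ → ℚ
choose (yes _) x y = x
choose (no _)  x y = y

choose-yes : ∀ {P : Set} (d : Dec P) {x y} → P → choose d x y ≡ x
choose-yes (yes _) _ = refl
choose-yes (no ¬p) p = ⊥-elim (¬p p)

choose-no : ∀ {P : Set} (d : Dec P) {x y} → ¬ P → choose d x y ≡ y
choose-no (yes p) ¬p = ⊥-elim (¬p p)
choose-no (no _)  _  = refl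

int-choose : ∀ {P : Set} (d : Dec P) {x y} → IsInt x → IsInt y → IsInt (choose d x y)
int-choose (yes _) hx _ = hx
int-choose (no _)  _ hy = hy

lookup-injective : ∀ {xs : List X} → Unique xs → ∀ i j → lookup xs i ≡ lookup xs j → i ≡ j
lookup-injective (_ ∷ _) fzero fzero _ = refl
lookup-injective {x ∷ xs} (h ∷ _) fzero (fsuc j) e = ⊥-elim (All.lookup h (∈-lookup {xs = xs} j) e)
lookup-injective {x ∷ xs} (h ∷ _) (fsuc i) fzero e = ⊥-elim (All.lookup h (∈-lookup {xs = xs} i) (sym e))
lookup-injective (_ ∷ u) (fsuc i) (fsuc j) e = cong fsuc (lookup-injective u i j e)

-- Linear functionals and reflection of sums.

Linear : (Pt → ℚ) → Set
Linear Φ = ∀ x y z α β → (∀ i j → z i j ≡ α * x i j + β * y i j) → Φ z ≡ α * Φ x + β * Φ y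

hook-linear : ∀ p → Linear (λ x → hook x p)
hook-linear p x y z α β e = trans (cong₂ _+_ (cong₂ _+_
    (Sum-lin (x (row p)) (y (row p)) (z (row p)) α β (suc (row p)) (col p) (e (row p))) (e (row p) (col p)))
    (Sum-lin (λ c → x c (col p)) (λ c → y c (col p)) (λ c → z c (col p)) α β (suc (row p)) (col p) (λ c → e c (col p))))
  (l α β (rowSum x p) (rowSum y p) (x ∙ p) (y ∙ p) (colSum x p) (colSum y p))
  where
  l : ∀ α β a b c d e f → (α * a + β * b) + (α * c + β * d) + (α * e + β * f) ≡ α * (a + c + e) + β * (b + d + f)
  l = RS.solve-∀ ℚ-ring

linear-lin : ∀ {Φ} → Linear Φ → ∀ m c r → Φ (lin m c r) ≡ sumFin m (λ k → c k * Φ (λ i j → toℚ (r k i j)))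
linear-lin {Φ} h zero c r = trans (h (λ _ _ → 0ℚ) (λ _ _ → 0ℚ) (lin zero c r) 0ℚ 0ℚ (λ _ _ → refl)) (l (Φ (λ _ _ → 0ℚ)))
  where
  l : ∀ x → 0ℚ * x + 0ℚ * x ≡ 0ℚ
  l = RS.solve-∀ ℚ-ring
linear-lin {Φ} h (suc m) c r = trans
  (h (λ i j → toℚ (r fzero i j)) (lin m (c ∘ fsuc) (r ∘ fsuc)) (lin (suc m) c r) (c fzero) 1ℚ
     (λ i j → cong (c fzero * toℚ (r fzero i j) +_) (sym (ℚ.*-identityˡ (lin m (c ∘ fsuc) (r ∘ fsuc) i j)))))
  (cong (c fzero * Φ (λ i j → toℚ (r fzero i j)) +_)
    (trans (ℚ.*-identityˡ (Φ (lin m (c ∘ fsuc) (r ∘ fsuc)))) (linear-lin {Φ} h m (c ∘ fsuc) (r ∘ fsuc))))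

Sum-reverse : ∀ f k lo hi → lo ≤ hi → hi ≤ suc k → Sum (λ c → f (k ∸ c)) lo hi ≡ Sum f (suc k ∸ hi) (suc k ∸ lo)
Sum-reverse f k lo hi l≤h h≤k = trans (go (hi ∸ lo) lo (subst (_≤ suc k) (sym (ℕ.m+[n∸m]≡n l≤h)) h≤k))
  (cong₂ (sumI f) (cong (suc k ∸_) (ℕ.m+[n∸m]≡n l≤h)) len)
  where
  len : hi ∸ lo ≡ (suc k ∸ lo) ∸ (suc k ∸ hi)
  len = sym (trans (ℕ.∸-+-assoc (suc k) lo (suc k ∸ hi)) (trans (cong (suc k ∸_) (ℕ.+-comm lo (suc k ∸ hi)))
    (trans (sym (ℕ.∸-+-assoc (suc k) (suc k ∸ hi) lo)) (cong (_∸ lo) (ℕ.m∸[m∸n]≡n h≤k)))))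
  go : ∀ d lo → lo ℕ.+ d ≤ suc k → sumI (λ c → f (k ∸ c)) lo d ≡ sumI f (suc k ∸ (lo ℕ.+ d)) d
  go zero lo h = refl
  go (suc d) lo h = trans (cong (f (k ∸ lo) +_) (go d (suc lo) (subst (_≤ suc k) (ℕ.+-suc lo d) h)))
    (trans (ℚ.+-comm (f (k ∸ lo)) _) (trans (cong₂ _+_ (cong (λ z → sumI f (suc k ∸ z) d) (sym (ℕ.+-suc lo d))) (cong f e))
      (sym (sumI-snoc f (suc k ∸ (lo ℕ.+ suc d)) d))))
    where
    h′ : lo ℕ.+ d ≤ k
    h′ = ℕ.≤-pred (subst (_≤ suc k) (ℕ.+-suc lo d) h)
    e : k ∸ lo ≡ (suc k ∸ (lo ℕ.+ suc d)) ℕ.+ d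
    e = sym (trans (cong (λ z → (suc k ∸ z) ℕ.+ d) (ℕ.+-suc lo d)) (trans (cong (ℕ._+ d) (sym (ℕ.∸-+-assoc k lo d)))
      (ℕ.m∸n+n≡m (ℕ.m+n≤o⇒m≤o∸n d (subst (_≤ k) (ℕ.+-comm lo d) h′)))))

S-map : ∀ y (g : ℕ → X) l → S y (map g l) ≡ sumℚ (map (λ c → y ∙ g c) l)
S-map y g []      = refl
S-map y g (c ∷ l) = cong (y ∙ g c +_) (S-map y g l)

S-dA : ∀ y {i j} → i < j → S y (dA i j) ≡ hook y (i , j)
S-dA y {i} {suc j} (s≤s i≤j) = trans (S-++ y (map (λ k → (i , k)) (range (suc i) (suc j))) (map (λ k → (k , suc j)) (range (suc i) j)))
  (cong₂ _+_ (trans (S-map y (λ k → (i , k)) (range (suc i) (suc j))) (trans (sumℚ-range (y i) (suc i) (suc j)) (Sum-snoc (y i) (s≤s i≤j))))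
             (trans (S-map y (λ k → (k , suc j)) (range (suc i) j)) (sumℚ-range (λ c → y c (suc j)) (suc i) j)))

double-cancel : ∀ {x y} → x + x ≡ y + y → x ≡ y
double-cancel {x} {y} e with ℚ.<-cmp x y
... | tri< h _ _ = ⊥-elim (ℚ.<-irrefl e (ℚ.+-mono-< h h))
... | tri≈ _ h _ = h
... | tri> _ _ h = ⊥-elim (ℚ.<-irrefl (sym e) (ℚ.+-mono-< h h))

cancel-+ : ∀ a {x y} → a + x ≡ a + y → x ≡ y
cancel-+ a {x} {y} e = ℚ.≤-antisym (+-cancel-≤ {a} (≤-eq e)) (+-cancel-≤ {a} (≤-eq (sym e)))

-- Nodes, partial sums of `a`, and the bounds of a chain.

module Setting (n : ℕ) (a : ℕ → ℕ) (a-pos : ∀ i → 1 ≤ i → i ≤ n → 1 ≤ a i) where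

  K : ℕ
  K = 2 ℕ.* n ℕ.+ 1

  K≡ : K ≡ suc (n ℕ.+ n)
  K≡ = trans (ℕ.+-comm (2 ℕ.* n) 1) (cong (λ z → suc (n ℕ.+ z)) (ℕ.+-identityʳ n))

  Node : X → Set
  Node p = InRange n (row p) (col p)

  node? : ∀ p → Dec (Node p)
  node? (i , j) = (1 ℕ.≤? i) ×-dec ((i ℕ.<? j) ×-dec (i ℕ.+ j ℕ.≤? K))

  1≤row : ∀ {p} → Node p → 1 ≤ row p
  1≤row = proj₁

  row<col : ∀ {p} → Node p → row p < col p
  row<col = proj₁ ∘ proj₂

  row+col≤K : ∀ {p} → Node p → row p ℕ.+ col p ≤ K
  row+col≤K = proj₂ ∘ proj₂

  row≤n : ∀ {p} → Node p → row p ≤ n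
  row≤n {i , j} (_ , i<j , s) with i ℕ.≤? n
  ... | yes h = h
  ... | no h = ⊥-elim (ℕ.<-irrefl refl (ℕ.≤-trans (ℕ.≤-reflexive (cong suc (sym (ℕ.+-suc n n))))
    (ℕ.≤-trans (ℕ.+-mono-≤ (ℕ.≰⇒> h) (ℕ.≤-trans (ℕ.≰⇒> h) (ℕ.<⇒≤ i<j))) (ℕ.≤-trans s (ℕ.≤-reflexive K≡)))))

  nodes : List X
  nodes = cartesianProduct (upTo (suc K)) (upTo (suc K))

  node-∈ : ∀ {p} → Node p → p ∈ nodes
  node-∈ {i , j} (_ , _ , s) = ∈-cartesianProduct⁺
    (∈-upTo⁺ (s≤s (ℕ.≤-trans (ℕ.m≤m+n i j) s))) (∈-upTo⁺ (s≤s (ℕ.≤-trans (ℕ.m≤n+m j i) s)))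

  search : ∀ {P : X → Set} → (∀ p → Dec (P p)) → (∃ P) ⊎ (∀ p → Node p → ¬ P p)
  search P? with any? P? nodes
  ... | yes h = inj₁ (satisfied h)
  ... | no h = inj₂ λ p np pp → h (lose (node-∈ np) pp)

  A : ℕ → ℚ
  A zero    = 0ℚ
  A (suc k) = A k + ℕtoℚ (a (suc k))

  A-mono : ∀ {i j} → i ≤ j → A i ≤ℚ A j
  A-mono {i} {j} h = subst (λ z → A i ≤ℚ A z) (ℕ.m+[n∸m]≡n h) (go (j ∸ i))
    where
    go : ∀ k → A i ≤ℚ A (i ℕ.+ k)
    go zero = ≤-eq (cong A (sym (ℕ.+-identityʳ i)))
    go (suc k) rewrite ℕ.+-suc i k = ℚ.≤-trans (go k) (a≤a+b (ℕtoℚ-nonneg (a (suc (i ℕ.+ k)))))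

  A-strict : ∀ {i j} → i < j → j ≤ n → A i <ℚ A j
  A-strict {i} {suc j} (s≤s i≤j) j<n =
    ℚ.≤-<-trans (A-mono i≤j) (a<a+b (ℕtoℚ-pos (a-pos (suc j) (s≤s z≤n) j<n)))

  A-reflect-< : ∀ {i j} → A i <ℚ A j → i < j
  A-reflect-< {i} {j} h with i ℕ.<? j
  ... | yes p = p
  ... | no p  = ⊥-elim (≤⇒≯ (A-mono (ℕ.≮⇒≥ p)) h)

  -- A chain from p to q has sum at most `up q` - `lo p`. At an inner node `up` is the bound of the
  -- path prolonged down its column, to the diagonal if the column is at most n and to the
  -- antidiagonal otherwise; hence the minimum with n.
  lo up : X → ℚ
  lo p = A (row p ∸ 1)
  up p = A ((col p ∸ 1) ℕ.⊓ n)

  lo-mono : ∀ {p q} → row p ≤ row q → lo p ≤ℚ lo q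
  lo-mono h = A-mono (ℕ.∸-monoˡ-≤ 1 h)

  up-mono : ∀ {p q} → col p ≤ col q → up p ≤ℚ up q
  up-mono h = A-mono (ℕ.⊓-mono-≤ (ℕ.∸-monoˡ-≤ 1 h) ℕ.≤-refl)

  lo-strict : ∀ {p q} → Node p → Node q → row p < row q → lo p <ℚ lo q
  lo-strict {suc i , _} {suc k , _} np nq (s≤s h) = A-strict h (ℕ.<⇒≤ (row≤n nq))

  lo≤up : ∀ {p q} → Node q → row p ≤ row q → lo p ≤ℚ up q
  lo≤up {p} {q} nq h = A-mono (ℕ.⊓-glb (ℕ.∸-monoˡ-≤ 1 (ℕ.≤-trans h (ℕ.<⇒≤ (row<col nq))))
    (ℕ.≤-trans (ℕ.m∸n≤m (row p) 1) (ℕ.≤-trans h (row≤n nq))))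

  -- From column n + 1 on the bound is constantly `A n`. This is where strictness fails and the
  -- central segments have to step in.
  up-strict : ∀ {p q} → Node p → col p ≤ n → col p < col q → up p <ℚ up q
  up-strict {_ , suc j} {_ , suc l} _ j<n (s≤s h) =
    A-strict (ℕ.≤-<-trans (ℕ.m⊓n≤m j n) (ℕ.⊓-glb h j<n)) (ℕ.m⊓n≤n l n)

  up<lo : ∀ {p q} → Node p → Node q → col p < row q → up p <ℚ lo q
  up<lo {_ , suc j} {suc k , _} _ nq (s≤s h) =
    A-strict (ℕ.≤-<-trans (ℕ.m⊓n≤m j n) h) (ℕ.<⇒≤ (row≤n nq))

  lo<up : ∀ {p} → Node p → lo p <ℚ up p
  lo<up {suc i , j} np@(_ , s≤s h , _) = A-strict {i} (ℕ.⊓-glb h (row≤n np)) (ℕ.m⊓n≤n (j ∸ 1) n)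

  -- `π p` is what may have been collected before p, the entry at p excluded. Links are required for
  -- all p ≺ q and not only for neighbours, so that chains may skip the zeros of `x`.
  record Pot (x : Pt) : Set where
    field
      π       : X → ℚ
      lo≤π    : ∀ {p} → Node p → lo p ≤ℚ π p
      π-link  : ∀ {p q} → Node p → Node q → p ≺ q → π p + x ∙ p ≤ℚ π q
      π+x≤up  : ∀ {p} → Node p → π p + x ∙ p ≤ℚ up p

  -- The longest-path potential of a point of P.

  last-node : ∀ p ps → StepsFrom n p ps → Node (lastP p ps) × p ≼ lastP p ps
  last-node p [] st = st , ℕ.≤-refl , ℕ.≤-refl
  last-node (i , j) (q ∷ qs) (_ , s , st) with last-node q qs st
  ... | nl , r , c with s
  ... | inj₁ (refl , refl) = nl , ℕ.≤-trans (ℕ.n≤1+n i) r , c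
  ... | inj₂ (refl , refl) = nl , r , ℕ.≤-trans (ℕ.n≤1+n j) c

  A-aSum : ∀ {l h} → 1 ≤ l → l ≤ suc h → A (l ∸ 1) + aSum a l h ≡ A h
  A-aSum {suc l} {h} _ (s≤s l≤h) = trans (cong (A l +_) (sumℚ-range _ (suc l) h))
    (trans (go l (h ∸ l)) (cong A (ℕ.m+[n∸m]≡n l≤h)))
    where
    go : ∀ l k → A l + sumI (λ k → ℕtoℚ (a k)) (suc l) k ≡ A (l ℕ.+ k)
    go l zero = trans (ℚ.+-identityʳ (A l)) (cong A (sym (ℕ.+-identityʳ l)))
    go l (suc k) = trans (sym (ℚ.+-assoc (A l) _ _)) (trans (go (suc l) k) (cong A (sym (ℕ.+-suc l k))))

  n≤col-1 : ∀ {p} → Node p → row p ℕ.+ col p ≡ K → n ≤ col p ∸ 1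
  n≤col-1 {i , zero} (_ , () , _) e
  n≤col-1 {i , suc j} np e with n ℕ.≤? j
  ... | yes h = h
  ... | no h = ⊥-elim (ℕ.<-irrefl (trans (sym (ℕ.+-suc i j)) (trans e K≡))
                 (s≤s (ℕ.+-mono-≤-< (row≤n np) (ℕ.≰⇒> h))) )

  up-diag : ∀ {i j} → Node (i , j) → j ≡ suc i → up (i , j) ≡ A i
  up-diag np refl = cong A (ℕ.m≤n⇒m⊓n≡m (row≤n np))

  up-anti : ∀ {p} → Node p → row p ℕ.+ col p ≡ K → up p ≡ A n
  up-anti np e = cong A (ℕ.m≥n⇒m⊓n≡n (n≤col-1 np e))

  -- Telescoping; the two kinds of path end correspond to the two ways in which the minimum in `up`
  -- is attained.
  lo+M : ∀ p ps → StepsFrom n p ps → EndOK n (lastP p ps) → lo p + M n a p ps ≡ up (lastP p ps)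
  lo+M (i₁ , j₁) ps st e with 1≤row (first ps st) | row≤n (first ps st)
    where
    first : ∀ ps → StepsFrom n (i₁ , j₁) ps → Node (i₁ , j₁)
    first []      s = s
    first (_ ∷ _) s = proj₁ s
  ... | 1≤i₁ | i₁≤n with lastP (i₁ , j₁) ps | last-node (i₁ , j₁) ps st
  ... | (iN , jN) | nl , i₁≤iN , _ with jN ℕ.≡ᵇ suc iN in eq
  ... | true  = trans (A-aSum 1≤i₁ (ℕ.m≤n⇒m≤1+n i₁≤iN))
                      (sym (up-diag nl (ℕ.≡ᵇ⇒≡ jN (suc iN) (subst T (sym eq) tt))))
  ... | false with e
  ...   | inj₁ refl = ⊥-elim (subst T eq (ℕ.≡⇒≡ᵇ iN iN refl))
  ...   | inj₂ anti = trans (A-aSum 1≤i₁ (ℕ.m≤n⇒m≤1+n i₁≤n)) (sym (up-anti nl anti))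

  -- pot x i j is the largest value of A (s - 1) plus the sum of x along a path from (s , s + 1) to (i , j),
  -- the last point excluded. It is abstract because its unfolding grows exponentially.
  abstract
    pot : Pt → ℕ → ℕ → ℚ
    pot x zero    j       = 0ℚ
    pot x (suc i) zero    = A i
    pot x (suc i) (suc j) = (A i ℚ.⊔ (pot x i (suc j) + x i (suc j))) ℚ.⊔
      (if suc i ℕ.<ᵇ j then pot x (suc i) j + x (suc i) j else A i)

    pot-lub : ∀ x i j {s e} → x 0 (suc j) ≡ 0ℚ → A i + s ≤ℚ e → (1 ≤ i → pot x i (suc j) + x i (suc j) + s ≤ℚ e) →
              (suc i < j → pot x (suc i) j + x (suc i) j + s ≤ℚ e) → pot x (suc i) (suc j) + s ≤ℚ e
    pot-lub x i j {s} {e} x0 base above left = ⊔-+-lub (A i ℚ.⊔ (pot x i (suc j) + x i (suc j))) L s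
        (⊔-+-lub (A i) (pot x i (suc j) + x i (suc j)) s base (above′ i base above)) left′
      where
      L : ℚ
      L = if suc i ℕ.<ᵇ j then pot x (suc i) j + x (suc i) j else A i
      above′ : ∀ i → A i + s ≤ℚ e → (1 ≤ i → pot x i (suc j) + x i (suc j) + s ≤ℚ e) → pot x i (suc j) + x i (suc j) + s ≤ℚ e
      above′ zero    base _     = subst (λ z → 0ℚ + z + s ≤ℚ e) (sym x0) base
      above′ (suc i) _    above = above (s≤s z≤n)
      left′ : L + s ≤ℚ e
      left′ with suc i ℕ.<ᵇ j in eq
      ... | false = base
      ... | true  = left (ℕ.<ᵇ⇒< (suc i) j (subst T (sym eq) tt))

    lo≤pot : ∀ x i j → A i ≤ℚ pot x (suc i) (suc j)
    lo≤pot x i j = ℚ.≤-trans (ℚ.p≤p⊔q (A i) _) (ℚ.p≤p⊔q _ _)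

    pot-down : ∀ x i j → pot x (suc i) (suc j) + x (suc i) (suc j) ≤ℚ pot x (suc (suc i)) (suc j)
    pot-down x i j = ℚ.≤-trans (ℚ.p≤q⊔p (A (suc i)) _) (ℚ.p≤p⊔q _ _)

    pot-right : ∀ x i j → i < j → pot x (suc i) (suc j) + x (suc i) (suc j) ≤ℚ pot x (suc i) (suc (suc j))
    pot-right x i j i<j = ℚ.≤-trans (≤-eq (sym (if-yes (ℕ.<⇒<ᵇ (s≤s i<j))))) (ℚ.p≤q⊔p (A i ℚ.⊔ (pot x i (suc (suc j)) + x i (suc (suc j)))) _)

  module _ {x : Pt} (x∈P : InP n a x) where

    private
      x-zero : ∀ {p} → ¬ Node p → x ∙ p ≡ 0ℚ
      x-zero = proj₁ x∈P _ _

      x-nonneg : ∀ {p} → Node p → 0ℚ ≤ℚ x ∙ p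
      x-nonneg = proj₁ (proj₂ x∈P) _ _

    -- Prolong the path to the left as far as (i , i + 1). The new entries are nonnegative, so the
    -- inequality of the longer Dyck path suffices.
    row-start : ∀ i j → Node (i , j) → ∀ ps → StepsFrom n (i , j) ps → EndOK n (lastP (i , j) ps) →
                A (i ∸ 1) + S x ((i , j) ∷ ps) ≤ℚ up (lastP (i , j) ps)
    row-start i zero (_ , () , _)
    row-start i (suc j) nd@(1≤i , s≤s i≤j , s) ps st e with i ℕ.<? j
    ... | yes i<j = ℚ.≤-trans (ℚ.+-monoʳ-≤ (A (i ∸ 1)) (subst (S x ((i , suc j) ∷ ps) ≤ℚ_) (ℚ.+-comm _ (x i j)) (a≤a+b (x-nonneg nd′))))
                      (row-start i j nd′ ((i , suc j) ∷ ps) (nd′ , inj₂ (refl , refl) , st) e)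
      where
      nd′ : Node (i , j)
      nd′ = 1≤i , i<j , ℕ.≤-trans (ℕ.+-monoʳ-≤ i (ℕ.n≤1+n j)) s
    ... | no i≮j with ℕ.≤-antisym i≤j (ℕ.≮⇒≥ i≮j)
    ... | refl = subst (A (i ∸ 1) + S x ((i , suc i) ∷ ps) ≤ℚ_) (lo+M (i , suc i) ps st e)
                   (ℚ.+-monoʳ-≤ (A (i ∸ 1)) (proj₂ (proj₂ x∈P) (i , suc i) ps (refl , st , e)))

    -- Each unfolding of the maximum in `pot` moves the front of the path one step back, up or to
    -- the left, until `row-start` applies.
    pot-tail : ∀ i j → Node (i , j) → ∀ ps → StepsFrom n (i , j) ps → EndOK n (lastP (i , j) ps) →
               pot x i j + S x ((i , j) ∷ ps) ≤ℚ up (lastP (i , j) ps)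
    pot-tail zero j (() , _)
    pot-tail (suc i) zero (_ , () , _)
    pot-tail (suc i) (suc j) nd@(_ , i<j , s) ps st e = pot-lub x i j (x-zero {0 , suc j} λ ())
        (row-start (suc i) (suc j) nd ps st e) above left
      where
      E = up (lastP (suc i , suc j) ps)
      s₀ = S x ((suc i , suc j) ∷ ps)
      above : 1 ≤ i → pot x i (suc j) + x i (suc j) + s₀ ≤ℚ E
      above 1≤i = subst (_≤ℚ E) (sym (ℚ.+-assoc (pot x i (suc j)) (x i (suc j)) s₀))
          (pot-tail i (suc j) nd′ ((suc i , suc j) ∷ ps) (nd′ , inj₁ (refl , refl) , st) e)
        where
        nd′ : Node (i , suc j)
        nd′ = 1≤i , ℕ.<-trans (ℕ.n<1+n i) i<j , ℕ.≤-trans (ℕ.n≤1+n _) s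
      left : suc i < j → pot x (suc i) j + x (suc i) j + s₀ ≤ℚ E
      left h = subst (_≤ℚ E) (sym (ℚ.+-assoc (pot x (suc i) j) (x (suc i) j) s₀))
          (pot-tail (suc i) j nd′ ((suc i , suc j) ∷ ps) (nd′ , inj₂ (refl , refl) , st) e)
        where
        nd′ : Node (suc i , j)
        nd′ = s≤s z≤n , h , ℕ.≤-trans (ℕ.+-monoʳ-≤ (suc i) (ℕ.n≤1+n j)) s

    private
      π′ : X → ℚ
      π′ p = pot x (row p) (col p)

    π-right : ∀ i j d → Node (i , suc d ℕ.+ j) → Node (i , j) → π′ (i , j) + x i j ≤ℚ π′ (i , suc d ℕ.+ j)
    π-right (suc i) zero d _ (_ , () , _)
    π-right zero _ d _ (() , _)
    π-right (suc i) (suc j) zero n₁ (_ , s≤s h , _) = pot-right x i j h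
    π-right (suc i) (suc j) (suc d) n₁ n₂ = ℚ.≤-trans (π-right (suc i) (suc j) d n₃ n₂)
      (ℚ.≤-trans (a≤a+b (x-nonneg n₃)) (pot-right x i (d ℕ.+ suc j) (ℕ.≤-pred (row<col n₃))))
      where
      n₃ : Node (suc i , suc d ℕ.+ suc j)
      n₃ = s≤s z≤n , ℕ.<-≤-trans (row<col n₂) (ℕ.m≤n+m (suc j) (suc d)) ,
           ℕ.≤-trans (ℕ.+-monoʳ-≤ (suc i) (ℕ.n≤1+n _)) (row+col≤K n₁)

    π-down : ∀ i j d → Node (suc d ℕ.+ i , j) → Node (i , j) → π′ (i , j) + x i j ≤ℚ π′ (suc d ℕ.+ i , j)
    π-down (suc i) zero d _ (_ , () , _)
    π-down zero _ d _ (() , _)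
    π-down (suc i) (suc j) zero n₁ n₂ = pot-down x i j
    π-down (suc i) (suc j) (suc d) n₁ n₂ = ℚ.≤-trans (π-down (suc i) (suc j) d n₃ n₂)
      (ℚ.≤-trans (a≤a+b (x-nonneg n₃)) (pot-down x (d ℕ.+ suc i) j))
      where
      n₃ : Node (suc d ℕ.+ suc i , suc j)
      n₃ = s≤s z≤n , ℕ.<-trans (ℕ.n<1+n _) (row<col n₁) , ℕ.≤-trans (ℕ.n≤1+n _) (row+col≤K n₁)

    -- A node where no path may end lies above another node of its column, and `up` is the same
    -- there.
    π-up : ∀ d i j → j ≤ d ℕ.+ i → Node (i , j) → π′ (i , j) + x i j ≤ℚ up (i , j)
    π-up zero i j h nd = ⊥-elim (ℕ.<-irrefl refl (ℕ.<-≤-trans (row<col nd) h))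
    π-up (suc d) i j h nd with j ℕ.≟ suc i | i ℕ.+ j ℕ.≟ K
    ... | yes e | _ = subst (_≤ℚ up (i , j)) (cong (pot x i j +_) (ℚ.+-identityʳ (x i j))) (pot-tail i j nd [] nd (inj₁ e))
    ... | no _ | yes e = subst (_≤ℚ up (i , j)) (cong (pot x i j +_) (ℚ.+-identityʳ (x i j))) (pot-tail i j nd [] nd (inj₂ e))
    ... | no ne₁ | no ne₂ = ℚ.≤-trans (ℚ.≤-trans (π-down i j 0 nd′ nd) (a≤a+b (x-nonneg nd′)))
                                       (π-up d (suc i) j (subst (j ≤_) (sym (ℕ.+-suc d i)) h) nd′)
      where
      nd′ : Node (suc i , j)
      nd′ = s≤s z≤n , ℕ.≤∧≢⇒< (row<col nd) (ne₁ ∘ sym) , ℕ.≤∧≢⇒< (row+col≤K nd) ne₂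

    potential : Pot x
    potential = record
      { π      = π′
      ; lo≤π   = λ { {suc i , suc j} _ → lo≤pot x i j
                   ; {suc i , zero} (_ , () , _) ; {zero , _} (() , _) }
      ; π-link = link
      ; π+x≤up = λ { {i , j} nd → π-up j i j (ℕ.m≤m+n j i) nd } }
      where
      link : ∀ {p q} → Node p → Node q → p ≺ q → π′ p + x ∙ p ≤ℚ π′ q
      link {i , j} {k , l} np nq ((i≤k , j≤l) , s) = go (ℕ.m≤n⇒m<n∨m≡n j≤l) (ℕ.m≤n⇒m<n∨m≡n i≤k)
        where
        right : ∀ {j l} → j < l → Node (i , j) → Node (i , l) → π′ (i , j) + x i j ≤ℚ π′ (i , l)
        right {j} {l} j<l n₁ n₂ = subst (λ z → Node (i , z) → π′ (i , j) + x i j ≤ℚ π′ (i , z)) e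
          (λ n₂ → π-right i j (l ∸ suc j) n₂ n₁) n₂
          where
          e : suc (l ∸ suc j) ℕ.+ j ≡ l
          e = trans (sym (ℕ.+-suc (l ∸ suc j) j)) (ℕ.m∸n+n≡m j<l)
        down : ∀ {i k l} → i < k → Node (i , l) → Node (k , l) → π′ (i , l) + x i l ≤ℚ π′ (k , l)
        down {i} {k} {l} i<k n₁ n₂ = subst (λ z → Node (z , l) → π′ (i , l) + x i l ≤ℚ π′ (z , l)) e
          (λ n₂ → π-down i l (k ∸ suc i) n₂ n₁) n₂
          where
          e : suc (k ∸ suc i) ℕ.+ i ≡ k
          e = trans (sym (ℕ.+-suc (k ∸ suc i) i)) (ℕ.m∸n+n≡m i<k)
        go : j < l ⊎ j ≡ l → i < k ⊎ i ≡ k → π′ (i , j) + x i j ≤ℚ π′ (k , l)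
        go (inj₁ j<l) (inj₂ refl) = right j<l np nq
        go (inj₂ refl) (inj₁ i<k) = down i<k np nq
        -- Right first: (i , l) is always a node, whereas (k , j) may violate k < j.
        go (inj₁ j<l) (inj₁ i<k) = ℚ.≤-trans (right j<l np nm) (ℚ.≤-trans (a≤a+b (x-nonneg nm)) (down i<k nm nq))
          where
          nm : Node (i , l)
          nm = 1≤row np , ℕ.<-trans (row<col np) j<l , ℕ.≤-trans (ℕ.+-monoˡ-≤ l i≤k) (row+col≤K nq)
        go (inj₂ refl) (inj₂ refl) = ⊥-elim (≺-irrefl {i , j} ((ℕ.≤-refl , ℕ.≤-refl) , s))

    open Pot potential

    row-between : ∀ i j d → Node (i , j) → Node (i , d ℕ.+ j) → π (i , j) + Sum (x i) j (d ℕ.+ j) ≤ℚ π (i , d ℕ.+ j)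
    row-between i j zero n₁ n₂ = ≤-eq (trans (cong (π (i , j) +_) (Sum-empty (x i) {j} {j} ℕ.≤-refl)) (ℚ.+-identityʳ (π (i , j))))
    row-between i j (suc d) n₁ n₂ = ℚ.≤-trans (≤-eq (trans (cong (π (i , j) +_) (Sum-snoc (x i) (ℕ.m≤n+m j d)))
        (sym (ℚ.+-assoc (π (i , j)) (Sum (x i) j (d ℕ.+ j)) (x i (d ℕ.+ j))))))
      (ℚ.≤-trans (ℚ.+-monoˡ-≤ (x i (d ℕ.+ j)) (row-between i j d n₁ n₃)) (π-link n₃ n₂ ((ℕ.≤-refl , ℕ.n≤1+n _) , inj₂ ℕ.≤-refl)))
      where
      n₃ : Node (i , d ℕ.+ j)
      n₃ = 1≤row n₁ , ℕ.<-≤-trans (row<col n₁) (ℕ.m≤n+m j d) , ℕ.≤-trans (ℕ.+-monoʳ-≤ i (ℕ.n≤1+n _)) (row+col≤K n₂)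

    row-bound : ∀ {p} → Node p → lo p + rowSum x p ≤ℚ π p
    row-bound {i , j} np = subst (λ z → Node (i , z) → lo (i , z) + Sum (x i) (suc i) z ≤ℚ π (i , z)) (ℕ.m∸n+n≡m (row<col np))
      (λ nz → ℚ.≤-trans (ℚ.+-monoˡ-≤ (Sum (x i) (suc i) (j ∸ suc i ℕ.+ suc i)) (lo≤π n₀)) (row-between i (suc i) (j ∸ suc i) n₀ nz)) np
      where
      n₀ : Node (i , suc i)
      n₀ = 1≤row np , ℕ.≤-refl , ℕ.≤-trans (ℕ.+-monoʳ-≤ i (row<col np)) (row+col≤K np)

    col-bound : ∀ {p} → Node p → π p + x ∙ p + colSum x p ≤ℚ up p
    col-bound {i , l} np = go (l ∸ i) i np (ℕ.≤-reflexive (sym (ℕ.m∸n+n≡m (ℕ.<⇒≤ (row<col np)))))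
      where
      f : ℕ → ℚ
      f c = x c l
      go : ∀ N i → Node (i , l) → l ≤ N ℕ.+ i → π (i , l) + x i l + Sum f (suc i) l ≤ℚ up (i , l)
      go zero i np h = ⊥-elim (ℕ.<⇒≱ (row<col np) h)
      go (suc N) i np h with node? (suc i , l)
      ... | yes n′ = ℚ.≤-trans (≤-eq (cong (π (i , l) + x i l +_) (Sum-cons f (row<col n′))))
            (ℚ.≤-trans (by≤ (π-link np n′ ((ℕ.n≤1+n i , ℕ.≤-refl) , inj₁ ℕ.≤-refl)) (q (π (i , l) + x i l) (π (suc i , l)) (f (suc i)) (Sum f (suc (suc i)) l)))
              (go N (suc i) n′ (subst (l ≤_) (sym (ℕ.+-suc N i)) h)))
        where
        q : ∀ a b c d → (b + c + d) + a ≡ (a + (c + d)) + b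
        q = RS.solve-∀ ℚ-ring
      -- Once the next entry of the column is no node, no later one is, and the rest of the sum is
      -- 0.
      ... | no ¬n = ℚ.≤-trans (≤-eq (trans (cong (π (i , l) + x i l +_) (Sum-zero (suc i) l λ c i<c c<l → x-zero {c , l} λ nc →
              ¬n (s≤s z≤n , ℕ.≤-<-trans i<c c<l , ℕ.≤-trans (ℕ.+-monoˡ-≤ l i<c) (row+col≤K nc)))) (ℚ.+-identityʳ (π (i , l) + x i l))))
            (π+x≤up np)

    hook-bound : ∀ {p} → Node p → lo p + hook x p ≤ℚ up p
    hook-bound {p} np = ℚ.≤-trans (by≤ (row-bound np) (l (lo p) (rowSum x p) (x ∙ p) (colSum x p) (π p))) (col-bound np)
      where
      l : ∀ o r x c p → (p + x + c) + (o + r) ≡ (o + (r + x + c)) + p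
      l = RS.solve-∀ ℚ-ring

    row-nonneg : ∀ {i} lo′ hi → 0ℚ ≤ℚ Sum (x i) lo′ hi
    row-nonneg {i} lo′ hi = Sum-nonneg lo′ hi λ c _ _ → nonneg (i , c)
      where
      nonneg : ∀ p → 0ℚ ≤ℚ x ∙ p
      nonneg p = case node? p of λ { (yes np) → x-nonneg np ; (no ¬n) → ≤-eq (sym (x-zero ¬n)) }

    col-nonneg : ∀ {l} lo′ hi → 0ℚ ≤ℚ Sum (λ c → x c l) lo′ hi
    col-nonneg {l} lo′ hi = Sum-nonneg lo′ hi λ c _ _ → nonneg (c , l)
      where
      nonneg : ∀ p → 0ℚ ≤ℚ x ∙ p
      nonneg p = case node? p of λ { (yes np) → x-nonneg np ; (no ¬n) → ≤-eq (sym (x-zero ¬n)) }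

  -- The tangent cone at a point, and certificates of membership.

  module Point (v : Pt) (v∈P : InP n a v) where

    v-zero : ∀ {p} → ¬ Node p → v ∙ p ≡ 0ℚ
    v-zero = proj₁ v∈P _ _

    v-nonneg : ∀ {p} → Node p → 0ℚ ≤ℚ v ∙ p
    v-nonneg = proj₁ (proj₂ v∈P) _ _

    open Pot (potential v∈P) public

    Out : X → ℚ
    Out p = π p + v ∙ p

    Cone : Pt → Set
    Cone = InTangentCone n a v

    -- `hin` and `hout` are derivatives of π and `Out` in direction `w`. They are constrained on
    -- `Rel` alone, which has to contain the nodes where `v` or `w` does not vanish: all others add
    -- 0 to every path sum. Only tight inequalities appear among the hypotheses, since a small ε
    -- absorbs the rest.
    module Certificate
      (Rel : X → Set) (w : Pt) (hin hout : X → ℚ)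
      (rel : ∀ p → Node p → Rel p ⊎ (v ∙ p ≡ 0ℚ × w ∙ p ≡ 0ℚ))
      (w∈U : InU n w)
      (w-nonneg : ∀ p → Node p → v ∙ p ≡ 0ℚ → 0ℚ ≤ℚ w ∙ p)
      (h-node : ∀ p → Node p → Rel p → hin p + w ∙ p ≤ℚ hout p)
      (h-link : ∀ p q → Node p → Node q → Rel p → Rel q → p ≺ q → Out p ≡ π q → hout p ≤ℚ hin q)
      (h-start : ∀ p → Node p → Rel p → lo p ≡ π p → 0ℚ ≤ℚ hin p)
      (h-end : ∀ p → Node p → Rel p → Out p ≡ up p → hout p ≤ℚ 0ℚ)
      where

      private
        f₁ f₂ f₃ : X → ℚ × ℚ
        f₁ p = v ∙ p - 0ℚ , 0ℚ - w ∙ p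
        f₂ p = π p - lo p , 0ℚ - hin p
        f₃ p = up p - Out p , hout p - 0ℚ
        f₄ : X × X → ℚ × ℚ
        f₄ (p , q) = π q - Out p , hout p - hin q

        slacks : List (ℚ × ℚ)
        slacks = map f₁ nodes ++ map f₂ nodes ++ map f₃ nodes ++ map f₄ (cartesianProduct nodes nodes)

      module Perturb (ε : ℚ) (0<ε : 0ℚ <ℚ ε) (sl : ∀ {g} → g ∈ slacks → Slack ε g) where
        0≤ε : 0ℚ ≤ℚ ε
        0≤ε = ℚ.<⇒≤ 0<ε

        x′ : Pt
        x′ i j = v i j + ε * w i j
        π′ o′ : X → ℚ
        π′ p = π p + ε * hin p
        o′ p = Out p + ε * hout p

        zero-l : ∀ ε x → x + ε * 0ℚ ≡ x
        zero-l = RS.solve-∀ ℚ-ring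

        x′-nonneg : ∀ p → Node p → 0ℚ ≤ℚ x′ ∙ p
        x′-nonneg p np = subst (_≤ℚ x′ ∙ p) (zero-l ε 0ℚ)
          (tilt 0ℚ (v ∙ p) 0ℚ (w ∙ p) 0≤ε (v-nonneg np) (w-nonneg p np ∘ sym) (sl (∈-++⁺ˡ (∈-map⁺ f₁ (node-∈ np)))))

        node′ : ∀ p → Node p → Rel p → π′ p + x′ ∙ p ≤ℚ o′ p
        node′ p np r = by≤ (*-mono 0≤ε (h-node p np r)) (l ε (π p) (v ∙ p) (hin p) (w ∙ p) (hout p))
          where
          l : ∀ ε π v hin w hout → ((π + v) + ε * hout) + ε * (hin + w) ≡ ((π + ε * hin) + (v + ε * w)) + ε * hout
          l = RS.solve-∀ ℚ-ring

        start′ : ∀ p → Node p → Rel p → lo p ≤ℚ π′ p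
        start′ p np r = subst (_≤ℚ π′ p) (zero-l ε (lo p))
          (tilt (lo p) (π p) 0ℚ (hin p) 0≤ε (lo≤π np) (h-start p np r)
            (sl (∈-++⁺ʳ (map f₁ nodes) (∈-++⁺ˡ (∈-map⁺ f₂ (node-∈ np))))))

        end′ : ∀ p → Node p → Rel p → o′ p ≤ℚ up p
        end′ p np r = subst (o′ p ≤ℚ_) (zero-l ε (up p))
          (tilt (Out p) (up p) (hout p) 0ℚ 0≤ε (π+x≤up np) (h-end p np r)
            (sl (∈-++⁺ʳ (map f₁ nodes) (∈-++⁺ʳ (map f₂ nodes) (∈-++⁺ˡ (∈-map⁺ f₃ (node-∈ np)))))))

        link′ : ∀ p q → Node p → Node q → Rel p → Rel q → p ≺ q → o′ p ≤ℚ π′ q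
        link′ p q np nq rp rq p≺q = tilt (Out p) (π q) (hout p) (hin q) 0≤ε (π-link np nq p≺q) (h-link p q np nq rp rq p≺q)
            (sl (∈-++⁺ʳ (map f₁ nodes) (∈-++⁺ʳ (map f₂ nodes) (∈-++⁺ʳ (map f₃ nodes)
              (∈-map⁺ f₄ (∈-cartesianProduct⁺ (node-∈ np) (node-∈ nq)))))))

        x′-irrelevant : ∀ p → v ∙ p ≡ 0ℚ → w ∙ p ≡ 0ℚ → x′ ∙ p ≡ 0ℚ
        x′-irrelevant p ev ew = trans (cong₂ (λ α β → α + ε * β) ev ew) (zero-l ε 0ℚ)

        step-≺ : ∀ p q → Step p q → p ≺ q
        step-≺ (i , j) _ (inj₁ (refl , refl)) = (ℕ.n≤1+n i , ℕ.≤-refl) , inj₁ ℕ.≤-refl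
        step-≺ (i , j) _ (inj₂ (refl , refl)) = (ℕ.≤-refl , ℕ.n≤1+n j) , inj₂ ℕ.≤-refl

        -- `B` is the running total of a path: it stays below the new potential at the relevant
        -- nodes ahead and below every upper bound ahead. Irrelevant nodes leave it unchanged.
        path-bound : ∀ B p ps → StepsFrom n p ps →
          (∀ q → Node q → p ≼ q → Rel q → B ≤ℚ π′ q) → (∀ q → Node q → p ≼ q → B ≤ℚ up q) →
          B + S x′ (p ∷ ps) ≤ℚ up (lastP p ps)
        path-bound B p [] np b₁ b₂ with rel p np
        ... | inj₁ r = subst (_≤ℚ up p) (cong (B +_) (sym (ℚ.+-identityʳ _)))
            (ℚ.≤-trans (ℚ.≤-trans (ℚ.+-monoˡ-≤ (x′ ∙ p) (b₁ p np (ℕ.≤-refl , ℕ.≤-refl) r)) (node′ p np r)) (end′ p np r))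
        ... | inj₂ (ev , ew) = subst (_≤ℚ up p) (sym (trans (cong (λ z → B + (z + 0ℚ)) (x′-irrelevant p ev ew)) (ℚ.+-identityʳ B)))
            (b₂ p np (ℕ.≤-refl , ℕ.≤-refl))
        path-bound B p (q ∷ qs) (np , s , st) b₁ b₂ with rel p np
        ... | inj₁ r = ℚ.≤-trans
            (by≤ (ℚ.≤-trans (ℚ.+-monoˡ-≤ (x′ ∙ p) (b₁ p np (ℕ.≤-refl , ℕ.≤-refl) r)) (node′ p np r)) (l B (x′ ∙ p) (S x′ (q ∷ qs)) (o′ p)))
            (path-bound (o′ p) q qs st
              (λ r′ nr′ q≼r′ rr′ → link′ p r′ np nr′ r rr′ (≺-≼-trans (step-≺ p q s) q≼r′))
              (λ r′ nr′ q≼r′ → ℚ.≤-trans (end′ p np r) (up-mono {p} {r′} (proj₂ (proj₁ (≺-≼-trans (step-≺ p q s) q≼r′))))))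
          where
          l : ∀ B x s o → (o + s) + (B + x) ≡ (B + (x + s)) + o
          l = RS.solve-∀ ℚ-ring
        ... | inj₂ (ev , ew) = subst (_≤ℚ up (lastP q qs))
            (cong (B +_) (sym (trans (cong (_+ S x′ (q ∷ qs)) (x′-irrelevant p ev ew)) (ℚ.+-identityˡ _))))
            (path-bound B q qs st
              (λ r′ nr′ q≼r′ → b₁ r′ nr′ (proj₁ (≺-≼-trans (step-≺ p q s) q≼r′)))
              (λ r′ nr′ q≼r′ → b₂ r′ nr′ (proj₁ (≺-≼-trans (step-≺ p q s) q≼r′))))

        x′∈P : InP n a x′
        x′∈P = (λ i j h → x′-irrelevant (i , j) (v-zero h) (w∈U i j h)) , (λ i j → x′-nonneg (i , j)) ,
          λ { p@(i , j) ps (_ , st , e) → +-cancel-≤ {lo p} (subst (lo p + S x′ (p ∷ ps) ≤ℚ_) (sym (lo+M p ps st e))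
                (path-bound (lo p) p ps st
                  (λ q nq p≼q rq → ℚ.≤-trans (lo-mono {p} {q} (proj₁ p≼q)) (start′ q nq rq))
                  (λ q nq p≼q → lo≤up {p} {q} nq (proj₁ p≼q)))) }

        perturb : Cone w
        perturb = let c , 0<c , εc = inverse 0<ε in c , x′ , ℚ.<⇒≤ 0<c , x′∈P , λ i j →
          trans (sym (ℚ.*-identityˡ (w i j))) (trans (cong (_* w i j) (sym εc)) (l c ε (v i j) (w i j)))
          where
          l : ∀ c ε v w → ε * c * w ≡ c * ((v + ε * w) - v)
          l = RS.solve-∀ ℚ-ring

      certified : Cone w
      certified = let ε , 0<ε , sl = common-slack slacks in Perturb.perturb ε 0<ε (All.lookup sl)

    open Certificate public using (certified)

    cone-zero : ∀ {w} → Cone w → ∀ {p} → ¬ Node p → w ∙ p ≡ 0ℚ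
    cone-zero (t , x , _ , x∈P , e) {i , j} ¬n = trans (e i j)
      (trans (cong₂ (λ α β → t * (α - β)) (proj₁ x∈P i j ¬n) (v-zero ¬n)) (ℚ.*-zeroʳ t))

    cone-nonneg : ∀ {w} → Cone w → ∀ {p} → v ∙ p ≡ 0ℚ → 0ℚ ≤ℚ w ∙ p
    cone-nonneg {w} c@(t , x , 0≤t , x∈P , e) {p@(i , j)} ev = case node? p of λ
      { (no ¬n) → ≤-eq (sym (cone-zero {w} c {p} ¬n))
      ; (yes nd) → subst (0ℚ ≤ℚ_) (sym (e i j)) (*-nonneg 0≤t
            (a≤b⇒0≤b-a (subst (_≤ℚ x i j) (sym ev) (proj₁ (proj₂ x∈P) i j nd)))) }

    -- The list stands for the functional `S _ t`. Being maximal on P at `v`, it is nonpositive on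
    -- the tangent cone (`cone-tight`).
    TightFun : List X → Set
    TightFun t = ∀ x → InP n a x → S x t ≤ℚ S v t

    cone-tight : ∀ {w t} → Cone w → TightFun t → S w t ≤ℚ 0ℚ
    cone-tight {w} {t} (c , x , 0≤c , x∈P , e) tf = subst (_≤ℚ 0ℚ)
      (trans (l c (S x t) (S v t)) (sym (S-lin x v w c (- c) t λ i j → trans (e i j) (l c (x i j) (v i j)))))
      (*-nonneg-nonpos 0≤c (by≤ (tf x x∈P) (l₂ (S x t) (S v t))))
      where
      l : ∀ c x v → c * (x - v) ≡ c * x + (- c) * v
      l = RS.solve-∀ ℚ-ring
      l₂ : ∀ x v → 0ℚ + x ≡ (x - v) + v
      l₂ = RS.solve-∀ ℚ-ring

    -- The support, potential levels and indicator directions.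

    F : X → Set
    F p = Node p × 0ℚ <ℚ v ∙ p

    F? : ∀ p → Dec (F p)
    F? p = node? p ×-dec (0ℚ ℚ.<? v ∙ p)

    ¬F⇒0 : ∀ {p} → ¬ F p → v ∙ p ≡ 0ℚ
    ¬F⇒0 {p} ¬f = [ (λ np → nonneg∧≯0⇒≡0 (v-nonneg np) λ h → ¬f (np , h)) , v-zero ]′ (toSum (node? p))
      where
      toSum : ∀ {P : Set} → Dec P → P ⊎ ¬ P
      toSum (yes p) = inj₁ p
      toSum (no ¬p) = inj₂ ¬p

    F⇒≢0 : ∀ {p} → F p → ¬ v ∙ p ≡ 0ℚ
    F⇒≢0 f = 0<⇒≢0 (proj₂ f)

    π<Out : ∀ {p} → F p → π p <ℚ Out p
    π<Out f = a<a+b (proj₂ f)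

    -- The squeeze Out q ≤ π z ≤ Out z ≤ π p with equal ends.
    between-zero : ∀ {q z p θ} → Node q → Node z → Node p → q ≺ z → z ≺ p → Out q ≡ θ → π p ≡ θ → v ∙ z ≡ 0ℚ × π z ≡ θ × Out z ≡ θ
    between-zero {q} {z} {p} {θ} nq nz np q≺z z≺p e₁ e₂ = vz , πz , trans (cong (π z +_) vz) (trans (ℚ.+-identityʳ (π z)) πz)
      where
      h₁ : θ ≤ℚ π z
      h₁ = subst (_≤ℚ π z) e₁ (π-link nq nz q≺z)
      h₂ : Out z ≤ℚ θ
      h₂ = subst (Out z ≤ℚ_) e₂ (π-link nz np z≺p)
      πz : π z ≡ θ
      πz = ℚ.≤-antisym (ℚ.≤-trans (a≤a+b (v-nonneg nz)) h₂) h₁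
      vz : v ∙ z ≡ 0ℚ
      vz = ℚ.≤-antisym (+-cancel-≤ {π z} (ℚ.≤-trans h₂ (≤-eq (trans (sym πz) (sym (ℚ.+-identityʳ (π z))))))) (v-nonneg nz)

    end-zero : ∀ {q z θ} → Node q → Node z → q ≺ z → Out q ≡ θ → up z ≡ θ → v ∙ z ≡ 0ℚ × π z ≡ θ × Out z ≡ θ
    end-zero {q} {z} {θ} nq nz q≺z e₁ e₂ = vz , πz , trans (cong (π z +_) vz) (trans (ℚ.+-identityʳ (π z)) πz)
      where
      h₁ : θ ≤ℚ π z
      h₁ = subst (_≤ℚ π z) e₁ (π-link nq nz q≺z)
      h₂ : Out z ≤ℚ θ
      h₂ = subst (Out z ≤ℚ_) e₂ (π+x≤up nz)
      πz : π z ≡ θ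
      πz = ℚ.≤-antisym (ℚ.≤-trans (a≤a+b (v-nonneg nz)) h₂) h₁
      vz : v ∙ z ≡ 0ℚ
      vz = ℚ.≤-antisym (+-cancel-≤ {π z} (ℚ.≤-trans h₂ (≤-eq (trans (sym πz) (sym (ℚ.+-identityʳ (π z))))))) (v-nonneg nz)

    -- The members of F that leave, respectively enter, at level θ. A chain contains at most one of
    -- each, because π and `Out` increase strictly along its members in F.
    O I : ℚ → X → Set
    O θ p = F p × Out p ≡ θ
    I θ p = F p × π p ≡ θ

    O? : ∀ θ p → Dec (O θ p)
    O? θ p = F? p ×-dec (Out p ℚ.≟ θ)

    I? : ∀ θ p → Dec (I θ p)
    I? θ p = F? p ×-dec (π p ℚ.≟ θ)

    diff : {P Q : X → Set} → (∀ p → Dec (P p)) → (∀ p → Dec (Q p)) → Pt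
    diff P? Q? i j = 𝟙 (P? (i , j)) - 𝟙 (Q? (i , j))

    1-0 : ∀ {α β} → α ≡ 1ℚ → β ≡ 0ℚ → α - β ≡ 1ℚ
    1-0 refl refl = refl

    0-1 : ∀ {α β} → α ≡ 0ℚ → β ≡ 1ℚ → α - β ≡ - 1ℚ
    0-1 refl refl = refl

    0-0 : ∀ {α β} → α ≡ 0ℚ → β ≡ 0ℚ → α - β ≡ 0ℚ
    0-0 refl refl = refl

    module _ {χ : X → Set} (χ? : ∀ p → Dec (χ p)) (θ : ℚ) (χ-node : ∀ {p} → χ p → Node p)
             (χ-incomparable : ∀ {p q} → χ p → χ q → ¬ p ≺ q) where

      private
        rel : ∀ {Q : X → Set} (Q? : ∀ p → Dec (Q p)) → (∀ {p} → Q p → F p) →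
              ∀ p → Node p → (F p ⊎ χ p) ⊎ (v ∙ p ≡ 0ℚ × diff χ? Q? ∙ p ≡ 0ℚ)
        rel Q? Q⇒F p np with F? p | χ? p
        ... | yes f | _     = inj₁ (inj₁ f)
        ... | no _  | yes c = inj₁ (inj₂ c)
        ... | no ¬f | no ¬c = inj₂ (¬F⇒0 ¬f , 0-0 refl (𝟙-no (Q? p) (¬f ∘ Q⇒F)))

        U : ∀ {Q : X → Set} (Q? : ∀ p → Dec (Q p)) → (∀ {p} → Q p → F p) → InU n (diff χ? Q?)
        U Q? Q⇒F i j ¬n = 0-0 (𝟙-no (χ? (i , j)) (¬n ∘ χ-node)) (𝟙-no (Q? (i , j)) (¬n ∘ proj₁ ∘ Q⇒F))

        nonneg : ∀ {Q : X → Set} (Q? : ∀ p → Dec (Q p)) → (∀ {p} → Q p → F p) →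
                 ∀ p → Node p → v ∙ p ≡ 0ℚ → 0ℚ ≤ℚ diff χ? Q? ∙ p
        nonneg Q? Q⇒F p _ e = subst (λ z → 0ℚ ≤ℚ 𝟙 (χ? p) - z) (sym (𝟙-no (Q? p) λ q → F⇒≢0 (Q⇒F q) e))
          (subst (0ℚ ≤ℚ_) (l (𝟙 (χ? p))) (0≤𝟙 (χ? p)))
          where
          l : ∀ x → x ≡ x - 0ℚ
          l = RS.solve-∀ ℚ-ring

        neg≤0 : ∀ {P : Set} (d : Dec P) → - 𝟙 d ≤ℚ 0ℚ
        neg≤0 d = ℚ.neg-antimono-≤ (0≤𝟙 d)

      -- A tight chain through a member of χ that does not start there has just left some member of
      -- `O θ`, so the +1 on χ is paid for by a -1 before it; accordingly π drops at rate 1 on χ.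
      -- `minus-I-cone` charges what follows instead, and keeps π unchanged on χ outside `I θ`.
      minus-O-cone : (∀ {p} → χ p → π p ≡ θ) → (∀ {p} → χ p → ¬ lo p ≡ θ) → Cone (diff χ? (O? θ))
      minus-O-cone at ¬start = certified (λ p → F p ⊎ χ p) (diff χ? (O? θ)) (λ p → - 𝟙 (χ? p)) (λ p → - 𝟙 (O? θ p))
        (rel (O? θ) proj₁) (U (O? θ) proj₁) (nonneg (O? θ) proj₁)
        (λ p _ _ → ≤-eq (l (𝟙 (χ? p)) (𝟙 (O? θ p))))
        (λ p q _ _ rp rq p≺q e → ℚ.neg-antimono-≤ (𝟙-mono (χ? q) (O? θ p) λ c →
          [ (λ f → f , trans e (at c)) , (λ c′ → ⊥-elim (χ-incomparable c′ c p≺q)) ]′ rp))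
        (λ p _ _ e → ≤-eq (sym (cong -_ (𝟙-no (χ? p) λ c → ¬start c (trans e (at c))))))
        (λ p _ _ _ → neg≤0 (O? θ p))
        where
        l : ∀ x y → - x + (x - y) ≡ - y
        l = RS.solve-∀ ℚ-ring

      minus-I-cone : (∀ {p} → χ p → Out p ≡ θ) → (∀ {p} → χ p → ¬ up p ≡ θ) → Cone (diff χ? (I? θ))
      minus-I-cone at ¬end = certified (λ p → F p ⊎ χ p) (diff χ? (I? θ)) (λ p → 𝟙 (I? θ p)) (λ p → 𝟙 (χ? p))
        (rel (I? θ) proj₁) (U (I? θ) proj₁) (nonneg (I? θ) proj₁)
        (λ p _ _ → ≤-eq (l (𝟙 (χ? p)) (𝟙 (I? θ p))))
        (λ p q _ _ rp rq p≺q e → 𝟙-mono (χ? p) (I? θ q) λ c →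
          [ (λ f → f , trans (sym e) (at c)) , (λ c′ → ⊥-elim (χ-incomparable c c′ p≺q)) ]′ rq)
        (λ p _ _ _ → 0≤𝟙 (I? θ p))
        (λ p _ _ e → ≤-eq (𝟙-no (χ? p) λ c → ¬end c (trans (sym e) (at c))))
        where
        l : ∀ x y → y + (x - y) ≡ x
        l = RS.solve-∀ ℚ-ring

    single : ∀ {z} → Node z → ∀ {p} → z ≡ p → Node p
    single nz refl = nz

    single-incomparable : ∀ {z p q : X} → z ≡ p → z ≡ q → ¬ p ≺ q
    single-incomparable refl refl = ≺-irrefl

    -- Zero derivatives are a certificate, as path sums only decrease.
    nonpos-cone : ∀ w → (∀ i j → w i j ≤ℚ 0ℚ) → (∀ {p} → ¬ F p → w ∙ p ≡ 0ℚ) → Cone w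
    nonpos-cone w w≤0 w-off = certified F w (λ _ → 0ℚ) (λ _ → 0ℚ)
      (λ p _ → case F? p of λ { (yes f) → inj₁ f ; (no ¬f) → inj₂ (¬F⇒0 ¬f , w-off ¬f) })
      (λ i j ¬n → w-off (¬n ∘ proj₁))
      (λ p _ e → ≤-eq (sym (w-off λ f → F⇒≢0 f e)))
      (λ p _ _ → subst (_≤ℚ 0ℚ) (sym (ℚ.+-identityˡ (w ∙ p))) (w≤0 (row p) (col p)))
      (λ _ _ _ _ _ _ _ _ → ℚ.≤-refl) (λ _ _ _ _ → ℚ.≤-refl) (λ _ _ _ _ → ℚ.≤-refl)

    -- The two opposite directions that move the level θ up or down inside the region Q.
    module Shift (θ : ℚ) {Q : X → Set} (Q? : ∀ p → Dec (Q p))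
      (link : ∀ {p q} → F p → F q → p ≺ q → Out p ≡ θ → π q ≡ θ → (Q p → Q q) × (Q q → Q p))
      (start : ∀ {p} → F p → π p ≡ θ → lo p ≡ θ → ¬ Q p)
      (end : ∀ {p} → F p → Out p ≡ θ → up p ≡ θ → ¬ Q p) where

      OQ? : ∀ p → Dec (O θ p × Q p)
      OQ? p = O? θ p ×-dec Q? p

      IQ? : ∀ p → Dec (I θ p × Q p)
      IQ? p = I? θ p ×-dec Q? p

      private
        rel : ∀ {A B : X → Set} (A? : ∀ p → Dec (A p)) (B? : ∀ p → Dec (B p)) → (∀ {p} → A p → F p) → (∀ {p} → B p → F p) →
              ∀ p → Node p → F p ⊎ (v ∙ p ≡ 0ℚ × diff A? B? ∙ p ≡ 0ℚ)
        rel A? B? fA fB p _ with F? p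
        ... | yes f = inj₁ f
        ... | no ¬f = inj₂ (¬F⇒0 ¬f , 0-0 (𝟙-no (A? p) (¬f ∘ fA)) (𝟙-no (B? p) (¬f ∘ fB)))

        off : ∀ {A B : X → Set} (A? : ∀ p → Dec (A p)) (B? : ∀ p → Dec (B p)) → (∀ {p} → A p → F p) → (∀ {p} → B p → F p) →
              ∀ {p} → ¬ F p → diff A? B? ∙ p ≡ 0ℚ
        off A? B? fA fB {p} ¬f = 0-0 (𝟙-no (A? p) (¬f ∘ fA)) (𝟙-no (B? p) (¬f ∘ fB))

        fO : ∀ {p} → O θ p × Q p → F p
        fO = proj₁ ∘ proj₁
        fI : ∀ {p} → I θ p × Q p → F p
        fI = proj₁ ∘ proj₁

        l₁ : ∀ x y → y + (x - y) ≡ x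
        l₁ = RS.solve-∀ ℚ-ring
        l₂ : ∀ x y → - y + (y - x) ≡ - x
        l₂ = RS.solve-∀ ℚ-ring

        same : ∀ {p q} → F p → F q → p ≺ q → Out p ≡ π q → 𝟙 (OQ? p) ≡ 𝟙 (IQ? q)
        same {p} {q} fp fq p≺q e = 𝟙-cong (OQ? p) (IQ? q)
          (λ { ((_ , eo) , qp) → (fq , trans (sym e) eo) , proj₁ (link fp fq p≺q eo (trans (sym e) eo)) qp })
          (λ { ((_ , ei) , qq) → (fp , trans e ei) , proj₂ (link fp fq p≺q (trans e ei) ei) qq })

        start0 : ∀ {p} → F p → lo p ≡ π p → 𝟙 (IQ? p) ≡ 0ℚ
        start0 {p} f e = 𝟙-no (IQ? p) λ { ((_ , ei) , q) → start f ei (trans e ei) q }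

        end0 : ∀ {p} → F p → Out p ≡ up p → 𝟙 (OQ? p) ≡ 0ℚ
        end0 {p} f e = 𝟙-no (OQ? p) λ { ((_ , eo) , q) → end f eo (trans (sym e) eo) q }

      up-cone : Cone (diff OQ? IQ?)
      up-cone = certified F (diff OQ? IQ?) (λ p → 𝟙 (IQ? p)) (λ p → 𝟙 (OQ? p))
        (rel OQ? IQ? fO fI) (λ i j ¬n → off OQ? IQ? fO fI (¬n ∘ proj₁))
        (λ p _ e → ≤-eq (sym (off OQ? IQ? fO fI {p} λ f → F⇒≢0 f e)))
        (λ p _ _ → ≤-eq (l₁ (𝟙 (OQ? p)) (𝟙 (IQ? p))))
        (λ p q _ _ fp fq p≺q e → ≤-eq (same fp fq p≺q e))
        (λ p _ f e → ≤-eq (sym (start0 f e)))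
        (λ p _ f e → ≤-eq (end0 f e))

      down-cone : Cone (diff IQ? OQ?)
      down-cone = certified F (diff IQ? OQ?) (λ p → - 𝟙 (IQ? p)) (λ p → - 𝟙 (OQ? p))
        (rel IQ? OQ? fI fO) (λ i j ¬n → off IQ? OQ? fI fO (¬n ∘ proj₁))
        (λ p _ e → ≤-eq (sym (off IQ? OQ? fI fO {p} λ f → F⇒≢0 f e)))
        (λ p _ _ → ≤-eq (l₂ (𝟙 (OQ? p)) (𝟙 (IQ? p))))
        (λ p q _ _ fp fq p≺q e → ≤-eq (cong -_ (same fp fq p≺q e)))
        (λ p _ f e → ≤-eq (sym (cong -_ (start0 f e))))
        (λ p _ f e → ≤-eq (cong -_ (end0 f e)))

    -- A tight piece of chain before p, stored as an affine lower bound for the potential at p of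
    -- every point of P, with equality at `v`. Since the bound refers to the one chosen `potential`
    -- of each point, a `Pre` and a `Post` at the same node can be glued.
    record Pre (p : X) : Set where
      constructor pre
      field
        base  : ℚ
        list  : List X
        bound : ∀ x (x∈P : InP n a x) → base + S x list ≤ℚ Pot.π (potential x∈P) p
        tight : base + S v list ≡ π p

    record Post (p : X) : Set where
      constructor post
      field
        base  : ℚ
        list  : List X
        bound : ∀ x (x∈P : InP n a x) → Pot.π (potential x∈P) p + x ∙ p + S x list ≤ℚ base
        tight : Out p + S v list ≡ base

    start-pre : ∀ {p} → Node p → lo p ≡ π p → Pre p
    start-pre {p} np e = pre (lo p) [] (λ x x∈P → subst (_≤ℚ Pot.π (potential x∈P) p) (sym (ℚ.+-identityʳ (lo p))) (Pot.lo≤π (potential x∈P) np))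
      (trans (ℚ.+-identityʳ (lo p)) e)

    end-post : ∀ {p} → Node p → Out p ≡ up p → Post p
    end-post {p} np e = post (up p) [] (λ x x∈P → subst (_≤ℚ up p) (sym (ℚ.+-identityʳ (Pot.π (potential x∈P) p + x ∙ p))) (Pot.π+x≤up (potential x∈P) np))
      (trans (ℚ.+-identityʳ (Out p)) e)

    snoc : ∀ {p q} → Pre p → Node p → Node q → p ≺ q → Out p ≡ π q → Pre q
    snoc {p} {q} (pre b t bd tg) np nq p≺q e = pre b (p ∷ t)
      (λ x x∈P → ℚ.≤-trans (by≤ (bd x x∈P) (l b (x ∙ p) (S x t) (Pot.π (potential x∈P) p))) (Pot.π-link (potential x∈P) np nq p≺q))
      (trans (l′ b (v ∙ p) (S v t)) (trans (cong (_+ v ∙ p) tg) e))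
      where
      l : ∀ b xp s π → (π + xp) + (b + s) ≡ (b + (xp + s)) + π
      l = RS.solve-∀ ℚ-ring
      l′ : ∀ b xp s → b + (xp + s) ≡ (b + s) + xp
      l′ = RS.solve-∀ ℚ-ring

    cons : ∀ {p q} → Post q → Node p → Node q → p ≺ q → Out p ≡ π q → Post p
    cons {p} {q} (post b t bd tg) np nq p≺q e = post b (q ∷ t)
      (λ x x∈P → ℚ.≤-trans (by≤ (Pot.π-link (potential x∈P) np nq p≺q)
        (l (Pot.π (potential x∈P) p + x ∙ p) (x ∙ q) (S x t) (Pot.π (potential x∈P) q))) (bd x x∈P))
      (trans (sym (ℚ.+-assoc (Out p) (v ∙ q) (S v t))) (trans (cong (λ z → z + v ∙ q + S v t) e) tg))
      where
      l : ∀ b xp s π → (π + xp + s) + b ≡ (b + (xp + s)) + π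
      l = RS.solve-∀ ℚ-ring

    -- The potential of `x` at p cancels between the two pieces; what remains is valid on P and an
    -- equality at `v`.
    close : ∀ {p} (A : Pre p) (B : Post p) → TightFun (p ∷ (Pre.list A ++ Post.list B))
    close {p} (pre b t bd tg) (post c s bd′ tg′) x x∈P =
      by≤ (bd x x∈P ⊕ bd′ x x∈P) (trans (cong (λ α → (v ∙ p + α) + (b + S x t + (Pot.π (potential x∈P) p + x ∙ p + S x s))) (S-++ v t s))
        (trans (l b (v ∙ p) (S v t) (S v s) (x ∙ p) (S x t) (S x s) (Pot.π (potential x∈P) p) (π p) c tg tg′)
          (cong (λ α → (x ∙ p + α) + (Pot.π (potential x∈P) p + c)) (sym (S-++ x t s)))))
      where
      l₀ : ∀ b vp vt vs xp xt xs πx πv → (vp + (vt + vs)) + (b + xt + (πx + xp + xs)) ≡ (xp + (xt + xs)) + (πx + ((b + vt) + vp + vs))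
      l₀ = RS.solve-∀ ℚ-ring
      l : ∀ b vp vt vs xp xt xs πx πv c → b + vt ≡ πv → πv + vp + vs ≡ c →
          (vp + (vt + vs)) + (b + xt + (πx + xp + xs)) ≡ (xp + (xt + xs)) + (πx + c)
      l b vp vt vs xp xt xs πx πv c refl refl = l₀ b vp vt vs xp xt xs πx πv

    record Good : Set where
      field
        hooks   : ∀ {p} → F p → lo p + hook v p ≡ up p
        laminar : ∀ {p q} → F p → F q → row p < row q → row q ≤ col p → col p < col q → ⊥
        central : ∀ {p} → F p → n < col p → F (K ∸ col p , col p)

    -- Consequences of a simplicial tangent cone.

    module Simplicial (m : ℕ) (r : Fin m → PtZ)
      (indep : ∀ (c : Fin m → ℚ) → (∀ i j → lin m c r i j ≡ 0ℚ) → ∀ k → c k ≡ 0ℚ)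
      (gen : ∀ (w : Pt) →
         (InTangentCone n a v w → Σ (Fin m → ℚ) λ c → (∀ k → 0ℚ ≤ℚ c k) × (∀ i j → w i j ≡ lin m c r i j))
       × ((Σ (Fin m → ℚ) λ c → (∀ k → 0ℚ ≤ℚ c k) × (∀ i j → w i j ≡ lin m c r i j)) → InTangentCone n a v w))
      where

      ρ : Fin m → Pt
      ρ k i j = toℚ (r k i j)

      S-sum : ∀ {w} c → (∀ i j → w i j ≡ lin m c r i j) → ∀ t → S w t ≡ sumFin m (λ k → c k * S (ρ k) t)
      S-sum c e [] = sym (sumFin-zero m λ k → ℚ.*-zeroʳ (c k))
      S-sum {w} c e ((i , j) ∷ t) = trans (cong₂ _+_ (e i j) (S-sum {w} c e t))
        (trans (sym (trans (sumFin-lin m 1ℚ 1ℚ (λ k → c k * ρ k i j) (λ k → c k * S (ρ k) t))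
                   (cong₂ _+_ (ℚ.*-identityˡ (lin m c r i j)) (ℚ.*-identityˡ (sumFin m λ k → c k * S (ρ k) t)))))
               (sumFin-cong m λ k → l (c k) (ρ k i j) (S (ρ k) t)))
        where
        l : ∀ c x y → 1ℚ * (c * x) + 1ℚ * (c * y) ≡ c * (x + y)
        l = RS.solve-∀ ℚ-ring

      lin-combine : ∀ α β c d i j → lin m (λ k → α * c k + β * d k) r i j ≡ α * lin m c r i j + β * lin m d r i j
      lin-combine α β c d i j = trans (sumFin-cong m λ k → l α β (c k) (d k) (ρ k i j))
        (sumFin-lin m α β (λ k → c k * ρ k i j) (λ k → d k * ρ k i j))
        where
        l : ∀ α β c d x → (α * c + β * d) * x ≡ α * (c * x) + β * (d * x)
        l = RS.solve-∀ ℚ-ring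

      lin-uniq : ∀ c d → (∀ i j → lin m c r i j ≡ lin m d r i j) → ∀ k → c k ≡ d k
      lin-uniq c d h k = from0 (c k) (d k) (indep (λ k → 1ℚ * c k + (- 1ℚ) * d k) (λ i j →
          trans (lin-combine 1ℚ (- 1ℚ) c d i j)
          (trans (cong (λ z → 1ℚ * z + (- 1ℚ) * lin m d r i j) (h i j)) (l₂ (lin m d r i j)))) k)
        where
        l₂ : ∀ x → 1ℚ * x + (- 1ℚ) * x ≡ 0ℚ
        l₂ = RS.solve-∀ ℚ-ring
        l₃ : ∀ c d → c ≡ (1ℚ * c + (- 1ℚ) * d) + d
        l₃ = RS.solve-∀ ℚ-ring
        from0 : ∀ c d → 1ℚ * c + (- 1ℚ) * d ≡ 0ℚ → c ≡ d
        from0 c d e = trans (l₃ c d) (trans (cong (_+ d) e) (ℚ.+-identityˡ d))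

      unit : Fin m → Fin m → ℚ
      unit k k′ = 𝟙 (k Fin.≟ k′)

      lin-unit : ∀ k i j → ρ k i j ≡ lin m (unit k) r i j
      lin-unit k i j = sym (trans (sumFin-single m _ k λ k′ ne → trans (cong (_* ρ k′ i j) (𝟙-no (k Fin.≟ k′) ne)) (ℚ.*-zeroˡ (ρ k′ i j)))
        (trans (cong (_* ρ k i j) (𝟙-yes (k Fin.≟ k) refl)) (ℚ.*-identityˡ (ρ k i j))))

      ρ-cone : ∀ k → Cone (ρ k)
      ρ-cone k = proj₂ (gen (ρ k)) (unit k , (λ k′ → 0≤𝟙 (k Fin.≟ k′)) , lin-unit k)

      module Coefs {w : Pt} (cw : Cone w) where
        private cs = proj₁ (gen w) cw
        coef : Fin m → ℚ
        coef = proj₁ cs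
        coef-nonneg : ∀ k → 0ℚ ≤ℚ coef k
        coef-nonneg = proj₁ (proj₂ cs)
        coef-eq : ∀ i j → w i j ≡ lin m coef r i j
        coef-eq = proj₂ (proj₂ cs)

        -- All terms of the expansion of S w t are nonpositive and they add up to 0: a face contains
        -- the generators of its members.
        tight-terms : ∀ {t} → TightFun t → S w t ≡ 0ℚ → ∀ k → 0ℚ <ℚ coef k → S (ρ k) t ≡ 0ℚ
        tight-terms {t} tf e k 0<c = neg-0 (S (ρ k) t) (*-cancel-0 0<c (sumFin-zero-terms m {λ k → coef k * (- S (ρ k) t)}
            (λ k → *-nonneg (coef-nonneg k) (ℚ.neg-antimono-≤ (cone-tight {ρ k} {t} (ρ-cone k) tf)))
            (trans (sumFin-cong m (λ k → l (coef k) (S (ρ k) t)))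
              (trans (sumFin-lin m (- 1ℚ) 0ℚ (λ k → coef k * S (ρ k) t) (λ _ → 0ℚ))
              (trans (cong (λ z → (- 1ℚ) * z + 0ℚ * sumFin m (λ _ → 0ℚ)) (trans (sym (S-sum {w} coef coef-eq t)) e)) (l₂ (sumFin m (λ _ → 0ℚ)))))) k))
          where
          l : ∀ c s → c * (- s) ≡ (- 1ℚ) * (c * s) + 0ℚ * 0ℚ
          l = RS.solve-∀ ℚ-ring
          l₂ : ∀ z → (- 1ℚ) * 0ℚ + 0ℚ * z ≡ 0ℚ
          l₂ = RS.solve-∀ ℚ-ring
          neg-0 : ∀ s → - s ≡ 0ℚ → s ≡ 0ℚ
          neg-0 s e = ℚ.neg-injective e

        zero-terms : ∀ {z} → v ∙ z ≡ 0ℚ → w ∙ z ≡ 0ℚ → ∀ k → 0ℚ <ℚ coef k → ρ k ∙ z ≡ 0ℚ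
        zero-terms {z} ev ew k 0<c = *-cancel-0 0<c (sumFin-zero-terms m
          (λ k → *-nonneg (coef-nonneg k) (cone-nonneg {ρ k} (ρ-cone k) ev)) (trans (sym (coef-eq (row z) (col z))) ew) k)

        pos-term : ∀ {z} → 0ℚ <ℚ w ∙ z → Σ (Fin m) λ k → 0ℚ <ℚ coef k × 0ℚ <ℚ ρ k ∙ z
        pos-term {z} h = let k , q = sumFin-pos-term m (subst (0ℚ <ℚ_) (coef-eq (row z) (col z)) h) in k , pos-factor (coef-nonneg k) q

      open Coefs

      -- The coefficients of `w` and `w′` are nonnegative and cancel by independence. This is the
      -- form in which extremality of `v` is used.
      lineality : ∀ {w w′} → Cone w → Cone w′ → (∀ i j → w i j + w′ i j ≡ 0ℚ) → ∀ i j → w i j ≡ 0ℚ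
      lineality {w} {w′} c c′ h i j = trans (coef-eq c i j)
        (sumFin-zero m λ k → trans (cong (_* ρ k i j) (zk k)) (ℚ.*-zeroˡ (ρ k i j)))
        where
        zk : ∀ k → coef c k ≡ 0ℚ
        zk k = ℚ.≤-antisym (subst (coef c k ≤ℚ_) (trans (l₃ (coef c k) (coef c′ k)) sum0) (a≤a+b (coef-nonneg c′ k))) (coef-nonneg c k)
          where
          l₂ : ∀ x y → 1ℚ * x + 1ℚ * y ≡ x + y
          l₂ = RS.solve-∀ ℚ-ring
          l₃ : ∀ c d → c + d ≡ 1ℚ * c + 1ℚ * d
          l₃ = RS.solve-∀ ℚ-ring
          sum0 : 1ℚ * coef c k + 1ℚ * coef c′ k ≡ 0ℚ
          sum0 = indep (λ k → 1ℚ * coef c k + 1ℚ * coef c′ k) (λ i j →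
            trans (lin-combine 1ℚ 1ℚ (coef c) (coef c′) i j)
            (trans (cong₂ (λ α β → 1ℚ * α + 1ℚ * β) (sym (coef-eq c i j)) (sym (coef-eq c′ i j))) (trans (l₂ (w i j) (w′ i j)) (h i j)))) k

      -- P is closed under replacing an entry by 0. As `v ∙ z` is 0, doing so in `x` removes exactly
      -- the entry of `w` at z.
      drop : ∀ {w z} → Cone w → v ∙ z ≡ 0ℚ → Node z → Cone (λ i j → w i j - w ∙ z * δ z i j)
      drop {w} {z} (t , x , 0≤t , x∈P , e) ev nz = t , x′ , 0≤t , x′∈P , λ i j →
          trans (cong₂ (λ α β → α - β * δ z i j) (e i j) (trans (e (row z) (col z)) (cong (λ ζ → t * (x ∙ z - ζ)) ev)))
                (l t (x i j) (v i j) (x ∙ z) (δ z i j))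
        where
        x′ : Pt
        x′ i j = x i j - x ∙ z * δ z i j
        l : ∀ t x v xz d → t * (x - v) - t * (xz - 0ℚ) * d ≡ t * ((x - xz * d) - v)
        l = RS.solve-∀ ℚ-ring
        l₂ : ∀ x y → (x - y * 1ℚ) ≡ x - y
        l₂ = RS.solve-∀ ℚ-ring
        l₃ : ∀ x y → (x - y * 0ℚ) ≡ x
        l₃ = RS.solve-∀ ℚ-ring
        x′-off : ∀ {p} → ¬ z ≡ p → x′ ∙ p ≡ x ∙ p
        x′-off {p} ne = trans (cong (λ d → x ∙ p - x ∙ z * d) (𝟙-no (z ≟ₓ p) ne)) (l₃ (x ∙ p) (x ∙ z))
        x′≤x : ∀ i j → x′ i j ≤ℚ x i j
        x′≤x i j = by≤ (*-nonneg (proj₁ (proj₂ x∈P) (row z) (col z) nz) (0≤𝟙 (z ≟ₓ (i , j)))) (l₄ (x i j) (x ∙ z) (δ z i j))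
          where
          l₄ : ∀ x xz d → x + 0ℚ ≡ (x - xz * d) + xz * d
          l₄ = RS.solve-∀ ℚ-ring
        x′∈P : InP n a x′
        x′∈P = (λ i j h → trans (x′-off {i , j} λ { refl → h nz }) (proj₁ x∈P i j h)) ,
               (λ i j h → case z ≟ₓ (i , j) of λ
                 { (yes refl) → ≤-eq (sym (trans (cong (λ d → x i j - x i j * d) (𝟙-yes (z ≟ₓ z) refl)) (trans (l₂ (x i j) (x i j)) (ℚ.+-inverseʳ (x i j)))))
                 ; (no ne) → subst (0ℚ ≤ℚ_) (sym (x′-off {i , j} ne)) (proj₁ (proj₂ x∈P) i j h) }) ,
               (λ p ps dy → ℚ.≤-trans (S-mono (p ∷ ps) x′≤x) (proj₂ (proj₂ x∈P) p ps dy))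

      -- A direction u of the cone whose only positive entry at a zero of v is the one at z.
      record Bump (z : X) : Set where
        field
          u u₀ : Pt
          u-cone : Cone u
          u₀-cone : Cone u₀
          u-split : ∀ i j → u i j ≡ δ z i j + u₀ i j
          u₀-zero : ∀ {p} → v ∙ p ≡ 0ℚ → u₀ ∙ p ≡ 0ℚ
          z-node : Node z
          z-zero : v ∙ z ≡ 0ℚ

        u-off : ∀ {p} → v ∙ p ≡ 0ℚ → ¬ z ≡ p → u ∙ p ≡ 0ℚ
        u-off {p} e ne = trans (u-split (row p) (col p)) (trans (cong₂ _+_ (𝟙-no (z ≟ₓ p) ne) (u₀-zero e)) refl)

        u-at : u ∙ z ≡ 1ℚ
        u-at = trans (u-split (row z) (col z)) (trans (cong₂ _+_ (𝟙-yes (z ≟ₓ z) refl) (u₀-zero z-zero)) refl)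

        -- With s the entry of ρ k at z, one has ρ k + s u₀ = (ρ k - s δ z) + s u. The bracket lies
        -- in the cone by `drop` and vanishes at z, so ρ k has coefficient 0 in it. Comparing the
        -- coefficients of ρ k gives 1 + s c₀ = s c with c₀ ≥ 0.
        u-coef : ∀ k → 0ℚ <ℚ ρ k ∙ z → 1ℚ ≤ℚ coef u-cone k * ρ k ∙ z
        u-coef k 0<s = by≤ (*-nonneg (ℚ.<⇒≤ 0<s) (coef-nonneg u₀-cone k))
            (solve-eq (coef u-cone k) s (unit k k) (coef u₀-cone k) (coef dr k) eqk₀ (𝟙-yes (k Fin.≟ k) refl) νk)
          where
          s = ρ k ∙ z
          dr : Cone (λ i j → ρ k i j - s * δ z i j)
          dr = drop {ρ k} {z} (ρ-cone k) z-zero z-node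
          νk : coef dr k ≡ 0ℚ
          νk = nonneg∧≯0⇒≡0 (coef-nonneg dr k) λ p → 0<⇒≢0 0<s (zero-terms dr {z} z-zero
            (trans (cong (λ d → s - s * d) (𝟙-yes (z ≟ₓ z) refl)) (trans (cong (λ y → s - y) (ℚ.*-identityʳ s)) (ℚ.+-inverseʳ s))) k p)
          eqk₀ : 1ℚ * unit k k + s * coef u₀-cone k ≡ 1ℚ * coef dr k + s * coef u-cone k
          eqk₀ = lin-uniq (λ k′ → 1ℚ * unit k k′ + s * coef u₀-cone k′) (λ k′ → 1ℚ * coef dr k′ + s * coef u-cone k′)
            (λ i j → trans (lin-combine 1ℚ s (unit k) (coef u₀-cone) i j)
              (trans (cong₂ (λ α β → 1ℚ * α + s * β) (sym (lin-unit k i j)) (sym (coef-eq u₀-cone i j)))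
              (trans (l₆ (ρ k i j) s (δ z i j) (u₀ i j))
              (trans (cong (λ β → 1ℚ * (ρ k i j - s * δ z i j) + s * β) (sym (u-split i j)))
              (trans (cong₂ (λ α β → 1ℚ * α + s * β) (coef-eq dr i j) (coef-eq u-cone i j))
                     (sym (lin-combine 1ℚ s (coef dr) (coef u-cone) i j))))))) k
            where
            l₆ : ∀ x s d y → 1ℚ * x + s * y ≡ 1ℚ * (x - s * d) + s * (d + y)
            l₆ = RS.solve-∀ ℚ-ring
          solve-eq : ∀ x s e y d → 1ℚ * e + s * y ≡ 1ℚ * d + s * x → e ≡ 1ℚ → d ≡ 0ℚ → x * s + 0ℚ ≡ 1ℚ + s * y
          solve-eq x s e y d h refl refl = trans (l₇ x s) (trans (sym h) (cong (_+ s * y) (ℚ.*-identityˡ 1ℚ)))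
            where
            l₇ : ∀ x s → x * s + 0ℚ ≡ 1ℚ * 0ℚ + s * x
            l₇ = RS.solve-∀ ℚ-ring

        -- The generator occurs in `u` by `u-coef`, and `u` vanishes at z′.
        no-second : ∀ {z′} → v ∙ z′ ≡ 0ℚ → ¬ z ≡ z′ → ∀ k → 0ℚ <ℚ ρ k ∙ z → ¬ 0ℚ <ℚ ρ k ∙ z′
        no-second {z′} e ne k p p′ = 0<⇒≢0 p′ (zero-terms u-cone {z′} e (u-off e ne) k
          (proj₁ (pos-factor (coef-nonneg u-cone k) (ℚ.<-≤-trans 0<1 (u-coef k p)))))

        -- Two such generators would contribute at least 2 to the entry of `u` at z, which is 1.
        unique-gen : ∀ k k′ → 0ℚ <ℚ ρ k ∙ z → 0ℚ <ℚ ρ k′ ∙ z → k ≡ k′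
        unique-gen k k′ p p′ = decidable-stable (k Fin.≟ k′) λ ne → ≤⇒≯ (ℚ.≤-trans (u-coef k p ⊕ u-coef k′ p′)
                (two-terms≤sumFin m (λ k → *-nonneg (coef-nonneg u-cone k) (cone-nonneg {ρ k} (ρ-cone k) z-zero)) k k′ ne))
              (subst (_<ℚ 1ℚ + 1ℚ) (trans (sym u-at) (coef-eq u-cone (row z) (col z))) (a<a+b 0<1))

      open Bump

      -- Some generator occurring in `w` is positive at z. It annihilates both functionals, which
      -- differ by the exchange of z for z′, so it is equally positive at z′, against `no-second`.
      exchange : ∀ {z z′ w t t′} → Bump z → v ∙ z′ ≡ 0ℚ → ¬ z ≡ z′ → Cone w → TightFun t → TightFun t′ →
        S w t ≡ 0ℚ → S w t′ ≡ 0ℚ → 0ℚ <ℚ w ∙ z → (∀ u → S u t + u ∙ z′ ≡ S u t′ + u ∙ z) → ⊥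
      exchange {z} {z′} {w} {t} {t′} B ez′ ne cw tf tf′ e e′ wz rel = go (pos-term cw {z} wz)
        where
        go : (Σ (Fin m) λ k → 0ℚ <ℚ coef cw k × 0ℚ <ℚ ρ k ∙ z) → ⊥
        go (k , 0<c , 0<ρ) = no-second B ez′ ne k 0<ρ (subst (0ℚ <ℚ_)
          (trans (sym (ℚ.+-identityˡ (ρ k ∙ z))) (trans (cong (_+ ρ k ∙ z) (sym (tight-terms cw {t′} tf′ e′ k 0<c)))
            (trans (sym (rel (ρ k))) (trans (cong (_+ ρ k ∙ z′) (tight-terms cw {t} tf e k 0<c)) (ℚ.+-identityˡ (ρ k ∙ z′)))))) 0<ρ)

      -- By `unique-gen` the generator positive at z occurs in both `w` and `w′`, hence annihilates
      -- t₁ and t₂. On it t₃ then equals the positive entry at z, although a tight functional is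
      -- nonpositive.
      touching : ∀ {z w w′ t₁ t₂ t₃} → Bump z → Cone w → Cone w′ → TightFun t₁ → TightFun t₂ → TightFun t₃ →
        S w t₂ ≡ 0ℚ → S w′ t₁ ≡ 0ℚ → 0ℚ <ℚ w ∙ z → 0ℚ <ℚ w′ ∙ z → (∀ u → S u t₃ ≡ u ∙ z + (S u t₁ + S u t₂)) → ⊥
      touching {z} {w} {w′} {t₁} {t₂} {t₃} B cw cw′ h₁ h₂ h₃ e e′ wz wz′ rel = go (pos-term cw {z} wz) (pos-term cw′ {z} wz′)
        where
        contra : ∀ k → 0ℚ <ℚ coef cw k → 0ℚ <ℚ coef cw′ k → 0ℚ <ℚ ρ k ∙ z → ⊥
        contra k 0<c 0<c′ 0<ρ = ≤⇒≯ (subst (_≤ℚ 0ℚ) (trans (rel (ρ k)) (trans (cong (ρ k ∙ z +_)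
          (trans (cong₂ _+_ (tight-terms cw′ {t₁} h₁ e′ k 0<c′) (tight-terms cw {t₂} h₂ e k 0<c)) refl)) (ℚ.+-identityʳ (ρ k ∙ z))))
          (cone-tight {ρ k} {t₃} (ρ-cone k) h₃)) 0<ρ
        go : (Σ (Fin m) λ k → 0ℚ <ℚ coef cw k × 0ℚ <ℚ ρ k ∙ z) → (Σ (Fin m) λ k → 0ℚ <ℚ coef cw′ k × 0ℚ <ℚ ρ k ∙ z) → ⊥
        go (k , 0<c , 0<ρ) (k′ , 0<c′ , 0<ρ′) =
          contra k 0<c (subst (λ k → 0ℚ <ℚ coef cw′ k) (sym (unique-gen B k k′ 0<ρ 0<ρ′)) 0<c′) 0<ρ

      -- In a simplicial cone w₁ + w₂ = w₃ + w₄ admits a Riesz refinement, which the four values below exclude.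
      crossing : ∀ {w₁ w₂ w₃ w₄ t₁₁ t₁₂ t₂₁ t₂₂} → Cone w₁ → Cone w₂ → Cone w₃ → Cone w₄ →
        TightFun t₁₁ → TightFun t₁₂ → TightFun t₂₁ → TightFun t₂₂ →
        (∀ u → S u t₁₁ + S u t₂₂ ≡ S u t₁₂ + S u t₂₁) → (∀ i j → w₁ i j + w₂ i j ≡ w₃ i j + w₄ i j) →
        S w₁ t₂₁ ≡ 0ℚ → S w₁ t₂₂ ≡ 0ℚ → S w₃ t₁₂ ≡ 0ℚ → S w₄ t₁₁ ≡ 0ℚ → S w₁ t₁₁ ≡ 0ℚ
      crossing {w₁} {w₂} {w₃} {w₄} {t₁₁} {t₁₂} {t₂₁} {t₂₂} c₁ c₂ c₃ c₄ h₁₁ h₁₂ h₂₁ h₂₂ rel sum e₂₁ e₂₂ e₃ e₄ =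
        trans (S-sum {w₁} (coef c₁) (coef-eq c₁) t₁₁) (sumFin-zero m term)
        where
        l₂ : ∀ x y → 1ℚ * x + 1ℚ * y ≡ x + y
        l₂ = RS.solve-∀ ℚ-ring
        l₃ : ∀ x → x + 0ℚ ≡ x
        l₃ = RS.solve-∀ ℚ-ring
        lin-sum : ∀ {w w′} (c : Cone w) (c′ : Cone w′) i j →
          lin m (λ k → 1ℚ * coef c k + 1ℚ * coef c′ k) r i j ≡ w i j + w′ i j
        lin-sum {w} {w′} c c′ i j = trans (lin-combine 1ℚ 1ℚ (coef c) (coef c′) i j)
          (trans (cong₂ (λ α β → 1ℚ * α + 1ℚ * β) (sym (coef-eq c i j)) (sym (coef-eq c′ i j))) (l₂ (w i j) (w′ i j)))
        coefs : ∀ k → coef c₁ k + coef c₂ k ≡ coef c₃ k + coef c₄ k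
        coefs k = trans (sym (l₂ (coef c₁ k) (coef c₂ k))) (trans (lin-uniq (λ k → 1ℚ * coef c₁ k + 1ℚ * coef c₂ k) (λ k → 1ℚ * coef c₃ k + 1ℚ * coef c₄ k) (λ i j → trans (lin-sum c₁ c₂ i j) (trans (sum i j) (sym (lin-sum c₃ c₄ i j)))) k) (l₂ (coef c₃ k) (coef c₄ k)))
        vanish : ∀ k → 0ℚ <ℚ coef c₁ k → S (ρ k) t₁₁ ≡ 0ℚ
        vanish k p = [ (λ z₄ → [ (λ z₃ → ⊥-elim (≤⇒≯ (subst (coef c₁ k ≤ℚ_) (trans (coefs k) (trans (cong₂ _+_ z₃ z₄) refl)) (a≤a+b (coef-nonneg c₂ k))) p)) , third ]′
                                    (nonneg-pos-cases (coef-nonneg c₃ k))) ,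
                       tight-terms c₄ {t₁₁} h₁₁ e₄ k ]′ (nonneg-pos-cases (coef-nonneg c₄ k))
          where
          third : 0ℚ <ℚ coef c₃ k → S (ρ k) t₁₁ ≡ 0ℚ
          third p₃ = trans (sym (l₃ (S (ρ k) t₁₁))) (trans (cong (S (ρ k) t₁₁ +_) (sym (tight-terms c₁ {t₂₂} h₂₂ e₂₂ k p)))
            (trans (rel (ρ k)) (trans (cong₂ _+_ (tight-terms c₃ {t₁₂} h₁₂ e₃ k p₃) (tight-terms c₁ {t₂₁} h₂₁ e₂₁ k p)) refl)))
        term : ∀ k → coef c₁ k * S (ρ k) t₁₁ ≡ 0ℚ
        term k = [ (λ e → trans (cong (_* S (ρ k) t₁₁) e) (ℚ.*-zeroˡ (S (ρ k) t₁₁))) ,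
                   (λ p → trans (cong (coef c₁ k *_) (vanish k p)) (ℚ.*-zeroʳ (coef c₁ k))) ]′ (nonneg-pos-cases (coef-nonneg c₁ k))

      -- A region closed under the tight links at level θ, without starts or ends at that level, can
      -- be shifted both ways. The opposite directions vanish by `lineality`, so no member of F in
      -- the region enters or leaves at θ.
      no-shift : ∀ θ {Q : X → Set} (Q? : ∀ p → Dec (Q p)) →
        (∀ {p q} → F p → F q → p ≺ q → Out p ≡ θ → π q ≡ θ → (Q p → Q q) × (Q q → Q p)) →
        (∀ {p} → F p → π p ≡ θ → lo p ≡ θ → ¬ Q p) → (∀ {p} → F p → Out p ≡ θ → up p ≡ θ → ¬ Q p) →
        ∀ {p} → F p → Q p → ¬ (π p ≡ θ ⊎ Out p ≡ θ)
      no-shift θ Q? link start end {p} f q h = [ (λ e → clash (trans e₀ (𝟙-yes (IQ? p) ((f , e) , q))) (𝟙-no (OQ? p) λ { ((_ , e′) , _) → <-irr (subst₂ _<ℚ_ e e′ (π<Out f)) })) ,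
                                                 (λ e → clash (𝟙-yes (OQ? p) ((f , e) , q)) (trans e₀ (𝟙-no (IQ? p) λ { ((_ , e′) , _) → <-irr (subst₂ _<ℚ_ e′ e (π<Out f)) }))) ]′ h
        where
        open Shift θ Q? link start end
        clash : ∀ {x} → x ≡ 1ℚ → x ≡ 0ℚ → ⊥
        clash refl ()
        cancel : ∀ α β → (α - β) + (β - α) ≡ 0ℚ
        cancel = RS.solve-∀ ℚ-ring
        l : ∀ α β → α ≡ (α - β) + β
        l = RS.solve-∀ ℚ-ring
        e₀ : 𝟙 (OQ? p) ≡ 𝟙 (IQ? p)
        e₀ = trans (l (𝟙 (OQ? p)) (𝟙 (IQ? p))) (trans (cong (_+ 𝟙 (IQ? p))
          (lineality up-cone down-cone (λ i j → cancel (𝟙 (OQ? (i , j))) (𝟙 (IQ? (i , j)))) (row p) (col p))) (ℚ.+-identityˡ _))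

      -- Tight links between members of the support.

      level-≮ : ∀ {p q} → F p → F q → π p ≡ π q → ¬ p ≺ q
      level-≮ {p} {q} fp fq e h = ≤⇒≯ (π-link (proj₁ fp) (proj₁ fq) h) (subst (_<ℚ Out p) e (π<Out fp))

      level-≮′ : ∀ {p q} → F p → F q → Out p ≡ Out q → ¬ p ≺ q
      level-≮′ {p} {q} fp fq e h = ≤⇒≯ (π-link (proj₁ fp) (proj₁ fq) h) (subst (π q <ℚ_) (sym e) (π<Out fq))

      Pred : X → X → Set
      Pred p y = F y × y ≺ p × Out y ≡ π p × col y < col p

      -- Without such a predecessor the columns from `col p` on form a region to shift at level π p.
      -- Inside it the members entering at this level are in rows up to that of p (`above`), so the
      -- source of a link coming from the left would be a predecessor after all. `SuccNone` is the
      -- mirror image with rows.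
      module PredNone {p : X} (fp : F p) (¬st : ¬ lo p ≡ π p) (none : ∀ y → Node y → ¬ Pred p y) where
        above : ∀ {x} → F x → π x ≡ π p → col p ≤ col x → row x ≤ row p
        above fx e h = ℕ.≮⇒≥ λ h′ → level-≮ fp fx (sym e) (≺-row h′ h)
        link : ∀ {y x} → F y → F x → y ≺ x → Out y ≡ π p → π x ≡ π p → (col p ≤ col y → col p ≤ col x) × (col p ≤ col x → col p ≤ col y)
        link {y} {x} fy fx y≺x ey ex = (λ h → ℕ.≤-trans h (proj₂ (proj₁ y≺x))) , λ h → ℕ.≮⇒≥ λ h′ →
          none y (proj₁ fy) (fy , ≺-col (ℕ.≤-trans (proj₁ (proj₁ y≺x)) (above fx ex h)) h′ , ey , h′)
        start : ∀ {x} → F x → π x ≡ π p → lo x ≡ π p → ¬ col p ≤ col x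
        start {x} fx ex e h = ¬st (ℚ.≤-antisym (lo≤π (proj₁ fp)) (subst (_≤ℚ lo p) e (lo-mono {x} {p} (above fx ex h))))
        end : ∀ {x} → F x → Out x ≡ π p → up x ≡ π p → ¬ col p ≤ col x
        end {x} fx _ e h = ≤⇒≯ (subst (Out p ≤ℚ_) e (ℚ.≤-trans (π+x≤up (proj₁ fp)) (up-mono {p} {x} h))) (π<Out fp)
        absurd : ⊥
        absurd = no-shift (π p) (λ q → col p ℕ.≤? col q) link start end fp ℕ.≤-refl (inj₁ refl)

      pred : ∀ {p} → F p → lo p ≡ π p ⊎ ∃ (Pred p)
      pred {p} fp = case lo p ℚ.≟ π p of λ { (yes e) → inj₁ e ; (no ¬st) → inj₂ ([ id , (λ none → ⊥-elim (PredNone.absurd fp ¬st none)) ]′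
        (search (λ y → F? y ×-dec ((y ≺? p) ×-dec ((Out y ℚ.≟ π p) ×-dec (col y ℕ.<? col p)))))) }

      Succ : X → X → Set
      Succ p x = F x × p ≺ x × Out p ≡ π x × row p < row x

      module SuccNone {p : X} (fp : F p) (¬en : ¬ Out p ≡ up p) (none : ∀ x → Node x → ¬ Succ p x) where
        right : ∀ {y} → F y → Out y ≡ Out p → row y ≤ row p → col p ≤ col y
        right fy e h = ℕ.≮⇒≥ λ h′ → level-≮′ fy fp e (≺-col h h′)
        link : ∀ {y x} → F y → F x → y ≺ x → Out y ≡ Out p → π x ≡ Out p → (row y ≤ row p → row x ≤ row p) × (row x ≤ row p → row y ≤ row p)
        link {y} {x} fy fx y≺x ey ex = (λ h → ℕ.≮⇒≥ λ h′ →
          none x (proj₁ fx) (fx , ≺-row h′ (ℕ.≤-trans (right fy ey h) (proj₂ (proj₁ y≺x))) , sym ex , h′)) ,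
          ℕ.≤-trans (proj₁ (proj₁ y≺x))
        start : ∀ {x} → F x → π x ≡ Out p → lo x ≡ Out p → ¬ row x ≤ row p
        start {x} fx _ e h = ≤⇒≯ (subst (_≤ℚ π p) e (ℚ.≤-trans (lo-mono {x} {p} h) (lo≤π (proj₁ fp)))) (π<Out fp)
        end : ∀ {y} → F y → Out y ≡ Out p → up y ≡ Out p → ¬ row y ≤ row p
        end {y} fy ey e h = ¬en (ℚ.≤-antisym (π+x≤up (proj₁ fp)) (subst (up p ≤ℚ_) e (up-mono {p} {y} (right fy ey h))))
        absurd : ⊥
        absurd = no-shift (Out p) (λ q → row q ℕ.≤? row p) link start end fp ℕ.≤-refl (inj₂ refl)

      succ : ∀ {p} → F p → Out p ≡ up p ⊎ ∃ (Succ p)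
      succ {p} fp = case Out p ℚ.≟ up p of λ { (yes e) → inj₁ e ; (no ¬en) → inj₂ ([ id , (λ none → ⊥-elim (SuccNone.absurd fp ¬en none)) ]′
        (search (λ x → F? x ×-dec ((p ≺? x) ×-dec ((Out p ℚ.≟ π x) ×-dec (row p ℕ.<? row x)))))) }

      size : X → ℕ
      size p = row p ℕ.+ col p

      ≺-size : ∀ {p q} → p ≺ q → size p < size q
      ≺-size ((a , b) , inj₁ c) = ℕ.+-mono-<-≤ c b
      ≺-size ((a , b) , inj₂ c) = ℕ.+-mono-≤-< a c

      -- The bounds on `Out` and π are carried along because they later keep the lists away from the
      -- level sets `O θ` and `I θ`.
      Init Fin′ : X → Set
      Init p = Σ (Pre p) λ A → All (λ y → F y × Out y ≤ℚ π p) (Pre.list A)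
      Fin′ p = Σ (Post p) λ B → All (λ y → F y × Out p ≤ℚ π y) (Post.list B)

      init-snoc : ∀ {y p} → Init y → F y → F p → y ≺ p → Out y ≡ π p → Init p
      init-snoc {y} {p} (A , sup) fy fp y≺p e = snoc A (proj₁ fy) (proj₁ fp) y≺p e ,
        (fy , ≤-eq e) ∷ All.map (λ { (fz , h) → fz , ℚ.≤-trans h (ℚ.≤-trans (ℚ.<⇒≤ (π<Out fy)) (≤-eq e)) }) sup

      fin-cons : ∀ {p x} → Fin′ x → F p → F x → p ≺ x → Out p ≡ π x → Fin′ p
      fin-cons {p} {x} (B , sup) fp fx p≺x e = cons B (proj₁ fp) (proj₁ fx) p≺x e ,
        (fx , ≤-eq e) ∷ All.map (λ { (fz , h) → fz , ℚ.≤-trans (≤-eq e) (ℚ.≤-trans (ℚ.<⇒≤ (π<Out fx)) h) }) sup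

      init : ∀ {p} → F p → Init p
      init {p} fp = go (suc (size p)) p fp ℕ.≤-refl
        where
        go : ∀ N p → F p → size p < N → Init p
        go (suc N) p fp (s≤s h) = [ (λ e → start-pre (proj₁ fp) e , []) ,
          (λ { (y , fy , y≺p , e , _) → init-snoc (go N y fy (ℕ.<-≤-trans (≺-size y≺p) h)) fy fp y≺p e }) ]′ (pred fp)

      fin : ∀ {p} → F p → Fin′ p
      fin {p} fp = go (suc K) p fp (ℕ.m≤m+n (suc K) (size p))
        where
        go : ∀ N p → F p → K < N ℕ.+ size p → Fin′ p
        go zero p fp h = ⊥-elim (ℕ.<⇒≱ h (row+col≤K (proj₁ fp)))
        go (suc N) p fp h = [ (λ e → end-post (proj₁ fp) e , []) ,
          (λ { (x , fx , p≺x , e , _) → fin-cons (go N x fx (ℕ.≤-trans h (ℕ.≤-trans (ℕ.≤-reflexive (sym (ℕ.+-suc N (size p))))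
                  (ℕ.+-monoʳ-≤ N (≺-size p≺x))))) fp fx p≺x e }) ]′ (succ fp)

      -- Exchangeable zeros and bent links.

      Two : X → X → X → Set
      Two z z′ p = z ≡ p ⊎ z′ ≡ p

      two? : ∀ z z′ p → Dec (Two z z′ p)
      two? z z′ p = (z ≟ₓ p) ⊎-dec (z′ ≟ₓ p)

      module _ {z z′ : X} (nz : Node z) (nz′ : Node z′) (ez : v ∙ z ≡ 0ℚ) (ez′ : v ∙ z′ ≡ 0ℚ)
               (z⊀z′ : ¬ z ≺ z′) (z′⊀z : ¬ z′ ≺ z) where

        two-node : ∀ {p} → Two z z′ p → Node p
        two-node (inj₁ refl) = nz
        two-node (inj₂ refl) = nz′

        two-incomparable : ∀ {p q} → Two z z′ p → Two z z′ q → ¬ p ≺ q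
        two-incomparable (inj₁ refl) (inj₁ refl) = ≺-irrefl
        two-incomparable (inj₁ refl) (inj₂ refl) = z⊀z′
        two-incomparable (inj₂ refl) (inj₁ refl) = z′⊀z
        two-incomparable (inj₂ refl) (inj₂ refl) = ≺-irrefl

        two-¬F : ∀ {p} → F p → ¬ Two z z′ p
        two-¬F f (inj₁ refl) = F⇒≢0 f ez
        two-¬F f (inj₂ refl) = F⇒≢0 f ez′

        two-O-cone : ∀ θ → π z ≡ θ → π z′ ≡ θ → ¬ lo z ≡ θ → ¬ lo z′ ≡ θ → Cone (diff (two? z z′) (O? θ))
        two-O-cone θ e e′ s s′ = minus-O-cone (two? z z′) θ two-node two-incomparable
          (λ { (inj₁ refl) → e ; (inj₂ refl) → e′ }) (λ { (inj₁ refl) → s ; (inj₂ refl) → s′ })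

        two-I-cone : ∀ θ → Out z ≡ θ → Out z′ ≡ θ → ¬ up z ≡ θ → ¬ up z′ ≡ θ → Cone (diff (two? z z′) (I? θ))
        two-I-cone θ e e′ s s′ = minus-I-cone (two? z z′) θ two-node two-incomparable
          (λ { (inj₁ refl) → e ; (inj₂ refl) → e′ }) (λ { (inj₁ refl) → s ; (inj₂ refl) → s′ })

        two-at : ∀ {Q : X → Set} (Q? : ∀ p → Dec (Q p)) → (∀ {p} → Q p → F p) → ∀ {p} → Two z z′ p → diff (two? z z′) Q? ∙ p ≡ 1ℚ
        two-at Q? Q⇒F {p} t = 1-0 (𝟙-yes (two? z z′ p) t) (𝟙-no (Q? p) λ q → two-¬F (Q⇒F q) t)

        two-off : ∀ {Q : X → Set} (Q? : ∀ p → Dec (Q p)) → ∀ {p} → F p → ¬ Q p → diff (two? z z′) Q? ∙ p ≡ 0ℚ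
        two-off Q? {p} f ¬q = 0-0 (𝟙-no (two? z z′ p) (two-¬F f)) (𝟙-no (Q? p) ¬q)

        two-on : ∀ {Q : X → Set} (Q? : ∀ p → Dec (Q p)) → ∀ {p} → F p → Q p → diff (two? z z′) Q? ∙ p ≡ - 1ℚ
        two-on Q? {p} f q = 0-1 (𝟙-no (two? z z′ p) (two-¬F f)) (𝟙-yes (Q? p) q)

      -- At a zero π z = `Out z`, and lo z < up z, so z cannot be both a start and an end. One of
      -- the two ways of paying for the entry at z is therefore available.
      bump : ∀ {z} → Node z → v ∙ z ≡ 0ℚ → Bump z
      bump {z} nz ez = [ (λ h → mk (O? (π z)) proj₁ (minus-O-cone (z ≟ₓ_) (π z) (single nz) single-incomparable (λ { refl → refl }) (λ { refl → h }))) ,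
                         (λ h → mk (I? (Out z)) proj₁ (minus-I-cone (z ≟ₓ_) (Out z) (single nz) single-incomparable (λ { refl → refl }) (λ { refl → h }))) ]′ cases
        where
        cases : ¬ lo z ≡ π z ⊎ ¬ up z ≡ Out z
        cases = case lo z ℚ.≟ π z of λ { (no ne) → inj₁ ne
          ; (yes e) → inj₂ λ e′ → <-irr (subst (lo z <ℚ_) (trans e′ (trans (cong (π z +_) ez) (trans (ℚ.+-identityʳ (π z)) (sym e)))) (lo<up nz)) }
        mk : ∀ {Q : X → Set} (Q? : ∀ p → Dec (Q p)) → (∀ {p} → Q p → F p) → Cone (diff (z ≟ₓ_) Q?) → Bump z
        mk Q? Q⇒F c = record
          { u = diff (z ≟ₓ_) Q? ; u₀ = λ i j → - 𝟙 (Q? (i , j)) ; u-cone = c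
          ; u₀-cone = nonpos-cone (λ i j → - 𝟙 (Q? (i , j))) (λ i j → ℚ.neg-antimono-≤ (0≤𝟙 (Q? (i , j)))) (λ {p} ¬f → cong -_ (𝟙-no (Q? p) (¬f ∘ Q⇒F)))
          ; u-split = λ i j → refl ; u₀-zero = λ {p} e → cong -_ (𝟙-no (Q? p) λ q → F⇒≢0 (Q⇒F q) e)
          ; z-node = nz ; z-zero = ez }

      -- Two exchangeable zeros z, z′ on otherwise equal tight chains contradict simpliciality.
      no-exchange : ∀ {z z′} (nz : Node z) (nz′ : Node z′) (ez : v ∙ z ≡ 0ℚ) (ez′ : v ∙ z′ ≡ 0ℚ) →
        ¬ z ≺ z′ → ¬ z′ ≺ z → ¬ z ≡ z′ →
        ∀ {Q : X → Set} (Q? : ∀ p → Dec (Q p)) → (∀ {p} → Q p → F p) → Cone (diff (two? z z′) Q?) →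
        ∀ (s : X → List X) {s′ q} → All (λ p → F p × ¬ Q p) s′ → Q q → TightFun (s z) → TightFun (s z′) →
        (∀ u ζ → S u (s ζ) ≡ u ∙ ζ + (u ∙ q + S u s′)) → ⊥
      no-exchange {z} {z′} nz nz′ ez ez′ i₁ i₂ ne Q? Q⇒F c s {s′} {q} sup qq t t′ S-eq =
        exchange {w = w} {t = s z} {t′ = s z′} (bump nz ez) ez′ ne c t t′ (S0 (inj₁ refl)) (S0 (inj₂ refl))
          (subst (0ℚ <ℚ_) (sym (at (inj₁ refl))) 0<1)
          (λ u → trans (cong (_+ u ∙ z′) (S-eq u z)) (trans (l (u ∙ z) (u ∙ q + S u s′) (u ∙ z′)) (cong (_+ u ∙ z) (sym (S-eq u z′)))))
        where
        w = diff (two? z z′) Q?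
        at : ∀ {p} → Two z z′ p → w ∙ p ≡ 1ℚ
        at = two-at nz nz′ ez ez′ i₁ i₂ Q? Q⇒F
        l : ∀ x y z → (x + y) + z ≡ (z + y) + x
        l = RS.solve-∀ ℚ-ring
        S0 : ∀ {ζ} → Two z z′ ζ → S w (s ζ) ≡ 0ℚ
        S0 {ζ} h = trans (S-eq w ζ) (trans (cong₂ _+_ (at h) (cong₂ _+_ (two-on nz nz′ ez ez′ i₁ i₂ Q? (Q⇒F qq) qq)
          (S-zero w s′ (All.map (λ { {p} (f , ¬q) → two-off nz nz′ ez ez′ i₁ i₂ Q? {p} f ¬q }) sup)))) refl)

      -- `A` is monotone. The inequality makes the lower left corner of a bent link a node.
      row<col-corner : ∀ {p q} → Node p → lo p <ℚ up q → row p < col q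
      row<col-corner {suc i , _} {k , suc l} np h = s≤s (ℕ.<-≤-trans (A-reflect-< {i} {l ℕ.⊓ n} h) (ℕ.m⊓n≤m l n))
      row<col-corner {suc i , _} {k , zero} np h = ⊥-elim (ℕ.n≮0 (A-reflect-< {i} {0} h))

      -- A tight link that advances in both row and column, with both corners nodes. The corners are
      -- zeros at level θ and replace each other on a tight chain. `no-exchange` then forces p to be
      -- a start and q to be an end, so lo p = θ = up q.
      module Link {q p : X} (fq : F q) (fp : F p) (r< : row q < row p) (c< : col q < col p)
                  (e : Out q ≡ π p) (lo<up′ : lo p <ℚ up q) where
        private
          θ = π p
          nq = proj₁ fq
          np = proj₁ fp
          z z′ : X
          z  = row q , col p
          z′ = row p , col q
          nz : Node z
          nz = 1≤row nq , ℕ.<-trans r< (row<col np) , ℕ.≤-trans (ℕ.+-monoˡ-≤ (col p) (ℕ.<⇒≤ r<)) (row+col≤K np)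
          nz′ : Node z′
          nz′ = 1≤row np , row<col-corner {p} {q} np lo<up′ , ℕ.≤-trans (ℕ.+-monoʳ-≤ (row p) (ℕ.<⇒≤ c<)) (row+col≤K np)
          q≺z : q ≺ z
          q≺z = ≺-col ℕ.≤-refl c<
          z≺p : z ≺ p
          z≺p = ≺-row r< ℕ.≤-refl
          q≺z′ : q ≺ z′
          q≺z′ = ≺-row r< ℕ.≤-refl
          z′≺p : z′ ≺ p
          z′≺p = ≺-col ℕ.≤-refl c<
          Z = between-zero nq nz np q≺z z≺p e refl
          Z′ = between-zero nq nz′ np q≺z′ z′≺p e refl
          z⊀z′ : ¬ z ≺ z′
          z⊀z′ ((_ , h) , _) = ℕ.<⇒≱ c< h
          z′⊀z : ¬ z′ ≺ z
          z′⊀z ((h , _) , _) = ℕ.<⇒≱ r< h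
          z≢z′ : ¬ z ≡ z′
          z≢z′ h = ℕ.<-irrefl (cong row h) r<
          Iq = init fq
          Fp = fin fp
          α = Pre.list (proj₁ Iq)
          β = Post.list (proj₁ Fp)
          s : X → List X
          s ζ = p ∷ ζ ∷ q ∷ (α ++ β)
          tz : TightFun (s z)
          tz = close (snoc (snoc (proj₁ Iq) nq nz q≺z (trans e (sym (proj₁ (proj₂ Z))))) nz np z≺p (proj₂ (proj₂ Z))) (proj₁ Fp)
          tz′ : TightFun (s z′)
          tz′ = close (snoc (snoc (proj₁ Iq) nq nz′ q≺z′ (trans e (sym (proj₁ (proj₂ Z′))))) nz′ np z′≺p (proj₂ (proj₂ Z′))) (proj₁ Fp)
          πq<θ : π q <ℚ θ
          πq<θ = subst (π q <ℚ_) e (π<Out fq)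
          αlow : All (λ y → F y × Out y <ℚ θ) α
          αlow = All.map (λ { (f , h) → f , ℚ.≤-<-trans h πq<θ }) (proj₂ Iq)
          βhigh : All (λ y → F y × θ <ℚ π y) β
          βhigh = All.map (λ { (f , h) → f , ℚ.<-≤-trans (π<Out fp) h }) (proj₂ Fp)
          l₁ : ∀ p z q s → p + (z + (q + s)) ≡ z + (q + (p + s))
          l₁ = RS.solve-∀ ℚ-ring
          l₂ : ∀ p z q s → p + (z + (q + s)) ≡ z + (p + (q + s))
          l₂ = RS.solve-∀ ℚ-ring

        bent-start : lo p ≡ θ
        bent-start = decidable-stable (lo p ℚ.≟ θ) λ ¬st → no-exchange nz nz′ (proj₁ Z) (proj₁ Z′) z⊀z′ z′⊀z z≢z′ (O? θ) proj₁
              (two-O-cone nz nz′ (proj₁ Z) (proj₁ Z′) z⊀z′ z′⊀z θ (proj₁ (proj₂ Z)) (proj₁ (proj₂ Z′))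
                (λ h → ≤⇒≯ (subst (_≤ℚ lo p) h (lo-mono {z} {p} (ℕ.<⇒≤ r<))) (≤∧≢⇒< (lo≤π np) ¬st)) ¬st)
              s {s′ = p ∷ (α ++ β)} {q = q}
              ((fp , λ o → <-irr (subst (θ <ℚ_) (proj₂ o) (π<Out fp))) ∷
                All-++ (All.map (λ { (f , h) → f , λ o → <-irr (subst (_<ℚ θ) (proj₂ o) h) }) αlow)
                       (All.map (λ { (f , h) → f , λ o → <-irr (ℚ.<-trans h (subst (_ <ℚ_) (proj₂ o) (π<Out f))) }) βhigh))
              (fq , e) tz tz′ (λ u ζ → l₁ (u ∙ p) (u ∙ ζ) (u ∙ q) (S u (α ++ β)))

        bent-end : up q ≡ θ
        bent-end = decidable-stable (up q ℚ.≟ θ) λ ¬en → no-exchange nz nz′ (proj₁ Z) (proj₁ Z′) z⊀z′ z′⊀z z≢z′ (I? θ) proj₁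
              (two-I-cone nz nz′ (proj₁ Z) (proj₁ Z′) z⊀z′ z′⊀z θ (proj₂ (proj₂ Z)) (proj₂ (proj₂ Z′))
                (λ h → ≤⇒≯ (subst (up q ≤ℚ_) h (up-mono {q} {z} (ℕ.<⇒≤ c<))) (≤∧≢⇒< (subst (_≤ℚ up q) e (π+x≤up nq)) (¬en ∘ sym))) ¬en)
              s {s′ = q ∷ (α ++ β)} {q = p}
              ((fq , λ o → <-irr (subst (_<ℚ θ) (proj₂ o) πq<θ)) ∷
                All-++ (All.map (λ { (f , h) → f , λ o → <-irr (ℚ.<-trans (subst (_<ℚ _) (proj₂ o) (π<Out f)) h) }) αlow)
                       (All.map (λ { (f , h) → f , λ o → <-irr (subst (θ <ℚ_) (proj₂ o) h) }) βhigh))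
              (fp , refl) tz tz′ (λ u ζ → l₂ (u ∙ p) (u ∙ ζ) (u ∙ q) (S u (α ++ β)))

        bent-⊥ : ⊥
        bent-⊥ = <-irr (subst₂ _<ℚ_ bent-start bent-end lo<up′)

      -- A predecessor y in a higher row cannot satisfy lo p < up y by `Link`; then π p = Out y ≤ up
      -- y ≤ lo p, and p is a start.
      row-pred : ∀ {p} → F p → lo p ≡ π p ⊎ Σ X λ y → F y × row y ≡ row p × col y < col p × Out y ≡ π p
      row-pred {p} fp = [ inj₁ , (λ { (y , fy , y≺p , e , c<) → [ (λ r< → inj₁ (helper y fy e c< r<)) , (λ r≡ → inj₂ (y , fy , r≡ , c< , e)) ]′ (ℕ.m≤n⇒m<n∨m≡n (proj₁ (proj₁ y≺p))) }) ]′ (pred fp)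
        where
        helper : ∀ y → F y → Out y ≡ π p → col y < col p → row y < row p → lo p ≡ π p
        helper y fy e c< r< = case lo p ℚ.<? up y of λ
          { (yes h) → ⊥-elim (Link.bent-⊥ fy fp r< c< e h)
          ; (no h) → ℚ.≤-antisym (lo≤π (proj₁ fp)) (ℚ.≤-trans (subst (_≤ℚ up y) e (π+x≤up (proj₁ fy))) (ℚ.≮⇒≥ h)) }

      col-succ : ∀ {p} → F p → Out p ≡ up p ⊎ Σ X λ x → F x × col x ≡ col p × row p < row x × Out p ≡ π x
      col-succ {p} fp = [ inj₁ , (λ { (x , fx , p≺x , e , r<) → [ (λ c< → inj₁ (helper x fx e c< r<)) , (λ c≡ → inj₂ (x , fx , sym c≡ , r< , e)) ]′ (ℕ.m≤n⇒m<n∨m≡n (proj₂ (proj₁ p≺x))) }) ]′ (succ fp)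
        where
        helper : ∀ x → F x → Out p ≡ π x → col p < col x → row p < row x → Out p ≡ up p
        helper x fx e c< r< = case lo x ℚ.<? up p of λ
          { (yes h) → ⊥-elim (Link.bent-⊥ fp fx r< c< e h)
          ; (no h) → ℚ.≤-antisym (π+x≤up (proj₁ fp)) (ℚ.≤-trans (ℚ.≮⇒≥ h) (subst (lo x ≤ℚ_) (sym e) (lo≤π (proj₁ fx)))) }

      -- Crossing and touching segments.

      Down : ℕ → X → X → Set
      Down k p q = F q × col q ≡ col p × row p ≤ row q × row q < k ×
        (Out q ≡ up q ⊎ Σ X λ x → F x × col x ≡ col p × k ≤ row x × Out q ≡ π x)

      -- The walk along tight links stops at an end, or just before the link that jumps to row k or
      -- beyond. `left-to` is the same for rows, walking backwards.
      down-to : ∀ k {p} → F p → row p < k → ∃ (Down k p)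
      down-to k {p} fp h = go (k ∸ row p) p fp h (ℕ.≤-reflexive (sym (ℕ.m∸n+n≡m (ℕ.<⇒≤ h))))
        where
        go : ∀ N p → F p → row p < k → k ≤ N ℕ.+ row p → ∃ (Down k p)
        go zero p fp h h′ = ⊥-elim (ℕ.<⇒≱ h h′)
        go (suc N) p fp h h′ = [ (λ e → p , fp , refl , ℕ.≤-refl , h , inj₁ e) ,
          (λ { (x , fx , c , r< , e) → [ (λ x<k → step (go N x fx x<k (ℕ.≤-trans h′ (ℕ.≤-trans (ℕ.≤-reflexive (sym (ℕ.+-suc N (row p)))) (ℕ.+-monoʳ-≤ N r<)))) c r<) ,
                                         (λ k≤x → p , fp , refl , ℕ.≤-refl , h , inj₂ (x , fx , c , k≤x , e)) ]′ (ℕ.<-≤-connex (row x) k) }) ]′ (col-succ fp)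
          where
          step : ∀ {x} → ∃ (Down k x) → col x ≡ col p → row p < row x → ∃ (Down k p)
          step (q , fq , c , r≤ , r< , t) c′ r = q , fq , trans c c′ , ℕ.≤-trans (ℕ.<⇒≤ r) r≤ , r< ,
            [ inj₁ , (λ { (y , fy , cy , ky , ey) → inj₂ (y , fy , trans cy c′ , ky , ey) }) ]′ t

      Left : ℕ → X → X → Set
      Left j p q = F q × row q ≡ row p × j < col q ×
        (lo q ≡ π q ⊎ Σ X λ b → F b × row b ≡ row p × col b ≤ j × Out b ≡ π q)

      left-to : ∀ j {p} → F p → j < col p → ∃ (Left j p)
      left-to j {p} fp h = go (col p) p fp h ℕ.≤-refl
        where
        go : ∀ N p → F p → j < col p → col p ≤ N → ∃ (Left j p)
        go zero p fp h h′ = ⊥-elim (ℕ.n≮0 (ℕ.<-≤-trans h h′))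
        go (suc N) p fp h h′ = [ (λ e → p , fp , refl , h , inj₁ e) ,
          (λ { (y , fy , r≡ , c< , e) → [ (λ j<y → step {y} (go N y fy j<y (ℕ.≤-pred (ℕ.<-≤-trans c< h′))) r≡) ,
                                          (λ y≤j → p , fp , refl , h , inj₂ (y , fy , r≡ , y≤j , e)) ]′ (ℕ.<-≤-connex j (col y)) }) ]′ (row-pred fp)
          where
          step : ∀ {y} → ∃ (Left j y) → row y ≡ row p → ∃ (Left j p)
          step (q , fq , r , c< , t) r′ = q , fq , trans r r′ , c< ,
            [ inj₁ , (λ { (b , fb , rb , cb , eb) → inj₂ (b , fb , trans rb r′ , cb , eb) }) ]′ t

      -- At c the chain q → c → q′ turns opposite to a hook: q is off the row of c and q′ off its
      -- column. But c also has a tight past along its row and a tight future along its column,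
      -- either possibly empty. Combining the two pasts with the two futures gives the four tight
      -- chains of `crossing`.
      module Valley {q c q′ : X} (fq : F q) (fc : F c) (fq′ : F q′) (q≺c : q ≺ c) (c≺q′ : c ≺ q′)
                    (e : Out q ≡ π c) (e′ : Out c ≡ π q′)
                    (row-q≢ : ¬ row q ≡ row c) (col-q′≢ : ¬ col q′ ≡ col c)
                    (q-not-end : ¬ up q ≡ π c) (q′-not-start : ¬ lo q′ ≡ Out c) where
        private
          θ = π c
          θ′ = Out c
          nq = proj₁ fq
          nc = proj₁ fc
          nq′ = proj₁ fq′
          θ<θ′ : θ <ℚ θ′
          θ<θ′ = π<Out fc
          πq<θ : π q <ℚ θ
          πq<θ = subst (π q <ℚ_) e (π<Out fq)
          θ′<Oq′ : θ′ <ℚ Out q′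
          θ′<Oq′ = subst (_<ℚ Out q′) (sym e′) (π<Out fq′)

          Low High : X → Set
          Low y = F y × Out y ≤ℚ θ
          High y = F y × θ′ ≤ℚ π y

          -- The past of c along its own row. It avoids q, whose `Out` equals that of the last node
          -- of this past but whose row differs from that of c.
          Ic : Σ (Pre c) λ P → All (λ y → Low y × ¬ q ≡ y) (Pre.list P)
          Ic = [ (λ st → start-pre nc st , []) ,
                 (λ { (y , fy , ry , c< , ey) → snoc (proj₁ (init fy)) (proj₁ fy) nc (≺-col (ℕ.≤-reflexive ry) c<) ey ,
                      ((fy , ≤-eq ey) , λ { refl → row-q≢ ry }) ∷
                      All.map (λ { {x} (f , h) → (f , ℚ.≤-trans h (ℚ.≤-trans (ℚ.<⇒≤ (π<Out fy)) (≤-eq ey))) ,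
                        λ { refl → <-irr (ℚ.≤-<-trans h (subst (π y <ℚ_) (trans ey (sym e)) (π<Out fy))) } }) (proj₂ (init fy)) }) ]′ (row-pred fc)

          Fc : Σ (Post c) λ P → All (λ y → High y × ¬ q′ ≡ y) (Post.list P)
          Fc = [ (λ en → end-post nc en , []) ,
                 (λ { (x , fx , cx , r< , ex) → cons (proj₁ (fin fx)) nc (proj₁ fx) (≺-row r< (ℕ.≤-reflexive (sym cx))) ex ,
                      ((fx , ≤-eq ex) , λ { refl → col-q′≢ cx }) ∷
                      All.map (λ { {y} (f , h) → (f , ℚ.≤-trans (≤-eq ex) (ℚ.≤-trans (ℚ.<⇒≤ (π<Out fx)) h)) ,
                        λ { refl → <-irr (ℚ.<-≤-trans (subst (_<ℚ Out x) (trans (sym ex) e′) (π<Out fx)) h) } }) (proj₂ (fin fx)) }) ]′ (col-succ fc)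

          Iq = init fq
          Fq′ = fin fq′
          α = Pre.list (proj₁ Iq)
          β = Post.list (proj₁ Fq′)
          αc = Pre.list (proj₁ Ic)
          βc = Post.list (proj₁ Fc)

          Pq : Pre c
          Pq = snoc (proj₁ Iq) nq nc q≺c e
          t₁₁ : TightFun (q′ ∷ c ∷ q ∷ (α ++ β))
          t₁₁ = close (snoc Pq nc nq′ c≺q′ e′) (proj₁ Fq′)
          t₁₂ : TightFun (c ∷ q ∷ (α ++ βc))
          t₁₂ = close Pq (proj₁ Fc)
          t₂₁ : TightFun (q′ ∷ c ∷ (αc ++ β))
          t₂₁ = close (snoc (proj₁ Ic) nc nq′ c≺q′ e′) (proj₁ Fq′)
          t₂₂ : TightFun (c ∷ (αc ++ βc))
          t₂₂ = close (proj₁ Ic) (proj₁ Fc)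

          B C : X → Set
          B p = I θ p × ¬ c ≡ p
          C p = O θ′ p × ¬ c ≡ p
          B? : ∀ p → Dec (B p)
          B? p = I? θ p ×-dec ¬? (c ≟ₓ p)
          C? : ∀ p → Dec (C p)
          C? p = O? θ′ p ×-dec ¬? (c ≟ₓ p)

          -- Two decompositions of one direction: the entries at q, respectively q′, cancel, and
          -- both sums equal minus the indicators of `B`, of `C` and of c.
          w₁ w₂ w₃ w₄ : Pt
          w₁ i j = - 𝟙 (q ≟ₓ (i , j)) - 𝟙 (C? (i , j))
          w₂ = diff (q ≟ₓ_) (I? θ)
          w₃ i j = - 𝟙 (q′ ≟ₓ (i , j)) - 𝟙 (B? (i , j))
          w₄ = diff (q′ ≟ₓ_) (O? θ′)

          neg-sum : ∀ {x y} → 0ℚ ≤ℚ x → 0ℚ ≤ℚ y → - x - y ≤ℚ 0ℚ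
          neg-sum h h′ = ℚ.neg-antimono-≤ h ⊕ ℚ.neg-antimono-≤ h′

          neg-zero : ∀ {x y} → x ≡ 0ℚ → y ≡ 0ℚ → - x - y ≡ 0ℚ
          neg-zero refl refl = refl

          c₁ : Cone w₁
          c₁ = nonpos-cone w₁ (λ i j → neg-sum (0≤𝟙 (q ≟ₓ (i , j))) (0≤𝟙 (C? (i , j))))
            (λ {p} ¬f → neg-zero (𝟙-no (q ≟ₓ p) λ { refl → ¬f fq }) (𝟙-no (C? p) λ { ((f , _) , _) → ¬f f }))
          c₂ : Cone w₂
          c₂ = minus-I-cone (q ≟ₓ_) θ (single nq) single-incomparable (λ { refl → e }) (λ { refl → q-not-end })
          c₃ : Cone w₃
          c₃ = nonpos-cone w₃ (λ i j → neg-sum (0≤𝟙 (q′ ≟ₓ (i , j))) (0≤𝟙 (B? (i , j))))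
            (λ {p} ¬f → neg-zero (𝟙-no (q′ ≟ₓ p) λ { refl → ¬f fq′ }) (𝟙-no (B? p) λ { ((f , _) , _) → ¬f f }))
          c₄ : Cone w₄
          c₄ = minus-O-cone (q′ ≟ₓ_) θ′ (single nq′) single-incomparable (λ { refl → sym e′ }) (λ { refl → q′-not-start })

          split : ∀ {P : X → Set} (P? : ∀ p → Dec (P p)) → P c → ∀ p → 𝟙 (P? p) ≡ 𝟙 (P? p ×-dec ¬? (c ≟ₓ p)) + 𝟙 (c ≟ₓ p)
          split P? pc p with P? p | c ≟ₓ p
          ... | yes _ | yes _ = refl
          ... | yes _ | no _  = refl
          ... | no ¬p | yes refl = ⊥-elim (¬p pc)
          ... | no _  | no _  = refl

          sum : ∀ i j → w₁ i j + w₂ i j ≡ w₃ i j + w₄ i j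
          sum i j = trans (cong (λ z → (- 𝟙 (q ≟ₓ (i , j)) - 𝟙 (C? (i , j))) + (𝟙 (q ≟ₓ (i , j)) - z)) (split (I? θ) (fc , refl) (i , j)))
            (trans (l (𝟙 (q ≟ₓ (i , j))) (𝟙 (q′ ≟ₓ (i , j))) (𝟙 (C? (i , j))) (𝟙 (B? (i , j))) (𝟙 (c ≟ₓ (i , j))))
              (cong (λ z → (- 𝟙 (q′ ≟ₓ (i , j)) - 𝟙 (B? (i , j))) + (𝟙 (q′ ≟ₓ (i , j)) - z)) (sym (split (O? θ′) (fc , refl) (i , j)))))
            where
            l : ∀ q q′ C B c → (- q - C) + (q - (B + c)) ≡ (- q′ - B) + (q′ - (C + c))
            l = RS.solve-∀ ℚ-ring

          w₁0 : ∀ {y} → ¬ q ≡ y → ¬ C y → w₁ ∙ y ≡ 0ℚ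
          w₁0 {y} h h′ = neg-zero (𝟙-no (q ≟ₓ y) h) (𝟙-no (C? y) h′)
          w₃0 : ∀ {y} → ¬ q′ ≡ y → ¬ B y → w₃ ∙ y ≡ 0ℚ
          w₃0 {y} h h′ = neg-zero (𝟙-no (q′ ≟ₓ y) h) (𝟙-no (B? y) h′)
          w₄0 : ∀ {y} → ¬ q′ ≡ y → ¬ O θ′ y → w₄ ∙ y ≡ 0ℚ
          w₄0 {y} h h′ = 0-0 (𝟙-no (q′ ≟ₓ y) h) (𝟙-no (O? θ′ y) h′)

          α-low : All Low α
          α-low = All.map (λ { (f , h) → f , ℚ.≤-trans h (ℚ.<⇒≤ πq<θ) }) (proj₂ Iq)
          α-≢q : All (λ y → ¬ q ≡ y) α
          α-≢q = All.map (λ { (f , h) refl → <-irr (ℚ.≤-<-trans h (π<Out f)) }) (proj₂ Iq)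
          β-high : All High β
          β-high = All.map (λ { (f , h) → f , ℚ.≤-trans (ℚ.<⇒≤ θ′<Oq′) h }) (proj₂ Fq′)
          β-≢q′ : All (λ y → ¬ q′ ≡ y) β
          β-≢q′ = All.map (λ { (f , h) refl → <-irr (ℚ.<-≤-trans (π<Out f) h) }) (proj₂ Fq′)

          low-¬O : ∀ {y} → Low y → ¬ O θ′ y
          low-¬O (_ , h) (_ , eo) = ≤⇒≯ (subst (_≤ℚ θ) eo h) θ<θ′
          high-¬O : ∀ {y} → High y → ¬ O θ′ y
          high-¬O (f , h) (_ , eo) = ≤⇒≯ h (subst (_ <ℚ_) eo (π<Out f))
          low-¬I : ∀ {y} → Low y → ¬ I θ y
          low-¬I (f , h) (_ , ei) = ≤⇒≯ h (subst (_<ℚ _) ei (π<Out f))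
          high-¬I : ∀ {y} → High y → ¬ I θ y
          high-¬I (_ , h) (_ , ei) = ≤⇒≯ (subst (θ′ ≤ℚ_) ei h) θ<θ′
          high-≢q : ∀ {y} → High y → ¬ q ≡ y
          high-≢q (f , h) refl = ≤⇒≯ (ℚ.≤-trans (ℚ.<⇒≤ θ<θ′) h) πq<θ
          low-≢q′ : ∀ {y} → Low y → ¬ q′ ≡ y
          low-≢q′ (f , h) refl = ≤⇒≯ h (ℚ.<-trans θ<θ′ θ′<Oq′)
          low-q : Low q
          low-q = fq , ≤-eq e
          high-q′ : High q′
          high-q′ = fq′ , ≤-eq e′
          c≢q : ¬ q ≡ c
          c≢q refl = row-q≢ refl
          c≢q′ : ¬ q′ ≡ c
          c≢q′ refl = col-q′≢ refl

          w₁-β : All (λ y → w₁ ∙ y ≡ 0ℚ) β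
          w₁-β = All.map (λ h → w₁0 (high-≢q h) (high-¬O h ∘ proj₁)) β-high
          w₁-αc : All (λ y → w₁ ∙ y ≡ 0ℚ) αc
          w₁-αc = All.map (λ { (h , ne) → w₁0 ne (low-¬O h ∘ proj₁) }) (proj₂ Ic)
          w₁-q′ : w₁ ∙ q′ ≡ 0ℚ
          w₁-q′ = w₁0 (high-≢q high-q′) (high-¬O high-q′ ∘ proj₁)
          w₁-c : w₁ ∙ c ≡ 0ℚ
          w₁-c = w₁0 c≢q (λ h → proj₂ h refl)

          zero₂₁ : S w₁ (q′ ∷ c ∷ (αc ++ β)) ≡ 0ℚ
          zero₂₁ = S-zero w₁ (q′ ∷ c ∷ (αc ++ β)) (w₁-q′ ∷ w₁-c ∷ All-++ w₁-αc w₁-β)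
          zero₂₂ : S w₁ (c ∷ (αc ++ βc)) ≡ 0ℚ
          zero₂₂ = S-zero w₁ (c ∷ (αc ++ βc)) (w₁-c ∷ All-++ w₁-αc (All.map (λ { (h , _) → w₁0 (high-≢q h) (high-¬O h ∘ proj₁) }) (proj₂ Fc)))
          zero₃ : S w₃ (c ∷ q ∷ (α ++ βc)) ≡ 0ℚ
          zero₃ = S-zero w₃ (c ∷ q ∷ (α ++ βc)) (w₃0 c≢q′ (λ h → proj₂ h refl) ∷ w₃0 (low-≢q′ low-q) (low-¬I low-q ∘ proj₁) ∷
            All-++ (All.map (λ h → w₃0 (low-≢q′ h) (low-¬I h ∘ proj₁)) α-low) (All.map (λ { (h , ne) → w₃0 ne (high-¬I h ∘ proj₁) }) (proj₂ Fc)))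
          zero₄ : S w₄ (q′ ∷ c ∷ q ∷ (α ++ β)) ≡ 0ℚ
          zero₄ = trans (cong₂ _+_ (1-0 (𝟙-yes (q′ ≟ₓ q′) refl) (𝟙-no (O? θ′ q′) (high-¬O high-q′)))
            (cong₂ _+_ (0-1 (𝟙-no (q′ ≟ₓ c) c≢q′) (𝟙-yes (O? θ′ c) (fc , refl)))
              (S-zero w₄ (q ∷ (α ++ β)) (w₄0 (low-≢q′ low-q) (low-¬O low-q) ∷
                All-++ (All.map (λ h → w₄0 (low-≢q′ h) (low-¬O h)) α-low) (All.zipWith (λ { (h , ne) → w₄0 ne (high-¬O h) }) (β-high , β-≢q′)))))) refl
          minus-one : S w₁ (q′ ∷ c ∷ q ∷ (α ++ β)) ≡ - 1ℚ
          minus-one = trans (cong₂ _+_ w₁-q′ (cong₂ _+_ w₁-c (cong₂ _+_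
            (cong₂ (λ x y → - x - y) (𝟙-yes (q ≟ₓ q) refl) (𝟙-no (C? q) (low-¬O low-q ∘ proj₁)))
            (S-zero w₁ (α ++ β) (All-++ (All.zipWith (λ { (h , ne) → w₁0 ne (low-¬O h ∘ proj₁) }) (α-low , α-≢q)) w₁-β))))) refl

          rel : ∀ u → S u (q′ ∷ c ∷ q ∷ (α ++ β)) + S u (c ∷ (αc ++ βc)) ≡ S u (c ∷ q ∷ (α ++ βc)) + S u (q′ ∷ c ∷ (αc ++ β))
          rel u = trans (cong₂ (λ x y → (u ∙ q′ + (u ∙ c + (u ∙ q + x))) + (u ∙ c + y)) (S-++ u α β) (S-++ u αc βc))
            (trans (l (u ∙ q′) (u ∙ c) (u ∙ q) (S u α) (S u β) (S u αc) (S u βc))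
              (cong₂ (λ x y → (u ∙ c + (u ∙ q + x)) + (u ∙ q′ + (u ∙ c + y))) (sym (S-++ u α βc)) (sym (S-++ u αc β))))
            where
            l : ∀ q′ c q α β αc βc → (q′ + (c + (q + (α + β)))) + (c + (αc + βc)) ≡ (c + (q + (α + βc))) + (q′ + (c + (αc + β)))
            l = RS.solve-∀ ℚ-ring

        valley-⊥ : ⊥
        valley-⊥ = contra (trans (sym minus-one)
          (crossing {t₁₁ = q′ ∷ c ∷ q ∷ (α ++ β)} {t₁₂ = c ∷ q ∷ (α ++ βc)} {t₂₁ = q′ ∷ c ∷ (αc ++ β)} {t₂₂ = c ∷ (αc ++ βc)}
            c₁ c₂ c₃ c₄ t₁₁ t₁₂ t₂₁ t₂₂ rel sum zero₂₁ zero₂₂ zero₃ zero₄))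
          where
          contra : ¬ - 1ℚ ≡ 0ℚ
          contra ()

      -- One tight chain ends at the level where the other starts, so their functionals add up, with
      -- the zero at the corner z inserted, to a third tight one. `w` pays for z in the first chain,
      -- `w′` in the second.
      touch-⊥ : ∀ {q q′} → F q → F q′ → row q < row q′ → col q < col q′ → Out q ≡ π q′ → up q ≡ Out q → lo q′ ≡ π q′ → ⊥
      touch-⊥ {q} {q′} fq fq′ r< c< e en st = touching {z} {w} {w′} {q ∷ (α ++ [])} {q′ ∷ β} {q′ ∷ z ∷ q ∷ (α ++ β)} (bump nz vz)
          (minus-O-cone (z ≟ₓ_) θ (single nz) single-incomparable (λ { refl → πz }) (λ { refl → λ h → <-irr (subst₂ _<ℚ_ h st (lo-strict {z} {q′} nz nq′ r<)) }))
          (minus-I-cone (z ≟ₓ_) θ (single nz) single-incomparable (λ { refl → Oz }) (λ { refl → λ h → <-irr (subst₂ _<ℚ_ st h (lo<up nq′)) }))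
          (close (proj₁ Iq) (end-post nq (sym en)))
          (close (start-pre nq′ st) (proj₁ Fq′))
          (close (snoc (snoc (proj₁ Iq) nq nz q≺z (trans e (sym πz))) nz nq′ z≺q′ Oz) (proj₁ Fq′))
          (S-zero w (q′ ∷ β) (off w (O? θ) (λ _ → refl) fq′ (λ o → <-irr (subst (θ <ℚ_) (proj₂ o) (π<Out fq′))) ∷
            All.map (λ { (f , h) → off w (O? θ) (λ _ → refl) f (λ o → <-irr (ℚ.<-≤-trans (π<Out fq′) (ℚ.≤-trans h (ℚ.<⇒≤ (subst (_ <ℚ_) (proj₂ o) (π<Out f)))))) }) (proj₂ Fq′)))
          (S-zero w′ (q ∷ (α ++ [])) (off w′ (I? θ) (λ _ → refl) fq (λ o → <-irr (subst₂ _<ℚ_ (proj₂ o) e (π<Out fq))) ∷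
            All-++ (All.map (λ { (f , h) → off w′ (I? θ) (λ _ → refl) f (λ o → <-irr (ℚ.<-trans (subst (_<ℚ _) (proj₂ o) (π<Out f)) (ℚ.≤-<-trans h (subst (π q <ℚ_) e (π<Out fq))))) }) (proj₂ Iq)) []))
          (subst (0ℚ <ℚ_) (sym (1-0 (𝟙-yes (z ≟ₓ z) refl) (𝟙-no (O? θ z) λ o → F⇒≢0 (proj₁ o) vz))) 0<1)
          (subst (0ℚ <ℚ_) (sym (1-0 (𝟙-yes (z ≟ₓ z) refl) (𝟙-no (I? θ z) λ o → F⇒≢0 (proj₁ o) vz))) 0<1)
          (λ u → trans (cong (λ y → u ∙ q′ + (u ∙ z + (u ∙ q + y))) (S-++ u α β))
            (trans (l (u ∙ q′) (u ∙ z) (u ∙ q) (S u α) (S u β)) (cong (λ y → u ∙ z + ((u ∙ q + y) + (u ∙ q′ + S u β))) (sym (S-++ u α [])))))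
        where
        θ = π q′
        nq = proj₁ fq
        nq′ = proj₁ fq′
        z : X
        z = row q , col q′
        nz : Node z
        nz = 1≤row nq , ℕ.<-trans r< (row<col nq′) , ℕ.≤-trans (ℕ.+-monoˡ-≤ (col q′) (ℕ.<⇒≤ r<)) (row+col≤K nq′)
        q≺z : q ≺ z
        q≺z = ≺-col ℕ.≤-refl c<
        z≺q′ : z ≺ q′
        z≺q′ = ≺-row r< ℕ.≤-refl
        Z = between-zero nq nz nq′ q≺z z≺q′ e refl
        vz = proj₁ Z
        πz = proj₁ (proj₂ Z)
        Oz = proj₂ (proj₂ Z)
        Iq = init fq
        Fq′ = fin fq′
        α = Pre.list (proj₁ Iq)
        β = Post.list (proj₁ Fq′)
        w w′ : Pt
        w = diff (z ≟ₓ_) (O? θ)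
        w′ = diff (z ≟ₓ_) (I? θ)
        off : ∀ {Q : X → Set} w (Q? : ∀ p → Dec (Q p)) → (∀ p → w ∙ p ≡ 𝟙 (z ≟ₓ p) - 𝟙 (Q? p)) → ∀ {y} → F y → ¬ Q y → w ∙ y ≡ 0ℚ
        off w Q? we {y} f ¬q = trans (we y) (0-0 (𝟙-no (z ≟ₓ y) λ { refl → F⇒≢0 f vz }) (𝟙-no (Q? y) ¬q))
        l : ∀ q′ z q α β → q′ + (z + (q + (α + β))) ≡ z + ((q + (α + 0ℚ)) + (q′ + β))
        l = RS.solve-∀ ℚ-ring

      -- From p₁ walk down its column towards the row of p₂, from p₂ walk left towards the column of
      -- p₁. The last nodes q and q′ meet at the corner c = (row p₂ , col p₁). A member of F there
      -- makes a valley, a zero there a bent link, and if c falls on k = j the two segments touch.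
      laminar : ∀ {p₁ p₂} → F p₁ → F p₂ → row p₁ < row p₂ → row p₂ ≤ col p₁ → col p₁ < col p₂ → ⊥
      laminar {p₁} {i₂ , j₂} f₁ f₂ r< k≤j c< with down-to i₂ f₁ r< | left-to (col p₁) f₂ c<
      ... | (i , j) , fq , refl , _ , i<k , t | (k , l) , fq′ , refl , j<l , t′ = [ crossing-case , touching-case ]′ (ℕ.m≤n⇒m<n∨m≡n k≤j)
        where
        q q′ c : X
        q = i , j
        q′ = k , l
        c = k , j
        nq = proj₁ fq
        nq′ = proj₁ fq′
        q≺c : q ≺ c
        q≺c = ≺-row i<k ℕ.≤-refl
        c≺q′ : c ≺ q′
        c≺q′ = ≺-col ℕ.≤-refl j<l
        touching-case : k ≡ j → ⊥
        touching-case k≡j = touch-⊥ fq fq′ i<k j<l (trans en (trans up≡lo st)) (sym en) st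
          where
          en : Out q ≡ up q
          en = [ id , (λ { (x , fx , cx , k≤x , _) → ⊥-elim (ℕ.<⇒≱ (row<col (proj₁ fx)) (ℕ.≤-trans (ℕ.≤-reflexive (trans cx (sym k≡j))) k≤x)) }) ]′ t
          st : lo q′ ≡ π q′
          st = [ id , (λ { (b , fb , rb , cb , _) → ⊥-elim (ℕ.<⇒≱ (row<col (proj₁ fb)) (ℕ.≤-trans cb (ℕ.≤-reflexive (trans (sym k≡j) (sym rb))))) }) ]′ t′
          up≡lo : up q ≡ lo q′
          up≡lo = cong A (trans (cong (λ z → (z ∸ 1) ℕ.⊓ n) (sym k≡j)) (ℕ.m≤n⇒m⊓n≡m (ℕ.≤-trans (ℕ.m∸n≤m k 1) (row≤n nq′))))
        crossing-case : k < j → ⊥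
        crossing-case k<j = case F? c of λ { (yes fc) → valley fc ; (no ¬fc) → bent ¬fc }
          where
          nc : Node c
          nc = 1≤row nq′ , k<j , ℕ.≤-trans (ℕ.+-monoʳ-≤ k (ℕ.<⇒≤ j<l)) (row+col≤K nq′)
          valley : F c → ⊥
          valley fc = Valley.valley-⊥ fq fc fq′ q≺c c≺q′ e e′ (ℕ.<⇒≢ i<k) (ℕ.<⇒≢ j<l ∘ sym)
              (λ h → ≤⇒≯ (subst (Out c ≤ℚ_) h (π+x≤up nc)) (π<Out fc))
              (λ h → ≤⇒≯ (subst (_≤ℚ π c) h (lo≤π nc)) (π<Out fc))
            where
            e : Out q ≡ π c
            e = [ (λ en → ⊥-elim (≤⇒≯ (ℚ.≤-trans (π+x≤up nc) (subst (_≤ℚ π c) en (π-link nq nc q≺c))) (π<Out fc))) ,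
                  (λ { ((i′ , _) , fx , refl , k≤x , ex) → [ (λ k<x → ⊥-elim (≤⇒≯ (ℚ.≤-trans (π-link nc (proj₁ fx) (≺-row k<x ℕ.≤-refl)) (subst (_≤ℚ π c) ex (π-link nq nc q≺c))) (π<Out fc))) ,
                       (λ { refl → ex }) ]′ (ℕ.m≤n⇒m<n∨m≡n k≤x) }) ]′ t
            e′ : Out c ≡ π q′
            e′ = [ (λ st → ⊥-elim (≤⇒≯ (ℚ.≤-trans (subst (Out c ≤ℚ_) (sym st) (π-link nc nq′ c≺q′)) (lo≤π nc)) (π<Out fc))) ,
                   (λ { ((_ , j′) , fb , refl , b≤j , eb) → [ (λ b<j → ⊥-elim (≤⇒≯ (ℚ.≤-trans (subst (Out c ≤ℚ_) (sym eb) (π-link nc nq′ c≺q′)) (π-link (proj₁ fb) nc (≺-col ℕ.≤-refl b<j))) (π<Out fc))) ,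
                        (λ { refl → eb }) ]′ (ℕ.m≤n⇒m<n∨m≡n b≤j) }) ]′ t′
          bent : ¬ F c → ⊥
          bent ¬fc = Link.bent-⊥ fq fq′ i<k j<l (ℚ.≤-antisym (π-link nq nq′ (≺-row i<k (ℕ.<⇒≤ j<l))) below) lo<up′
            where
            lo<up′ : lo q′ <ℚ up q
            lo<up′ = lo<up nc
            below : π q′ ≤ℚ Out q
            below = [ (λ en → [ (λ st → subst₂ _≤ℚ_ st (sym en) (ℚ.<⇒≤ lo<up′)) ,
                                (λ { (b , fb , rb , b≤j , eb) → subst₂ _≤ℚ_ eb (sym en) (ℚ.≤-trans (π+x≤up (proj₁ fb)) (up-mono {b} {q} b≤j)) }) ]′ t′) ,
                      (λ { ((i′ , _) , fx , refl , k≤x , ex) → [ (λ st → subst₂ _≤ℚ_ st (sym ex) (ℚ.≤-trans (lo-mono {q′} {i′ , j} k≤x) (lo≤π (proj₁ fx)))) ,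
                                (λ { ((_ , j′) , fb , refl , b≤j , eb) → subst₂ _≤ℚ_ eb (sym ex) (π-link (proj₁ fb) (proj₁ fx)
                                     ([ (λ k<x → ≺-row k<x b≤j) , (λ { refl → [ (λ b<j → ≺-col ℕ.≤-refl b<j) , (λ { refl → ⊥-elim (¬fc fx) }) ]′ (ℕ.m≤n⇒m<n∨m≡n b≤j) }) ]′ (ℕ.m≤n⇒m<n∨m≡n k≤x))) }) ]′ t′ }) ]′ t

      -- If a chain can end tightly at q in column j > n before the antidiagonal, it can be
      -- continued through a zero either at (K - j , j) or at (i , j + 1). The bound is still `A n`
      -- at both, so these zeros are exchangeable.
      module OffCentre {q : X} (fq : F q) (n<j : n < col q) (en : Out q ≡ up q) (¬anti : ¬ row q ℕ.+ col q ≡ K) where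
        private
          i = row q
          j = col q
          z z′ : X
          z = K ∸ j , j
          z′ = i , suc j
          θ = Out q
          nq = proj₁ fq
          size< : i ℕ.+ j < K
          size< = ℕ.≤∧≢⇒< (row+col≤K nq) ¬anti
          j≤K : j ≤ K
          j≤K = ℕ.≤-trans (ℕ.m≤n+m j i) (row+col≤K nq)
          i<z : i < K ∸ j
          i<z = ℕ.m+n≤o⇒m≤o∸n (suc i) size<
          nz : Node z
          nz = ℕ.<-trans (1≤row nq) i<z ,
               ℕ.≤-<-trans (ℕ.≤-trans (ℕ.∸-monoʳ-≤ K n<j) (ℕ.≤-reflexive (trans (cong (_∸ suc n) K≡) (ℕ.m+n∸m≡n n n)))) n<j ,
               ℕ.≤-reflexive (ℕ.m∸n+n≡m j≤K)
          nz′ : Node z′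
          nz′ = 1≤row nq , ℕ.m<n⇒m<1+n (row<col nq) , subst (_≤ K) (sym (ℕ.+-suc i j)) size<
          q≺z : q ≺ z
          q≺z = ≺-row i<z ℕ.≤-refl
          q≺z′ : q ≺ z′
          q≺z′ = ≺-col ℕ.≤-refl ℕ.≤-refl
          n≤j-1 : n ≤ j ∸ 1
          n≤j-1 = ℕ.m+n≤o⇒m≤o∸n n (subst (_≤ j) (ℕ.+-comm 1 n) n<j)
          upz′ : up z′ ≡ θ
          upz′ = trans (cong A (trans (ℕ.m≥n⇒m⊓n≡n (ℕ.<⇒≤ n<j)) (sym (ℕ.m≥n⇒m⊓n≡n n≤j-1)))) (sym en)
          Z = end-zero nq nz q≺z refl (sym en)
          Z′ = end-zero nq nz′ q≺z′ refl upz′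
          vz = proj₁ Z
          πz = proj₁ (proj₂ Z)
          Oz = proj₂ (proj₂ Z)
          vz′ = proj₁ Z′
          πz′ = proj₁ (proj₂ Z′)
          Oz′ = proj₂ (proj₂ Z′)
          Iq = init fq
          α = Pre.list (proj₁ Iq)
          z⊀z′ : ¬ z ≺ z′
          z⊀z′ ((h , _) , _) = ℕ.<⇒≱ i<z h
          z′⊀z : ¬ z′ ≺ z
          z′⊀z ((_ , h) , _) = ℕ.<⇒≱ (ℕ.n<1+n j) h

        off-centre-⊥ : ⊥
        off-centre-⊥ = no-exchange nz nz′ vz vz′ z⊀z′ z′⊀z (λ h → ℕ.<⇒≢ i<z (sym (cong row h))) (O? θ) proj₁
          (two-O-cone nz nz′ vz vz′ z⊀z′ z′⊀z θ πz πz′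
            (λ h → <-irr (subst₂ _<ℚ_ h (sym en) (lo<up nz))) (λ h → <-irr (subst₂ _<ℚ_ h upz′ (lo<up nz′))))
          (λ ζ → ζ ∷ q ∷ (α ++ [])) {s′ = α ++ []} {q = q}
          (All-++ (All.map (λ { (f , h) → f , λ o → <-irr (ℚ.≤-<-trans (subst (_≤ℚ π q) (proj₂ o) h) (π<Out fq)) }) (proj₂ Iq)) [])
          (fq , refl)
          (close (snoc (proj₁ Iq) nq nz q≺z (sym πz)) (end-post nz (trans Oz en)))
          (close (snoc (proj₁ Iq) nq nz′ q≺z′ (sym πz′)) (end-post nz′ (trans Oz′ (sym upz′))))
          (λ u ζ → refl)

      central-end : ∀ {q} → F q → n < col q → Out q ≡ up q → F (K ∸ col q , col q)
      central-end {i , j} fq n<j en = case i ℕ.+ j ℕ.≟ K of λ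
        { (yes anti) → subst (λ z → F (z , j)) (trans (sym (ℕ.m+n∸n≡m i j)) (cong (_∸ j) anti)) fq
        ; (no ¬anti) → ⊥-elim (OffCentre.off-centre-⊥ fq n<j en ¬anti) }

      central : ∀ {p} → F p → n < col p → F (K ∸ col p , col p)
      -- In column j all nodes are in rows below j in number, so the walk down cannot jump past row
      -- j and stops at an end.
      central {p} fp n<j = go (down-to (col p) fp (row<col (proj₁ fp)))
        where
        go : ∃ (Down (col p) p) → F (K ∸ col p , col p)
        go (q , fq , c , _ , _ , inj₁ en) = subst (λ j → F (K ∸ j , j)) c (central-end fq (subst (n <_) (sym c) n<j) en)
        go (_ , _ , _ , _ , _ , inj₂ (x , fx , cx , j≤x , _)) = ⊥-elim (ℕ.<⇒≱ (row<col (proj₁ fx)) (subst (_≤ row x) (sym cx) j≤x))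

      -- The tight links back to the start stay in the row of p, so what they collect is part of the
      -- row sum. With `up≤col` for the column this reverses `hook-bound`.
      π≤row : ∀ {p} → F p → π p ≤ℚ lo p + rowSum v p
      π≤row {p} fp = go (suc (col p)) p fp ℕ.≤-refl
        where
        go : ∀ N p → F p → col p < N → π p ≤ℚ lo p + rowSum v p
        go (suc N) p@(i , j) fp (s≤s h) = [ (λ e → subst (_≤ℚ lo p + rowSum v p) e (a≤a+b (row-nonneg v∈P {i} (suc i) j))) ,
            (λ { ((_ , j′) , fy , refl , c< , e) → subst₂ _≤ℚ_ e (row-split j′ (row<col (proj₁ fy)) c<)
                 (ℚ.≤-trans (ℚ.+-monoˡ-≤ (v i j′) (go N (i , j′) fy (ℕ.<-≤-trans c< h))) (a≤a+b (row-nonneg v∈P {i} (suc j′) j))) }) ]′ (row-pred fp)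
          where
          row-split : ∀ j′ → i < j′ → j′ < j → lo p + rowSum v (i , j′) + v i j′ + Sum (v i) (suc j′) j ≡ lo p + rowSum v p
          row-split j′ h₁ h₂ = trans (l (lo p) (rowSum v (i , j′)) (v i j′) (Sum (v i) (suc j′) j))
            (cong (lo p +_) (sym (trans (Sum-split (v i) h₁ (ℕ.<⇒≤ h₂)) (cong (rowSum v (i , j′) +_) (Sum-cons (v i) h₂)))))
            where
            l : ∀ a b c d → a + b + c + d ≡ a + (b + (c + d))
            l = RS.solve-∀ ℚ-ring

      up≤col : ∀ {p} → F p → up p ≤ℚ Out p + colSum v p
      up≤col {p} fp = go (col p) p fp (ℕ.m≤m+n (col p) (row p))
        where
        go : ∀ N p → F p → col p ≤ N ℕ.+ row p → up p ≤ℚ Out p + colSum v p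
        go zero p fp h = ⊥-elim (ℕ.<⇒≱ (row<col (proj₁ fp)) h)
        go (suc N) p@(i , j) fp h = [ (λ e → subst (_≤ℚ Out p + colSum v p) e (a≤a+b (col-nonneg v∈P {j} (suc i) j))) ,
            (λ { ((k , _) , fx , refl , r< , e) → ℚ.≤-trans (go N (k , j) fx (ℕ.≤-trans h (ℕ.≤-trans (ℕ.≤-reflexive (sym (ℕ.+-suc N i))) (ℕ.+-monoʳ-≤ N r<))))
                 (ℚ.≤-trans (≤-eq (trans (cong (λ z → z + v k j + colSum v (k , j)) (sym e)) (ℚ.+-assoc (Out p) (v k j) (colSum v (k , j)))))
                   (ℚ.+-monoʳ-≤ (Out p) (col-split k r< (row<col (proj₁ fx))))) }) ]′ (col-succ fp)
          where
          f : ℕ → ℚ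
          f c = v c j
          col-split : ∀ k → i < k → k < j → v k j + colSum v (k , j) ≤ℚ colSum v p
          col-split k h₁ h₂ = subst (v k j + colSum v (k , j) ≤ℚ_) (trans (ℚ.+-comm (v k j + colSum v (k , j)) (Sum f (suc i) k)) (sym (trans (Sum-split f h₁ (ℕ.<⇒≤ h₂)) (cong (Sum f (suc i) k +_) (Sum-cons f h₂)))))
            (a≤a+b (col-nonneg v∈P {j} (suc i) k))

      simple⇒good : Good
      simple⇒good = record { hooks = hk ; laminar = laminar ; central = central }
        where
        hk : ∀ {p} → F p → lo p + hook v p ≡ up p
        hk {p} fp = ℚ.≤-antisym
          (hook-bound v∈P np)
          (ℚ.≤-trans (up≤col fp) (by≤ (π≤row fp) (l₂ (lo p) (rowSum v p) (v ∙ p) (colSum v p) (π p))))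
          where
          np = proj₁ fp
          l₂ : ∀ o r x c p → (o + (r + x + c)) + p ≡ (p + x + c) + (o + r)
          l₂ = RS.solve-∀ ℚ-ring

    -- Tight links under the three conditions.

    module Converse (good : Good) where

      open Good good

      -- An end of a tight chain cannot be left to the right: the central segment of its column lies below.
      up-col : ∀ {y z} → F y → Node z → y ≺ z → Out y ≡ up z → col y ≡ col z
      up-col {y} {z} fy nz y≺z e = [ (λ c< → ⊥-elim (strict c<)) , id ]′ (ℕ.m≤n⇒m<n∨m≡n (proj₂ (proj₁ y≺z)))
        where
        ny = proj₁ fy
        Out≡up : Out y ≡ up y
        Out≡up = ℚ.≤-antisym (π+x≤up ny) (subst (up y ≤ℚ_) (sym e) (up-mono {y} {z} (proj₂ (proj₁ y≺z))))
        size< : row y ℕ.+ col y < K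
        size< = ℕ.<-≤-trans ([ (λ h → ℕ.+-mono-<-≤ h (proj₂ (proj₁ y≺z))) , (λ h → ℕ.+-mono-≤-< (proj₁ (proj₁ y≺z)) h) ]′ (proj₂ y≺z)) (row+col≤K nz)
        below : n < col y → ⊥
        below n<c = ≤⇒≯ (subst (_≤ℚ up y) refl (π+x≤up nc)) (subst (_<ℚ Out c) Out≡up (ℚ.≤-<-trans (π-link ny nc y≺c) (π<Out fc)))
          where
          c : X
          c = K ∸ col y , col y
          fc = central fy n<c
          nc = proj₁ fc
          y≺c : y ≺ c
          y≺c = ≺-row (ℕ.m+n≤o⇒m≤o∸n (suc (row y)) size<) ℕ.≤-refl
        strict : col y < col z → ⊥
        strict c< with n ℕ.<? col y
        ... | yes n<c = below n<c
        ... | no n≮c = <-irr (subst₂ _<ℚ_ (sym Out≡up) (sym e) (up-strict {y} {z} ny (ℕ.≮⇒≥ n≮c) c<))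

      lo-row : ∀ {z x} → Node z → Node x → z ≺ x → lo z ≡ π x → row x ≡ row z
      lo-row {z} {x} nz nx z≺x e = [ (λ r< → ⊥-elim (≤⇒≯ (subst (lo x ≤ℚ_) (sym e) (lo≤π nx)) (lo-strict {z} {x} nz nx r<))) , sym ]′ (ℕ.m≤n⇒m<n∨m≡n (proj₁ (proj₁ z≺x)))

      -- A bent link would join crossing segments, which `laminar` excludes, or disjoint ones, for
      -- which up y < lo x.
      straight : ∀ {y x} → F y → F x → y ≺ x → Out y ≡ π x → (row y ≡ row x × col y < col x) ⊎ (col y ≡ col x × row y < row x)
      straight {y} {x} fy fx ((r≤ , c≤) , s) e with ℕ.m≤n⇒m<n∨m≡n r≤ | ℕ.m≤n⇒m<n∨m≡n c≤
      ... | inj₂ r≡ | inj₁ c< = inj₁ (r≡ , c<)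
      ... | inj₁ r< | inj₂ c≡ = inj₂ (c≡ , r<)
      ... | inj₂ r≡ | inj₂ c≡ = ⊥-elim ([ (λ h → ℕ.<-irrefl r≡ h) , (λ h → ℕ.<-irrefl c≡ h) ]′ s)
      ... | inj₁ r< | inj₁ c< with row x ℕ.≤? col y
      ... | yes h = ⊥-elim (laminar fy fx r< h c<)
      ... | no h = ⊥-elim (≤⇒≯ (ℚ.≤-trans (subst (lo x ≤ℚ_) (sym e) (lo≤π (proj₁ fx))) (π+x≤up (proj₁ fy)))
                     (up<lo {y} {x} (proj₁ fy) (proj₁ fx) (ℕ.≰⇒> h)))

      -- Tells the two arms of a hook apart: by laminarity a node with a member of F above it has
      -- none to its right (`¬above-row`).
      Above : X → X → Set
      Above p y = F y × col y ≡ col p × row y < row p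

      above? : ∀ p → Dec (∃ (Above p))
      above? p with search (λ y → F? y ×-dec ((col y ℕ.≟ col p) ×-dec (row y ℕ.<? row p)))
      ... | inj₁ h = yes h
      ... | inj₂ h = no λ { (y , fy , r) → h y (proj₁ fy) (fy , r) }

      ¬above-row : ∀ {y x} → F x → row y ≡ row x → Node y → col y < col x → ¬ ∃ (Above y)
      ¬above-row fx r≡ ny c< (u , fu , c , r<) = laminar fu fx (subst (row u <_) r≡ r<)
        (subst₂ _≤_ r≡ (sym c) (ℕ.<⇒≤ (row<col ny))) (subst (_< _) (sym c) c<)

      -- Certificates for the rays of the cone.

      module Ray (w : Pt) (w∈U : InU n w) (w-off : ∀ {p} → v ∙ p ≡ 0ℚ → 0ℚ ≤ℚ w ∙ p)
                 (hook≤0 : ∀ {p} → F p → hook w p ≤ℚ 0ℚ) where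

        row-gap : ∀ {y z} → Node y → Node z → row y ≡ row z → col y < col z → Out y ≡ π z → rowSum w y + w ∙ y ≤ℚ rowSum w z
        row-gap {i , j} {_ , l} ny nz refl c< e = subst (rowSum w (i , j) + w i j ≤ℚ_)
          (trans (ℚ.+-assoc (rowSum w (i , j)) (w i j) (Sum (w i) (suc j) l)) (sym (trans (Sum-split (w i) (row<col ny) (ℕ.<⇒≤ c<)) (cong (rowSum w (i , j) +_) (Sum-cons (w i) c<)))))
          (a≤a+b (Sum-nonneg (suc j) l λ c j<c c<l → w-off (proj₁ (between-zero ny (nd c j<c c<l) nz (≺-col ℕ.≤-refl j<c) (≺-col ℕ.≤-refl c<l) e refl))))
          where
          nd : ∀ c → j < c → c < l → Node (i , c)
          nd c j<c c<l = 1≤row ny , ℕ.<-trans (row<col ny) j<c , ℕ.≤-trans (ℕ.+-monoʳ-≤ i (ℕ.<⇒≤ c<l)) (row+col≤K nz)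

        col-gap : ∀ {y z} → Node y → Node z → col y ≡ col z → row y < row z → Out y ≡ π z → w ∙ z + colSum w z ≤ℚ colSum w y
        col-gap {i , j} {k , _} ny nz refl r< e = subst (w k j + colSum w (k , j) ≤ℚ_)
          (trans (ℚ.+-comm (w k j + colSum w (k , j)) (Sum f (suc i) k)) (sym (trans (Sum-split f r< (ℕ.<⇒≤ (row<col nz))) (cong (Sum f (suc i) k +_) (Sum-cons f (row<col nz))))))
          (a≤a+b (Sum-nonneg (suc i) k λ c i<c c<k → w-off (proj₁ (between-zero ny (nd c i<c c<k) nz (≺-row i<c ℕ.≤-refl) (≺-row c<k ℕ.≤-refl) e refl))))
          where
          f : ℕ → ℚ
          f c = w c j
          nd : ∀ c → i < c → c < k → Node (c , j)
          nd c i<c c<k = ℕ.≤-trans (s≤s z≤n) i<c , ℕ.<-trans c<k (row<col nz) , ℕ.≤-trans (ℕ.+-monoˡ-≤ j (ℕ.<⇒≤ c<k)) (row+col≤K nz)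

        row-start≥0 : ∀ {z} → Node z → lo z ≡ π z → 0ℚ ≤ℚ rowSum w z
        row-start≥0 {i , l} nz e = Sum-nonneg (suc i) l λ c i<c c<l → w-off (vanish c i<c c<l)
          where
          vanish : ∀ c → i < c → c < l → v i c ≡ 0ℚ
          vanish c i<c c<l = ℚ.≤-antisym (+-cancel-≤ {π (i , c)} (ℚ.≤-trans (π-link nc nz (≺-col ℕ.≤-refl c<l))
              (ℚ.≤-trans (≤-eq (sym e)) (ℚ.≤-trans (lo≤π nc) (≤-eq (sym (ℚ.+-identityʳ (π (i , c))))))))) (v-nonneg nc)
            where
            nc : Node (i , c)
            nc = 1≤row nz , i<c , ℕ.≤-trans (ℕ.+-monoʳ-≤ i (ℕ.<⇒≤ c<l)) (row+col≤K nz)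

        col-end≥0 : ∀ {z} → Node z → Out z ≡ up z → 0ℚ ≤ℚ colSum w z
        col-end≥0 {i , l} nz e = Sum-nonneg (suc i) l λ c i<c _ → case node? (c , l) of λ
          { (yes nc) → w-off (proj₁ (end-zero nz nc (≺-row i<c ℕ.≤-refl) e refl))
          ; (no ¬n) → w-off (v-zero ¬n) }

        -- On a row arm the derivative of π is counted from the start of the row, on a column arm
        -- backwards from the end of the column. The two counts differ by `- hook w p`, which is
        -- nonnegative, so passing from the first to the second is allowed.
        g hinF houtF : X → ℚ
        g p = 𝟙 (above? p) * - hook w p
        hinF p = rowSum w p + g p
        houtF p = rowSum w p + g p + w ∙ p

        0≤g : ∀ {p} → F p → 0ℚ ≤ℚ g p
        0≤g {p} f = *-nonneg (0≤𝟙 (above? p)) (ℚ.neg-antimono-≤ (hook≤0 f))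

        g≤ : ∀ {p} → F p → g p ≤ℚ - hook w p
        g≤ {p} f = subst₂ _≤ℚ_ (ℚ.*-comm (- hook w p) (𝟙 (above? p))) (ℚ.*-identityʳ (- hook w p)) (*-mono (ℚ.neg-antimono-≤ (hook≤0 f)) (𝟙≤1 (above? p)))

        rowSum≤hinF : ∀ {p} → F p → rowSum w p ≤ℚ hinF p
        rowSum≤hinF f = a≤a+b (0≤g f)

        houtF≤col : ∀ {p} → F p → houtF p ≤ℚ - colSum w p
        houtF≤col {p} f = by≤ (g≤ f) (l (rowSum w p) (w ∙ p) (colSum w p) (g p))
          where
          l : ∀ r x c g → - c + g ≡ (r + g + x) + - (r + x + c)
          l = RS.solve-∀ ℚ-ring

        hinF-above : ∀ {p} → ∃ (Above p) → hinF p ≡ - (w ∙ p + colSum w p)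
        hinF-above {p} ab = trans (cong (λ z → rowSum w p + z * - hook w p) (𝟙-yes (above? p) ab)) (l (rowSum w p) (w ∙ p) (colSum w p))
          where
          l : ∀ r x c → r + 1ℚ * - (r + x + c) ≡ - (x + c)
          l = RS.solve-∀ ℚ-ring

        houtF-¬above : ∀ {p} → ¬ ∃ (Above p) → houtF p ≡ rowSum w p + w ∙ p
        houtF-¬above {p} ¬ab = trans (cong (λ z → rowSum w p + z * - hook w p + w ∙ p) (𝟙-no (above? p) ¬ab)) (l (rowSum w p) (w ∙ p) (hook w p))
          where
          l : ∀ r x h → r + 0ℚ * - h + x ≡ r + x
          l = RS.solve-∀ ℚ-ring

        row-link : ∀ {y z x} → F y → Node z → F x → row y ≡ row z → row y ≡ row x → col y < col z → col y < col x → Out y ≡ π z → houtF y ≤ℚ rowSum w z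
        row-link {y} {z} fy nz fx r r′ c< c<′ e = subst (_≤ℚ rowSum w z) (sym (houtF-¬above (¬above-row fx r′ (proj₁ fy) c<′)))
          (row-gap {y} {z} (proj₁ fy) nz r c< e)

        col-link : ∀ {y z} → F y → Node z → col y ≡ col z → row y < row z → Out y ≡ π z → houtF y ≤ℚ - (w ∙ z + colSum w z)
        col-link fy nz c r< e = ℚ.≤-trans (houtF≤col fy) (ℚ.neg-antimono-≤ (col-gap (proj₁ fy) nz c r< e))

        link-F : ∀ {y x} → F y → F x → y ≺ x → Out y ≡ π x → houtF y ≤ℚ hinF x
        link-F {y} {x} fy fx y≺x e = [ (λ { (r , c<) → ℚ.≤-trans (row-link fy (proj₁ fx) fx r r c< c< e) (rowSum≤hinF fx) }) ,
                                       (λ { (c , r<) → subst (houtF y ≤ℚ_) (sym (hinF-above (y , fy , c , r<))) (col-link fy (proj₁ fx) c r< e) }) ]′ (straight fy fx y≺x e)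

        start-F : ∀ {p} → F p → lo p ≡ π p → 0ℚ ≤ℚ hinF p
        start-F fp e = ℚ.≤-trans (row-start≥0 (proj₁ fp) e) (rowSum≤hinF fp)

        end-F : ∀ {p} → F p → Out p ≡ up p → houtF p ≤ℚ 0ℚ
        end-F fp e = ℚ.≤-trans (houtF≤col fp) (ℚ.neg-antimono-≤ (col-end≥0 (proj₁ fp) e))

        ray-F : (∀ {p} → v ∙ p ≡ 0ℚ → w ∙ p ≡ 0ℚ) → Cone w
        ray-F off = certified F w hinF houtF (λ p _ → case F? p of λ { (yes f) → inj₁ f ; (no ¬f) → inj₂ (¬F⇒0 ¬f , off (¬F⇒0 ¬f)) })
          w∈U (λ p _ → w-off) (λ p _ f → ℚ.≤-refl) (λ p q _ _ fp fq → link-F fp fq) (λ p _ → start-F) (λ p _ → end-F)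

        -- Here `w` may be positive at the zero z, which therefore joins the relevant nodes. The
        -- derivative η of π at z must be at least `houtF` of every tight predecessor in F, and η +
        -- `w ∙ z` at most `hinF` of every tight successor; a start or an end at z compares them
        -- with 0.
        module _ {z : X} (nz : Node z) (vz : v ∙ z ≡ 0ℚ) (off : ∀ {p} → v ∙ p ≡ 0ℚ → ¬ z ≡ p → w ∙ p ≡ 0ℚ) where

          private
            πz≡Outz : π z ≡ Out z
            πz≡Outz = sym (trans (cong (π z +_) vz) (ℚ.+-identityʳ (π z)))

            hin hout : ℚ → X → ℚ
            hin η p = 𝟙 (z ≟ₓ p) * η + (1ℚ - 𝟙 (z ≟ₓ p)) * hinF p
            hout η p = 𝟙 (z ≟ₓ p) * η + (1ℚ - 𝟙 (z ≟ₓ p)) * houtF p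

            at : ∀ η h → 1ℚ * η + (1ℚ - 1ℚ) * h ≡ η
            at = RS.solve-∀ ℚ-ring
            away : ∀ η h → 0ℚ * η + (1ℚ - 0ℚ) * h ≡ h
            away = RS.solve-∀ ℚ-ring

            hin-z : ∀ η → hin η z ≡ η
            hin-z η = trans (cong (λ d → d * η + (1ℚ - d) * hinF z) (𝟙-yes (z ≟ₓ z) refl)) (at η (hinF z))
            hout-z : ∀ η → hout η z ≡ η
            hout-z η = trans (cong (λ d → d * η + (1ℚ - d) * houtF z) (𝟙-yes (z ≟ₓ z) refl)) (at η (houtF z))
            hin-F : ∀ η {p} → F p → hin η p ≡ hinF p
            hin-F η {p} f = trans (cong (λ d → d * η + (1ℚ - d) * hinF p) (𝟙-no (z ≟ₓ p) λ { refl → F⇒≢0 f vz })) (away η (hinF p))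
            hout-F : ∀ η {p} → F p → hout η p ≡ houtF p
            hout-F η {p} f = trans (cong (λ d → d * η + (1ℚ - d) * houtF p) (𝟙-no (z ≟ₓ p) λ { refl → F⇒≢0 f vz })) (away η (houtF p))

            with-z : ∀ η → (∀ {y} → F y → y ≺ z → Out y ≡ π z → houtF y ≤ℚ η) → (lo z ≡ π z → 0ℚ ≤ℚ η) →
              (∀ {x} → F x → z ≺ x → Out z ≡ π x → η + w ∙ z ≤ℚ hinF x) → (Out z ≡ up z → η + w ∙ z ≤ℚ 0ℚ) → Cone w
            with-z η preds start succs end = certified (λ p → F p ⊎ z ≡ p) w (hin η) (hout (η + w ∙ z))
              rel w∈U (λ p _ → w-off)
              (λ { p _ (inj₁ f) → subst₂ (λ α β → α + w ∙ p ≤ℚ β) (sym (hin-F η f)) (sym (hout-F (η + w ∙ z) f)) ℚ.≤-refl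
                 ; p _ (inj₂ refl) → subst₂ (λ α β → α + w ∙ p ≤ℚ β) (sym (hin-z η)) (sym (hout-z (η + w ∙ z))) ℚ.≤-refl })
              (λ { p q _ _ (inj₁ f) (inj₁ f′) p≺q e → subst₂ _≤ℚ_ (sym (hout-F (η + w ∙ z) f)) (sym (hin-F η f′)) (link-F f f′ p≺q e)
                 ; p q _ _ (inj₁ f) (inj₂ refl) p≺q e → subst₂ _≤ℚ_ (sym (hout-F (η + w ∙ z) f)) (sym (hin-z η)) (preds f p≺q e)
                 ; p q _ _ (inj₂ refl) (inj₁ f′) p≺q e → subst₂ _≤ℚ_ (sym (hout-z (η + w ∙ z))) (sym (hin-F η f′)) (succs f′ p≺q e)
                 ; p q _ _ (inj₂ refl) (inj₂ refl) p≺q e → ⊥-elim (≺-irrefl p≺q) })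
              (λ { p _ (inj₁ f) e → subst (0ℚ ≤ℚ_) (sym (hin-F η f)) (start-F f e)
                 ; p _ (inj₂ refl) e → subst (0ℚ ≤ℚ_) (sym (hin-z η)) (start e) })
              (λ { p _ (inj₁ f) e → subst (_≤ℚ 0ℚ) (sym (hout-F (η + w ∙ z) f)) (end-F f e)
                 ; p _ (inj₂ refl) e → subst (_≤ℚ 0ℚ) (sym (hout-z (η + w ∙ z))) (end e) })
              where
              rel : ∀ p → Node p → (F p ⊎ z ≡ p) ⊎ (v ∙ p ≡ 0ℚ × w ∙ p ≡ 0ℚ)
              rel p _ with F? p | z ≟ₓ p
              ... | yes f | _      = inj₁ (inj₁ f)
              ... | no _  | yes e  = inj₁ (inj₂ e)
              ... | no ¬f | no z≢p = inj₂ (¬F⇒0 ¬f , off (¬F⇒0 ¬f) z≢p)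

            TP TS : X → Set
            TP y = F y × y ≺ z × Out y ≡ π z
            TS x = F x × z ≺ x × Out z ≡ π x

            -- With no tight continuation nothing limits η from above, so any bound for the finitely
            -- many values of `houtF` serves. `no-pred` is the mirror image.
            no-succ : ¬ ∃ TS → ¬ Out z ≡ up z → Cone w
            no-succ ¬s ¬e = let H , 0≤H , hs = upper-bound (map houtF nodes) in with-z H (λ f _ _ → All.lookup hs (∈-map⁺ houtF (node-∈ (proj₁ f)))) (λ _ → 0≤H)
                  (λ f z≺x e → ⊥-elim (¬s (_ , f , z≺x , e))) (λ e → ⊥-elim (¬e e))

            no-pred : ¬ ∃ TP → ¬ lo z ≡ π z → Cone w
            no-pred ¬p ¬s = let H , 0≤H , hs = upper-bound (map (λ p → - hinF p) nodes) in with-z (- H - w ∙ z) (λ f y≺z e → ⊥-elim (¬p (_ , f , y≺z , e))) (λ e → ⊥-elim (¬s e))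
                  (λ {x} f _ _ → by≤ (All.lookup hs (∈-map⁺ (λ p → - hinF p) (node-∈ (proj₁ f)))) (l₁ H (w ∙ z) (hinF x)))
                  (λ _ → by≤ 0≤H (l₂ H (w ∙ z)))
              where
              l₁ : ∀ H x h → h + - h ≡ (- H - x + x) + H
              l₁ = RS.solve-∀ ℚ-ring
              l₂ : ∀ H x → 0ℚ + 0ℚ ≡ (- H - x + x) + H
              l₂ = RS.solve-∀ ℚ-ring

            -- Since π z = `Out z`, the links y → z → x compose to a tight link y → x. This one is
            -- straight, and z lies on it.
            both : ∀ {y x} → TP y → TS x → (row y ≡ row z × row z ≡ row x) ⊎ (col y ≡ col z × col z ≡ col x)
            both {y} {x} (fy , y≺z , e) (fx , z≺x , e′) with straight fy fx y≺x (trans e (trans πz≡Outz e′))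
              where
              y≺x : y ≺ x
              y≺x = ≺-≼-trans y≺z (proj₁ z≺x)
            ... | inj₁ (r , _) = inj₁ (sq (proj₁ (proj₁ y≺z)) (proj₁ (proj₁ z≺x)) r)
              where
              sq : ∀ {i j k : ℕ} → i ≤ j → j ≤ k → i ≡ k → i ≡ j × j ≡ k
              sq h h′ refl = ℕ.≤-antisym h h′ , ℕ.≤-antisym h′ h
            ... | inj₂ (c , _) = inj₂ (sq (proj₂ (proj₁ y≺z)) (proj₂ (proj₁ z≺x)) c)
              where
              sq : ∀ {i j k : ℕ} → i ≤ j → j ≤ k → i ≡ k → i ≡ j × j ≡ k
              sq h h′ refl = ℕ.≤-antisym h h′ , ℕ.≤-antisym h′ h

            col< : ∀ {p q} → p ≺ q → row p ≡ row q → col p < col q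
            col< (_ , inj₁ h) r = ⊥-elim (ℕ.<-irrefl r h)
            col< (_ , inj₂ h) r = h
            row< : ∀ {p q} → p ≺ q → col p ≡ col q → row p < row q
            row< (_ , inj₁ h) r = h
            row< (_ , inj₂ h) r = ⊥-elim (ℕ.<-irrefl r h)

            ¬start-end : lo z ≡ π z → ¬ Out z ≡ up z
            ¬start-end e e′ = <-irr (subst₂ _<ℚ_ (trans e πz≡Outz) (sym e′) (lo<up nz))

            row-case : ∀ {x} → TS x → row z ≡ row x → (lo z ≡ π z ⊎ Σ X λ y → TP y × row y ≡ row z) → Cone w
            row-case {x} ts@(fx , z≺x , _) rx pr = with-z (rowSum w z)
              (λ {y} fy y≺z e → [ (λ { (r , _) → row-link fy nz fx r (trans r rx) (col< y≺z r) (ℕ.<-trans (col< y≺z r) (col< z≺x rx)) e }) ,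
                                  (λ { (_ , c) → ⊥-elim (ℕ.<-irrefl c (col< z≺x rx)) }) ]′ (both (fy , y≺z , e) ts))
              (row-start≥0 nz)
              (λ {x′} fx′ z≺x′ e → ℚ.≤-trans (row-gap nz (proj₁ fx′) (same fx′ z≺x′ e) (col< z≺x′ (same fx′ z≺x′ e)) e) (rowSum≤hinF fx′))
              (λ e → ⊥-elim ([ (λ s → ¬start-end s e) , (λ { (y , (fy , y≺z , ey) , r) → ℕ.<-irrefl (up-col fy nz y≺z (trans ey (trans πz≡Outz e))) (col< y≺z r) }) ]′ pr))
              where
              same : ∀ {x′} → F x′ → z ≺ x′ → Out z ≡ π x′ → row z ≡ row x′
              same fx′ z≺x′ e = [ (λ s → sym (lo-row nz (proj₁ fx′) z≺x′ (trans s (trans πz≡Outz e)))) ,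
                (λ { (y , tp@(_ , y≺z , _) , r) → [ proj₂ , (λ { (c , _) → ⊥-elim (ℕ.<-irrefl c (col< y≺z r)) }) ]′ (both tp (fx′ , z≺x′ , e)) }) ]′ pr

            col-case : ∀ {y} → TP y → col y ≡ col z → (Out z ≡ up z ⊎ Σ X λ x → TS x × col z ≡ col x) → Cone w
            col-case {y} tp@(fy , y≺z , _) cy sc = with-z (- (w ∙ z + colSum w z))
              (λ {y′} fy′ y′≺z e → col-link fy′ nz (same fy′ y′≺z e) (row< y′≺z (same fy′ y′≺z e)) e)
              (λ s → ⊥-elim ([ ¬start-end s , (λ { (x , (fx , z≺x , ex) , c) → ℕ.<-irrefl (sym (lo-row nz (proj₁ fx) z≺x (trans s (trans πz≡Outz ex)))) (row< z≺x c) }) ]′ sc))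
              (λ {x} fx z≺x e → [ (λ { (r , _) → ⊥-elim (ℕ.<-irrefl r (row< y≺z cy)) }) ,
                 (λ { (_ , c) → subst₂ _≤ℚ_ (sym (l (w ∙ z) (colSum w z))) (sym (hinF-above (y , fy , trans cy c , ℕ.<-trans (row< y≺z cy) (row< z≺x c))))
                        (ℚ.neg-antimono-≤ (col-gap nz (proj₁ fx) c (row< z≺x c) e)) }) ]′ (both tp (fx , z≺x , e)))
              (λ e → subst (_≤ℚ 0ℚ) (sym (l (w ∙ z) (colSum w z))) (ℚ.neg-antimono-≤ (col-end≥0 nz e)))
              where
              l : ∀ x c → - (x + c) + x ≡ - c
              l = RS.solve-∀ ℚ-ring
              same : ∀ {y′} → F y′ → y′ ≺ z → Out y′ ≡ π z → col y′ ≡ col z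
              same fy′ y′≺z e = [ (λ en → up-col fy′ nz y′≺z (trans e (trans πz≡Outz en))) ,
                (λ { (x , ts@(_ , z≺x , _) , c) → [ (λ { (_ , r) → ⊥-elim (ℕ.<-irrefl r (row< z≺x c)) }) , proj₁ ]′ (both (fy′ , y′≺z , e) ts) }) ]′ sc

          ray-z : Cone w
          ray-z = cases preds succs
            where
            preds : (lo z ≡ π z ⊎ ∃ TP) ⊎ (¬ ∃ TP × ¬ lo z ≡ π z)
            preds with lo z ℚ.≟ π z | search (λ y → F? y ×-dec ((y ≺? z) ×-dec (Out y ℚ.≟ π z)))
            ... | yes e | _ = inj₁ (inj₁ e)
            ... | no _  | inj₁ h = inj₁ (inj₂ h)
            ... | no ¬e | inj₂ h = inj₂ ((λ { (y , t) → h y (proj₁ (proj₁ t)) t }) , ¬e)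
            succs : (Out z ≡ up z ⊎ ∃ TS) ⊎ (¬ ∃ TS × ¬ Out z ≡ up z)
            succs with Out z ℚ.≟ up z | search (λ x → F? x ×-dec ((z ≺? x) ×-dec (Out z ℚ.≟ π x)))
            ... | yes e | _ = inj₁ (inj₁ e)
            ... | no _  | inj₁ h = inj₁ (inj₂ h)
            ... | no ¬e | inj₂ h = inj₂ ((λ { (x , t) → h x (proj₁ (proj₁ t)) t }) , ¬e)
            cases : (lo z ≡ π z ⊎ ∃ TP) ⊎ (¬ ∃ TP × ¬ lo z ≡ π z) → (Out z ≡ up z ⊎ ∃ TS) ⊎ (¬ ∃ TS × ¬ Out z ≡ up z) → Cone w
            cases (inj₂ (¬p , ¬s)) _ = no-pred ¬p ¬s
            cases (inj₁ _) (inj₂ (¬s , ¬e)) = no-succ ¬s ¬e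
            cases (inj₁ (inj₁ s)) (inj₁ (inj₁ e)) = ⊥-elim (¬start-end s e)
            cases (inj₁ (inj₁ s)) (inj₁ (inj₂ (x , ts@(fx , z≺x , ex)))) = row-case ts (sym (lo-row nz (proj₁ fx) z≺x (trans s (trans πz≡Outz ex)))) (inj₁ s)
            cases (inj₁ (inj₂ (y , tp@(fy , y≺z , ey)))) (inj₁ (inj₁ e)) = col-case tp (up-col fy nz y≺z (trans ey (trans πz≡Outz e))) (inj₁ e)
            cases (inj₁ (inj₂ (y , tp))) (inj₁ (inj₂ (x , ts))) =
              [ (λ { (ry , rx) → row-case ts rx (inj₂ (y , tp , ry)) }) , (λ { (cy , cx) → col-case tp cy (inj₂ (x , ts , cx)) }) ]′ (both tp ts)

      -- Convexity of the tangent cone and the dual basis.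

      cone-cong : ∀ {x y} → (∀ i j → y i j ≡ x i j) → Cone x → Cone y
      cone-cong h (t , p , 0≤t , p∈P , e) = t , p , 0≤t , p∈P , λ i j → trans (h i j) (e i j)

      convex : ∀ {x y α β} → InP n a x → InP n a y → 0ℚ ≤ℚ α → 0ℚ ≤ℚ β → α + β ≡ 1ℚ → InP n a (λ i j → α * x i j + β * y i j)
      convex {x} {y} {α} {β} (x₀ , x₁ , x₂) (y₀ , y₁ , y₂) 0≤α 0≤β s =
        (λ i j h → trans (cong₂ (λ p q → α * p + β * q) (x₀ i j h) (y₀ i j h)) (l₀ α β)) ,
        (λ i j h → *-nonneg 0≤α (x₁ i j h) ⊕ *-nonneg 0≤β (y₁ i j h)) ,
        λ p ps d → subst₂ _≤ℚ_ (sym (S-lin x y (λ i j → α * x i j + β * y i j) α β (p ∷ ps) (λ _ _ → refl)))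
          (trans (l₁ α β (M n a p ps)) (trans (cong (_* M n a p ps) s) (ℚ.*-identityˡ (M n a p ps)))) (*-mono 0≤α (x₂ p ps d) ⊕ *-mono 0≤β (y₂ p ps d))
        where
        l₀ : ∀ α β → α * 0ℚ + β * 0ℚ ≡ 0ℚ
        l₀ = RS.solve-∀ ℚ-ring
        l₁ : ∀ α β m → α * m + β * m ≡ (α + β) * m
        l₁ = RS.solve-∀ ℚ-ring

      -- With weights t / (t + t′) and t′ / (t + t′) the sum is a multiple of a direction towards
      -- one point of P. The case t = 0 is split off to make t + t′ invertible.
      cone-+ : ∀ {x y} → Cone x → Cone y → Cone (λ i j → x i j + y i j)
      cone-+ {x} {y} (t , p , 0≤t , p∈P , e) cy@(t′ , p′ , 0≤t′ , p′∈P , e′) = [ zero-case , pos-case ]′ (nonneg-pos-cases 0≤t)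
        where
        zero-case : t ≡ 0ℚ → Cone (λ i j → x i j + y i j)
        zero-case t≡0 = cone-cong (λ i j → trans (cong (_+ y i j) (trans (e i j) (trans (cong (_* (p i j - v i j)) t≡0) (ℚ.*-zeroˡ (p i j - v i j))))) (ℚ.+-identityˡ (y i j))) cy
        pos-case : 0ℚ <ℚ t → Cone (λ i j → x i j + y i j)
        pos-case 0<t = go (inverse 0<s)
          where
          s = t + t′
          0<s : 0ℚ <ℚ s
          0<s = ℚ.<-≤-trans 0<t (a≤a+b 0≤t′)
          go : (Σ ℚ λ u → 0ℚ <ℚ u × s * u ≡ 1ℚ) → Cone (λ i j → x i j + y i j)
          go (u , 0<u , su) = s , (λ i j → (u * t) * p i j + (u * t′) * p′ i j) , ℚ.<⇒≤ 0<s ,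
            convex p∈P p′∈P (*-nonneg (ℚ.<⇒≤ 0<u) 0≤t) (*-nonneg (ℚ.<⇒≤ 0<u) 0≤t′) (trans (l₁ u t t′) su) ,
            λ i j → trans (cong₂ _+_ (e i j) (e′ i j)) (trans (l₂ t t′ (p i j) (p′ i j) (v i j))
              (trans (cong (λ z → z * (t * p i j + t′ * p′ i j) - s * v i j) (sym su)) (l₃ u t t′ (p i j) (p′ i j) (v i j))))
            where
            l₁ : ∀ u t t′ → u * t + u * t′ ≡ (t + t′) * u
            l₁ = RS.solve-∀ ℚ-ring
            l₂ : ∀ t t′ p p′ v → t * (p - v) + t′ * (p′ - v) ≡ 1ℚ * (t * p + t′ * p′) - (t + t′) * v
            l₂ = RS.solve-∀ ℚ-ring
            l₃ : ∀ u t t′ p p′ v → ((t + t′) * u) * (t * p + t′ * p′) - (t + t′) * v ≡ (t + t′) * (((u * t) * p + (u * t′) * p′) - v)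
            l₃ = RS.solve-∀ ℚ-ring

      cone-* : ∀ {x} c → 0ℚ ≤ℚ c → Cone x → Cone (λ i j → c * x i j)
      cone-* {x} c 0≤c (t , p , 0≤t , p∈P , e) = c * t , p , *-nonneg 0≤c 0≤t , p∈P ,
        λ i j → trans (cong (c *_) (e i j)) (sym (ℚ.*-assoc c t (p i j - v i j)))

      cone-lin : ∀ m c (r : Fin m → PtZ) → (∀ k → 0ℚ ≤ℚ c k) → (∀ k → Cone (λ i j → toℚ (r k i j))) → Cone (lin m c r)
      cone-lin zero c r _ _ = 0ℚ , v , ℚ.≤-refl , v∈P , λ i j → sym (ℚ.*-zeroˡ (v i j - v i j))
      cone-lin (suc m) c r hc hr = cone-+ (cone-* (c fzero) (hc fzero) (hr fzero)) (cone-lin m (c ∘ fsuc) (r ∘ fsuc) (hc ∘ fsuc) (hr ∘ fsuc))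

      -- The facet functionals at `v`, one per node, signed so that they are nonnegative on the
      -- cone.
      fn : Pt → X → ℚ
      fn w p = choose (F? p) (- hook w p) (w ∙ p)

      fn-F : ∀ w {p} → F p → fn w p ≡ - hook w p
      fn-F w {p} f = choose-yes (F? p) f

      fn-¬F : ∀ w {p} → ¬ F p → fn w p ≡ w ∙ p
      fn-¬F w {p} ¬f = choose-no (F? p) ¬f

      fn-linear : ∀ p → Linear (λ w → fn w p)
      fn-linear p x y z α β e with F? p
      ... | yes _ = trans (cong -_ (hook-linear p x y z α β e)) (l α β (hook x p) (hook y p))
        where
        l : ∀ α β x y → - (α * x + β * y) ≡ α * - x + β * - y
        l = RS.solve-∀ ℚ-ring
      ... | no _  = e (row p) (col p)

      hook-cong : ∀ {x y} p → (∀ i j → x i j ≡ y i j) → hook x p ≡ hook y p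
      hook-cong (i , j) e = cong₂ _+_ (cong₂ _+_ (Sum-cong (suc i) j λ c _ _ → e i c) (e i j)) (Sum-cong (suc i) j λ c _ _ → e c j)

      fn-cong : ∀ {x y} p → (∀ i j → x i j ≡ y i j) → fn x p ≡ fn y p
      fn-cong {x} {y} p e with F? p
      ... | yes _ = cong -_ (hook-cong {x} {y} p e)
      ... | no _  = e (row p) (col p)

      -- Induction on j - i: besides its corner a hook contains only shorter segments.
      fn-injective : ∀ {x} → InU n x → (∀ {p} → Node p → fn x p ≡ 0ℚ) → ∀ i j → x i j ≡ 0ℚ
      fn-injective {x} x∈U h i j = go (j ∸ i) i j ℕ.≤-refl
        where
        go : ∀ N i j → j ∸ i ≤ N → x i j ≡ 0ℚ
        go zero i j d = x∈U i j λ np → ℕ.<⇒≱ (row<col np) (ℕ.m∸n≡0⇒m≤n (ℕ.n≤0⇒n≡0 d))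
        go (suc N) i j d with node? (i , j) | F? (i , j)
        ... | no ¬n  | _ = x∈U i j ¬n
        ... | yes np | no ¬f = trans (sym (fn-¬F x ¬f)) (h np)
        ... | yes np | yes f = trans (sym (trans (cong₂ (λ r c → r + x i j + c) row0 col0) (l (x i j))))
                (ℚ.neg-injective (trans (sym (fn-F x f)) (h np)))
          where
          l : ∀ x → 0ℚ + x + 0ℚ ≡ x
          l = RS.solve-∀ ℚ-ring
          row0 : rowSum x (i , j) ≡ 0ℚ
          row0 = Sum-zero (suc i) j λ c i<c c<j → go N i c (ℕ.≤-pred (ℕ.<-≤-trans (ℕ.∸-monoˡ-< c<j (ℕ.<⇒≤ i<c)) d))
          col0 : colSum x (i , j) ≡ 0ℚ
          col0 = Sum-zero (suc i) j λ c i<c c<j → go N c j (ℕ.≤-pred (ℕ.<-≤-trans (ℕ.∸-monoʳ-< i<c (ℕ.<⇒≤ c<j)) d))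

      -- Triangular solution of fn x = b, with the length j - i of the segment as recursion depth.
      solAt : (X → ℚ) → ℕ → Pt
      solAt b zero    i j = 0ℚ
      solAt b (suc N) i j = choose (F? (i , j)) (- b (i , j) - rowSum (solAt b N) (i , j) - colSum (solAt b N) (i , j))
                                   (choose (node? (i , j)) (b (i , j)) 0ℚ)

      sol : (X → ℚ) → Pt
      sol b i j = solAt b (j ∸ i) i j

      solAt-off : ∀ b N {i j} → ¬ Node (i , j) → solAt b N i j ≡ 0ℚ
      solAt-off b zero ¬n = refl
      solAt-off b (suc N) {i} {j} ¬n = trans (choose-no (F? (i , j)) (¬n ∘ proj₁)) (choose-no (node? (i , j)) ¬n)

      solAt-stable : ∀ b N N′ i j → j ∸ i ≤ N → j ∸ i ≤ N′ → solAt b N i j ≡ solAt b N′ i j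
      solAt-stable b zero N′ i j h _ = sym (solAt-off b N′ {i} {j} λ np → ℕ.<⇒≱ (row<col np) (ℕ.m∸n≡0⇒m≤n (ℕ.n≤0⇒n≡0 h)))
      solAt-stable b (suc N) zero i j _ h = solAt-off b (suc N) {i} {j} λ np → ℕ.<⇒≱ (row<col np) (ℕ.m∸n≡0⇒m≤n (ℕ.n≤0⇒n≡0 h))
      solAt-stable b (suc N) (suc N′) i j h h′ = cong (λ z → choose (F? (i , j)) z (choose (node? (i , j)) (b (i , j)) 0ℚ))
        (cong₂ (λ r c → - b (i , j) - r - c)
          (Sum-cong (suc i) j λ c i<c c<j → solAt-stable b N N′ i c (lt h (ℕ.∸-monoˡ-< c<j (ℕ.<⇒≤ i<c))) (lt h′ (ℕ.∸-monoˡ-< c<j (ℕ.<⇒≤ i<c))))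
          (Sum-cong (suc i) j λ c i<c c<j → solAt-stable b N N′ c j (lt h (ℕ.∸-monoʳ-< i<c (ℕ.<⇒≤ c<j))) (lt h′ (ℕ.∸-monoʳ-< i<c (ℕ.<⇒≤ c<j)))))
        where
        lt : ∀ {d e N} → d ≤ suc N → e < d → e ≤ N
        lt h h′ = ℕ.≤-pred (ℕ.<-≤-trans h′ h)

      sol-off : ∀ b {i j} → ¬ Node (i , j) → sol b i j ≡ 0ℚ
      sol-off b {i} {j} = solAt-off b (j ∸ i)

      sol-¬F : ∀ b {p} → Node p → ¬ F p → sol b ∙ p ≡ b p
      sol-¬F b {i , j} np ¬f = trans (solAt-stable b (j ∸ i) (suc (j ∸ i)) i j ℕ.≤-refl (ℕ.n≤1+n _))
        (trans (choose-no (F? (i , j)) ¬f) (choose-yes (node? (i , j)) np))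

      fn-sol : ∀ b {p} → Node p → fn (sol b) p ≡ b p
      fn-sol b {p@(i , j)} np with F? p
      ... | no ¬f = sol-¬F b np ¬f
      ... | yes f = trans (cong (λ z → - (rowSum (sol b) p + z + colSum (sol b) p)) sol-p) (l (rowSum (sol b) p) (b p) (colSum (sol b) p))
        where
        l : ∀ r b c → - (r + (- b - r - c) + c) ≡ b
        l = RS.solve-∀ ℚ-ring
        N = j ∸ i
        sol-p : sol b i j ≡ - b p - rowSum (sol b) p - colSum (sol b) p
        sol-p = trans (solAt-stable b N (suc N) i j ℕ.≤-refl (ℕ.n≤1+n N)) (trans (choose-yes (F? p) f)
          (cong₂ (λ r c → - b p - r - c)
            (Sum-cong (suc i) j λ c _ c<j → solAt-stable b N (c ∸ i) i c (ℕ.∸-monoˡ-≤ i (ℕ.<⇒≤ c<j)) ℕ.≤-refl)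
            (Sum-cong (suc i) j λ c i<c _ → solAt-stable b N (j ∸ c) c j (ℕ.∸-monoʳ-≤ j (ℕ.<⇒≤ i<c)) ℕ.≤-refl)))

      solAt-int : ∀ b → (∀ p → IsInt (b p)) → ∀ N i j → IsInt (solAt b N i j)
      solAt-int b h zero    i j = int-0
      solAt-int b h (suc N) i j = int-choose (F? (i , j))
        (int-+ (int-+ (int-neg (h (i , j))) (int-neg (int-Sum (solAt-int b h N i) (suc i) j))) (int-neg (int-Sum (λ c → solAt-int b h N c j) (suc i) j)))
        (int-choose (node? (i , j)) (h (i , j)) int-0)

      fn-int : ∀ w → (∀ i j → IsInt (w i j)) → ∀ p → IsInt (fn w p)
      fn-int w h (i , j) = int-choose (F? (i , j)) (int-neg (int-+ (int-+ (int-Sum (h i) (suc i) j) (h i j)) (int-Sum (λ c → h c j) (suc i) j))) (h i j)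

      L : List X
      L = filter node? nodes

      m : ℕ
      m = length L

      at : Fin m → X
      at = lookup L

      at-node : ∀ k → Node (at k)
      at-node k = proj₂ (∈-filter⁻ node? {xs = nodes} (∈-lookup {xs = L} k))

      at-injective : ∀ k k′ → at k ≡ at k′ → k ≡ k′
      at-injective = lookup-injective (Unique.filter⁺ node? (Unique.cartesianProduct⁺ (Unique.upTo⁺ (suc K)) (Unique.upTo⁺ (suc K))))

      at-surjective : ∀ {p} → Node p → Σ (Fin m) λ k → p ≡ at k
      at-surjective np = index p∈L , lookup-index p∈L
        where
        p∈L = ∈-filter⁺ node? (node-∈ np) np

      unit : Fin m → X → ℚ
      unit k p = 𝟙 (at k ≟ₓ p)

      ints : ∀ k i j → IsInt (sol (unit k) i j)
      ints k i j = solAt-int (unit k) (λ p → int-𝟙 (at k ≟ₓ p)) (j ∸ i) i j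

      r : Fin m → PtZ
      r k i j = proj₁ (ints k i j)

      r-sol : ∀ k i j → toℚ (r k i j) ≡ sol (unit k) i j
      r-sol k i j = proj₂ (ints k i j)

      -- A dual basis vector takes the value 0 or 1 at the zeros of `v` and the value 0 or -1 on the
      -- hooks of F, as `Ray` requires. `ray-z` is needed exactly when its node is a zero.
      r-cone : ∀ k → Cone (λ i j → toℚ (r k i j))
      r-cone k = cone-cong (r-sol k) (case F? (at k) of λ
          { (yes f) → Ray.ray-F w w∈U w-off hook≤0 (λ {p} e → w-zero e λ { refl → F⇒≢0 f e })
          ; (no ¬f) → Ray.ray-z w w∈U w-off hook≤0 (at-node k) (¬F⇒0 ¬f) (λ {p} e ne → w-zero e ne) })
        where
        w = sol (unit k)
        w∈U : InU n w
        w∈U i j = sol-off (unit k)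
        w-zero : ∀ {p} → v ∙ p ≡ 0ℚ → ¬ at k ≡ p → w ∙ p ≡ 0ℚ
        w-zero {p} e ne = case node? p of λ
          { (yes np) → trans (sol-¬F (unit k) np (λ f → F⇒≢0 f e)) (𝟙-no (at k ≟ₓ p) ne)
          ; (no ¬n) → sol-off (unit k) ¬n }
        w-off : ∀ {p} → v ∙ p ≡ 0ℚ → 0ℚ ≤ℚ w ∙ p
        w-off {p} e = case node? p of λ
          { (yes np) → subst (0ℚ ≤ℚ_) (sym (sol-¬F (unit k) np (λ f → F⇒≢0 f e))) (0≤𝟙 (at k ≟ₓ p))
          ; (no ¬n) → ≤-eq (sym (sol-off (unit k) ¬n)) }
        hook≤0 : ∀ {p} → F p → hook w p ≤ℚ 0ℚ
        hook≤0 {p} f = by≤ (subst (0ℚ ≤ℚ_) (trans (sym (fn-sol (unit k) (proj₁ f))) (fn-F w f)) (0≤𝟙 (at k ≟ₓ p))) (l (hook w p))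
          where
          l : ∀ h → 0ℚ + 0ℚ ≡ h + - h
          l = RS.solve-∀ ℚ-ring

      fn-lin : ∀ c k → fn (lin m c r) (at k) ≡ c k
      fn-lin c k = trans (linear-lin {λ w → fn w (at k)} (fn-linear (at k)) m c r)
        (trans (sumFin-cong m λ k′ → cong (c k′ *_) (trans (fn-cong (at k) (r-sol k′)) (fn-sol (unit k′) (at-node k))))
        (trans (sumFin-single m (λ k′ → c k′ * unit k′ (at k)) k
                 (λ k′ ne → trans (cong (c k′ *_) (𝟙-no (at k′ ≟ₓ at k) λ e → ne (at-injective k k′ (sym e)))) (ℚ.*-zeroʳ (c k′))))
               (trans (cong (c k *_) (𝟙-yes (at k ≟ₓ at k) refl)) (ℚ.*-identityʳ (c k)))))

      lin∈U : ∀ c → InU n (lin m c r)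
      lin∈U c i j ¬n = sumFin-zero m λ k → trans (cong (c k *_) (trans (r-sol k i j) (sol-off (unit k) ¬n))) (ℚ.*-zeroʳ (c k))

      expand : ∀ {w} → InU n w → ∀ i j → w i j ≡ lin m (λ k → fn w (at k)) r i j
      expand {w} w∈U i j = from0 (w i j) (lin m c r i j) (fn-injective {d} d∈U d0 i j)
        where
        c : Fin m → ℚ
        c k = fn w (at k)
        d : Pt
        d i j = 1ℚ * w i j + (- 1ℚ) * lin m c r i j
        l₀ : 1ℚ * 0ℚ + (- 1ℚ) * 0ℚ ≡ 0ℚ
        l₀ = refl
        l₁ : ∀ x → 1ℚ * x + (- 1ℚ) * x ≡ 0ℚ
        l₁ = RS.solve-∀ ℚ-ring
        l₂ : ∀ x y → x ≡ (1ℚ * x + (- 1ℚ) * y) + y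
        l₂ = RS.solve-∀ ℚ-ring
        from0 : ∀ x y → 1ℚ * x + (- 1ℚ) * y ≡ 0ℚ → x ≡ y
        from0 x y e = trans (l₂ x y) (trans (cong (_+ y) e) (ℚ.+-identityˡ y))
        d∈U : InU n d
        d∈U i j ¬n = trans (cong₂ (λ x y → 1ℚ * x + (- 1ℚ) * y) (w∈U i j ¬n) (lin∈U c i j ¬n)) l₀
        d0 : ∀ {p} → Node p → fn d p ≡ 0ℚ
        d0 np = let k , p≡ = at-surjective np in trans (cong (fn d) p≡)
          (trans (fn-linear (at k) w (lin m c r) d 1ℚ (- 1ℚ) (λ _ _ → refl))
          (trans (cong (λ z → 1ℚ * c k + (- 1ℚ) * z) (fn-lin c k)) (l₁ (c k))))

      fn-nonneg : ∀ {w} → Cone w → ∀ k → 0ℚ ≤ℚ fn w (at k)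
      fn-nonneg {w} cw@(t , x , 0≤t , x∈P , e) k = case F? (at k) of λ
          { (yes f) → subst (0ℚ ≤ℚ_) (sym (trans (fn-F w f) (trans (cong -_ (hook-linear (at k) x v w t (- t)
                          (λ i j → trans (e i j) (l₁ t (x i j) (v i j))))) (l₂ t (hook x (at k)) (hook v (at k))))))
                        (*-nonneg 0≤t (a≤b⇒0≤b-a (+-cancel-≤ {lo (at k)} (subst (lo (at k) + hook x (at k) ≤ℚ_) (sym (hooks f)) (hook-bound x∈P (at-node k))))))
          ; (no ¬f) → subst (0ℚ ≤ℚ_) (sym (fn-¬F w ¬f)) (cone-nonneg {w} cw (¬F⇒0 ¬f)) }
        where
        l₁ : ∀ t x v → t * (x - v) ≡ t * x + (- t) * v
        l₁ = RS.solve-∀ ℚ-ring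
        l₂ : ∀ t x v → - (t * x + (- t) * v) ≡ t * (v - x)
        l₂ = RS.solve-∀ ℚ-ring

      good⇒simple : IsSimple n a v
      good⇒simple = m , r ,
        (λ c h k → trans (sym (fn-lin c k)) (trans (fn-cong (at k) h) (fn-0 k))) ,
        (λ w → (λ cw → (λ k → fn w (at k)) , fn-nonneg {w} cw , expand {w} (λ i j → cone-zero {w} cw)) ,
               (λ { (c , hc , e) → cone-cong e (cone-lin m c r hc r-cone) })) ,
        -- The coefficients are the values of `fn`, which are integers on integral vectors.
        (λ { z (c , e) → (λ k → proj₁ (fn-int (λ i j → toℚ (z i j)) (λ i j → z i j , refl) (at k))) , λ i j →
             trans (expand {λ i j → toℚ (z i j)} (λ i j ¬n → trans (e i j) (lin∈U c i j ¬n)) i j)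
               (sumFin-cong m λ k → cong (_* toℚ (r k i j)) (sym (proj₂ (fn-int (λ i j → toℚ (z i j)) (λ i j → z i j , refl) (at k))))) })
        where
        fn-0 : ∀ k → fn (λ _ _ → 0ℚ) (at k) ≡ 0ℚ
        fn-0 k = trans (fn-linear (at k) (λ _ _ → 0ℚ) (λ _ _ → 0ℚ) (λ _ _ → 0ℚ) 0ℚ 0ℚ (λ _ _ → refl)) (l (fn (λ _ _ → 0ℚ) (at k)))
          where
          l : ∀ x → 0ℚ * x + 0ℚ * x ≡ 0ℚ
          l = RS.solve-∀ ℚ-ring

    -- Type A hook sums of φ v.

    y : Pt
    y = φ n v

    K≡suc : K ≡ suc (2 ℕ.* n)
    K≡suc = ℕ.+-comm (2 ℕ.* n) 1

    φ-low : ∀ {i j} → i ℕ.+ j < K → y i j ≡ v i j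
    φ-low h = if-yes (ℕ.<⇒<ᵇ h)

    φ-anti : ∀ {i j} → i ℕ.+ j ≡ K → y i j ≡ v i j + v i j
    φ-anti {i} {j} h = trans (if-no λ t → ℕ.<-irrefl h (ℕ.<ᵇ⇒< (i ℕ.+ j) K t))
      (trans (if-yes (ℕ.≡⇒≡ᵇ (i ℕ.+ j) K h)) (l (v i j)))
      where
      l : ∀ x → (1ℚ + 1ℚ) * x ≡ x + x
      l = RS.solve-∀ ℚ-ring

    φ-high : ∀ {i j} → K < i ℕ.+ j → y i j ≡ v (K ∸ j) (K ∸ i)
    φ-high {i} {j} h = trans (if-no λ t → ℕ.<-asym h (ℕ.<ᵇ⇒< (i ℕ.+ j) K t))
      (if-no λ t → ℕ.<-irrefl (sym (ℕ.≡ᵇ⇒≡ (i ℕ.+ j) K t)) h)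

    inR-col≤K : ∀ {i j} → InR n i j → j ≤ K
    inR-col≤K (_ , _ , h) = ℕ.≤-trans h (ℕ.m≤m+n (2 ℕ.* n) 1)

    inR-row≤K : ∀ {i j} → InR n i j → i ≤ K
    inR-row≤K r@(_ , i<j , _) = ℕ.≤-trans (ℕ.<⇒≤ i<j) (inR-col≤K r)

    node-inR : ∀ {i j} → Node (i , j) → InR n i j
    node-inR {i} {j} (1≤i , i<j , s) = 1≤i , i<j , ℕ.≤-pred (ℕ.≤-trans (ℕ.+-monoˡ-≤ j 1≤i) (subst (i ℕ.+ j ≤_) K≡suc s))

    inR-node : ∀ {i j} → InR n i j → i ℕ.+ j ≤ K → Node (i , j)
    inR-node (1≤i , i<j , _) s = 1≤i , i<j , s

    reflect-inR : ∀ {i j} → InR n i j → InR n (K ∸ j) (K ∸ i)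
    reflect-inR {i} {j} r@(1≤i , i<j , j≤2n) = ℕ.m<n⇒0<n∸m (subst (j <_) (sym K≡suc) (s≤s j≤2n)) ,
      ℕ.∸-monoʳ-< i<j (inR-col≤K r) , ℕ.≤-trans (ℕ.∸-monoʳ-≤ K 1≤i) (ℕ.≤-reflexive (cong (_∸ 1) K≡suc))

    reflect-sum : ∀ {i j} → InR n i j → (K ∸ j) ℕ.+ (K ∸ i) ℕ.+ (i ℕ.+ j) ≡ K ℕ.+ K
    reflect-sum {i} {j} r = trans (cong ((K ∸ j) ℕ.+ (K ∸ i) ℕ.+_) (ℕ.+-comm i j))
      (trans (ℕ.+-assoc (K ∸ j) (K ∸ i) (j ℕ.+ i)) (trans (cong ((K ∸ j) ℕ.+_) (trans (cong ((K ∸ i) ℕ.+_) (ℕ.+-comm j i)) (trans (sym (ℕ.+-assoc (K ∸ i) i j))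
        (cong (ℕ._+ j) (ℕ.m∸n+n≡m (inR-row≤K r)))))) (trans (cong ((K ∸ j) ℕ.+_) (ℕ.+-comm K j)) (trans (sym (ℕ.+-assoc (K ∸ j) j K)) (cong (ℕ._+ K) (ℕ.m∸n+n≡m (inR-col≤K r)))))))

    high⇒low : ∀ {i j} → InR n i j → K ≤ i ℕ.+ j → (K ∸ j) ℕ.+ (K ∸ i) ≤ K
    high⇒low {i} {j} r h = ℕ.+-cancelʳ-≤ (i ℕ.+ j) _ _ (ℕ.≤-trans (ℕ.≤-reflexive (reflect-sum r)) (ℕ.+-monoʳ-≤ K h))

    high⇒low< : ∀ {i j} → InR n i j → K < i ℕ.+ j → (K ∸ j) ℕ.+ (K ∸ i) < K
    high⇒low< {i} {j} r h = ℕ.+-cancelʳ-< (i ℕ.+ j) _ _ (ℕ.≤-<-trans (ℕ.≤-reflexive (reflect-sum r)) (ℕ.+-monoʳ-< K h))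

    low⇒high : ∀ {i j} → InR n i j → i ℕ.+ j < K → K < (K ∸ j) ℕ.+ (K ∸ i)
    low⇒high {i} {j} r h = ℕ.≰⇒> λ h′ → ℕ.<-irrefl (reflect-sum r) (ℕ.+-mono-≤-< h′ h)

    KK : ∀ {i} → i ≤ K → K ∸ (K ∸ i) ≡ i
    KK = ℕ.m∸[m∸n]≡n

    φ-sym : ∀ {i j} → InR n i j → y (K ∸ j) (K ∸ i) ≡ y i j
    φ-sym {i} {j} r = case ℕ.<-cmp (i ℕ.+ j) K of λ
      { (tri< h _ _) → trans (φ-high (low⇒high r h)) (trans (cong₂ v (KK (inR-row≤K r)) (KK (inR-col≤K r))) (sym (φ-low h)))
      ; (tri> _ _ h) → trans (φ-low (high⇒low< r h)) (sym (φ-high h))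
      ; (tri≈ _ h _) → cong₂ y (trans (cong (_∸ j) (sym h)) (ℕ.m+n∸n≡m i j)) (trans (cong (_∸ i) (sym h)) (ℕ.m+n∸m≡n i j)) }

    -- The reflection maps the row arm of one hook to the column arm of the other, in reverse order.
    hook-sym : ∀ {i j} → InR n i j → hook y (K ∸ j , K ∸ i) ≡ hook y (i , j)
    hook-sym {i} {j} r@(1≤i , i<j , j≤2n) = trans (cong₂ _+_ (cong₂ _+_ (half₁ r) (φ-sym r)) (half₂ r)) (l (colSum y (i , j)) (y i j) (rowSum y (i , j)))
      where
      l : ∀ a b c → a + b + c ≡ c + b + a
      l = RS.solve-∀ ℚ-ring
      sK : ∀ {i} → i ≤ K → suc K ∸ i ≡ suc (K ∸ i)
      sK = ℕ.+-∸-assoc 1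
      half₂ : InR n i j → colSum y (K ∸ j , K ∸ i) ≡ rowSum y (i , j)
      half₂ r = sym (trans (Sum-cong (suc i) j λ c i<c c<j → sym (φ-sym (1≤i , i<c , ℕ.≤-trans (ℕ.<⇒≤ c<j) j≤2n)))
        (trans (Sum-reverse (λ c → y c (K ∸ i)) K (suc i) j i<j (ℕ.m≤n⇒m≤1+n (inR-col≤K r)))
               (cong (λ z → Sum (λ c → y c (K ∸ i)) z (K ∸ i)) (sK (inR-col≤K r)))))
      half₁ : InR n i j → rowSum y (K ∸ j , K ∸ i) ≡ colSum y (i , j)
      half₁ r = sym (trans (Sum-cong (suc i) j λ c i<c c<j → sym (φ-sym (ℕ.≤-trans (s≤s z≤n) i<c , c<j , j≤2n)))
        (trans (Sum-reverse (y (K ∸ j)) K (suc i) j i<j (ℕ.m≤n⇒m≤1+n (inR-col≤K r)))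
               (cong (λ z → Sum (y (K ∸ j)) z (K ∸ i)) (sK (inR-col≤K r)))))

    a′ ab : ℕ → ℚ
    a′ k = ℕtoℚ (a k)
    ab k = ℕtoℚ (abar n a k)

    abar-low : ∀ {k} → k < n → abar n a k ≡ a k
    abar-low h = if-yes (ℕ.<⇒<ᵇ h)

    abar-mid : abar n a n ≡ 2 ℕ.* a n
    abar-mid = trans (if-no λ t → ℕ.<-irrefl refl (ℕ.<ᵇ⇒< n n t)) (if-yes (ℕ.≡⇒≡ᵇ n n refl))

    abar-high : ∀ {k} → n < k → abar n a k ≡ a (2 ℕ.* n ∸ k)
    abar-high {k} h = trans (if-no λ t → ℕ.<-asym h (ℕ.<ᵇ⇒< k n t)) (if-no λ t → ℕ.<-irrefl (sym (ℕ.≡ᵇ⇒≡ k n t)) h)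

    ab-low : ∀ {k} → k < n → ab k ≡ a′ k
    ab-low h = cong ℕtoℚ (abar-low h)

    ab-mid : ab n ≡ a′ n + a′ n
    ab-mid = trans (cong ℕtoℚ (trans abar-mid (cong (a n ℕ.+_) (ℕ.+-identityʳ (a n))))) (toℚ-+ (ℤ.+ a n) (ℤ.+ a n))

    ab-high : ∀ {k} → n < k → ab k ≡ a′ (2 ℕ.* n ∸ k)
    ab-high h = cong ℕtoℚ (abar-high h)

    abarSum≡ : ∀ {i j} → i < j → abarSum n a i (j ∸ 1) ≡ Sum ab i j
    abarSum≡ {i} {suc j} _ = sumℚ-range ab i j

    A-Sum : ∀ {l h} → 1 ≤ l → l ≤ suc h → A (l ∸ 1) + Sum a′ l (suc h) ≡ A h
    A-Sum {l} {h} 1≤l l≤h = trans (cong (A (l ∸ 1) +_) (sym (sumℚ-range a′ l h))) (A-aSum 1≤l l≤h)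

    2n≡ : 2 ℕ.* n ≡ n ℕ.+ n
    2n≡ = cong (n ℕ.+_) (ℕ.+-identityʳ n)

    K∸≤n : ∀ {j} → n < j → K ∸ j ≤ n
    K∸≤n {j} h = ℕ.≤-trans (ℕ.∸-monoʳ-≤ K h) (ℕ.≤-reflexive (trans (cong (_∸ suc n) K≡) (ℕ.m+n∸m≡n n n)))

    ab-small : ∀ {p} → Node p → col p ≤ n → lo p + Sum ab (row p) (col p) ≡ up p
    ab-small {i , suc j} np h = trans (cong (lo (i , suc j) +_) (Sum-cong i (suc j) λ c _ c<j → ab-low (ℕ.<-≤-trans c<j h)))
      (trans (A-Sum (1≤row np) (ℕ.<⇒≤ (row<col np))) (cong A (sym (ℕ.m≤n⇒m⊓n≡m (ℕ.≤-trans (ℕ.n≤1+n j) h)))))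

    up-big : ∀ {p} → n < col p → up p ≡ A n
    up-big {i , suc j} (s≤s h) = cong A (ℕ.m≥n⇒m⊓n≡n h)

    -- The sum is split at n. Of the middle term 2 a_n one copy completes the sum from i to n and
    -- the other, after reflection of the upper part, the sum from K - j to n.
    ab-big : ∀ {p} → Node p → n < col p → (lo p + lo (K ∸ col p , col p)) + Sum ab (row p) (col p) ≡ A n + A n
    ab-big {i , j} np n<j = trans (cong ((lo (i , j) + A (K ∸ j ∸ 1)) +_)
        (trans (Sum-split ab (ℕ.≤-trans (row≤n np) (ℕ.n≤1+n n)) n<j)
          (cong₂ _+_ (trans (Sum-snoc ab (row≤n np)) (cong₂ _+_ (Sum-cong i n λ c _ c<n → ab-low c<n) ab-mid)) upper)))
      (trans (l (lo (i , j)) (A (K ∸ j ∸ 1)) (Sum a′ i n) (a′ n) (Sum a′ (K ∸ j) n))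
        (cong₂ _+_ (trans (cong (lo (i , j) +_) (sym (Sum-snoc a′ (row≤n np)))) (A-Sum (1≤row np) (ℕ.≤-trans (row≤n np) (ℕ.n≤1+n n))))
                   (trans (cong (A (K ∸ j ∸ 1) +_) (sym (Sum-snoc a′ (K∸≤n n<j)))) (A-Sum 1≤K∸j (ℕ.≤-trans (K∸≤n n<j) (ℕ.n≤1+n n))))))
      where
      l : ∀ a b c d e → (a + b) + ((c + (d + d)) + e) ≡ (a + (c + d)) + (b + (e + d))
      l = RS.solve-∀ ℚ-ring
      r = node-inR np
      1≤K∸j : 1 ≤ K ∸ j
      1≤K∸j = proj₁ (reflect-inR r)
      upper : Sum ab (suc n) j ≡ Sum a′ (K ∸ j) n
      upper = trans (Sum-cong (suc n) j λ c n<c _ → ab-high n<c) (trans (Sum-reverse a′ (2 ℕ.* n) (suc n) j n<j (ℕ.m≤n⇒m≤1+n (proj₂ (proj₂ r))))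
        (cong₂ (Sum a′) (cong (_∸ j) (sym K≡suc)) (trans (cong (_∸ n) 2n≡) (ℕ.m+n∸m≡n n n))))

    abar-sym : ∀ {k} → k ≤ 2 ℕ.* n → abar n a (2 ℕ.* n ∸ k) ≡ abar n a k
    abar-sym {k} h = case ℕ.<-cmp k n of λ
      { (tri< k<n _ _) → trans (abar-high (subst₂ _<_ mid refl (ℕ.∸-monoʳ-< k<n (subst (n ≤_) (sym 2n≡) (ℕ.m≤m+n n n)))))
                           (trans (cong a (ℕ.m∸[m∸n]≡n h)) (sym (abar-low k<n)))
      ; (tri≈ _ refl _) → cong (abar n a) mid
      ; (tri> _ _ n<k) → trans (abar-low (subst₂ _<_ refl mid (ℕ.∸-monoʳ-< n<k h))) (sym (abar-high n<k)) }
      where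
      mid : 2 ℕ.* n ∸ n ≡ n
      mid = trans (cong (_∸ n) 2n≡) (ℕ.m+n∸m≡n n n)

    Sum-ab-sym : ∀ {i j} → InR n i j → Sum ab (K ∸ j) (K ∸ i) ≡ Sum ab i j
    Sum-ab-sym {i} {j} r@(_ , i<j , j≤2n) = sym (trans (Sum-cong i j λ c _ c<j → sym (cong ℕtoℚ (abar-sym (ℕ.≤-trans (ℕ.<⇒≤ c<j) j≤2n))))
      (trans (Sum-reverse ab (2 ℕ.* n) i j (ℕ.<⇒≤ i<j) (ℕ.m≤n⇒m≤1+n j≤2n)) (cong₂ (Sum ab) (cong (_∸ j) (sym K≡suc)) (cong (_∸ i) (sym K≡suc)))))

    row-low : ∀ {p} → Node p → rowSum y p ≡ rowSum v p
    row-low {i , j} np = Sum-cong (suc i) j λ c _ c<j → φ-low (ℕ.<-≤-trans (ℕ.+-monoʳ-< i c<j) (row+col≤K np))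

    hook-small : ∀ {p} → Node p → col p ≤ n → hook y p ≡ hook v p
    hook-small {i , j} np h = cong₂ _+_ (cong₂ _+_ (row-low np) (φ-low (small i (row<col np)))) (Sum-cong (suc i) j λ c _ c<j → φ-low (small c c<j))
      where
      small : ∀ c → c < j → c ℕ.+ j < K
      small c c<j = subst (c ℕ.+ j <_) (sym K≡) (s≤s (ℕ.+-mono-≤ (ℕ.≤-trans (ℕ.<⇒≤ c<j) h) h))

    hook-central : ∀ {j} → Node (K ∸ j , j) → hook v (K ∸ j , j) ≡ rowSum v (K ∸ j , j) + v (K ∸ j) j
    hook-central {j} np = trans (cong (rowSum v (K ∸ j , j) + v (K ∸ j) j +_) (Sum-zero (suc (K ∸ j)) j λ c h _ → v-zero λ nc →
      ℕ.<⇒≱ (ℕ.≤-<-trans (ℕ.≤-reflexive (sym (ℕ.m∸n+n≡m (inR-col≤K (node-inR np))))) (ℕ.+-monoˡ-< j h)) (row+col≤K nc))) (ℚ.+-identityʳ _)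

    central-node : ∀ {p} → Node p → n < col p → Node (K ∸ col p , col p)
    central-node {i , j} np h = proj₁ (reflect-inR (node-inR np)) , ℕ.≤-<-trans (K∸≤n h) h , ℕ.≤-reflexive (ℕ.m∸n+n≡m (inR-col≤K (node-inR np)))

    -- Past the antidiagonal φ copies column j from row K - j, in reverse order.
    upper-half : ∀ {p} → Node p → n < col p → Sum (λ c → y c (col p)) (suc (K ∸ col p)) (col p) ≡ rowSum v (K ∸ col p , col p)
    upper-half {i , j} np n<j = trans (Sum-cong (suc (K ∸ j)) j λ c h c<j → φ-high (ℕ.≤-<-trans (ℕ.≤-reflexive (sym (ℕ.m∸n+n≡m j≤K))) (ℕ.+-monoˡ-< j h)))
      (trans (Sum-reverse (v (K ∸ j)) K (suc (K ∸ j)) j (row<col (central-node np n<j)) (ℕ.m≤n⇒m≤1+n j≤K))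
        (cong₂ (Sum (v (K ∸ j))) (ℕ.+-∸-assoc 1 j≤K) (KK j≤K)))
      where
      j≤K = inR-col≤K (node-inR np)

    -- Cut the column arm at the antidiagonal. The part before it completes the type C hook at p,
    -- the part behind it is the row arm of the hook at (K - j , j), and the doubled entry on the
    -- antidiagonal is shared by the two.
    hook-big : ∀ {p} → Node p → n < col p → hook y p ≡ hook v p + hook v (K ∸ col p , col p)
    hook-big {p@(i , j)} np n<j = [ below , on ]′ (ℕ.m≤n⇒m<n∨m≡n (row+col≤K np))
      where
      c : X
      c = K ∸ j , j
      nc = central-node np n<j
      j≤K = inR-col≤K (node-inR np)
      anti : (K ∸ j) ℕ.+ j ≡ K
      anti = ℕ.m∸n+n≡m j≤K
      on : i ℕ.+ j ≡ K → hook y p ≡ hook v p + hook v c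
      on e with trans (sym (ℕ.m+n∸n≡m i j)) (cong (_∸ j) e)
      ... | i≡ = subst (λ z → hook y (z , j) ≡ hook v (z , j) + hook v c) (sym i≡)
          (trans (cong₂ _+_ (cong₂ _+_ (row-low nc) (φ-anti anti)) (upper-half np n<j))
            (trans (l (rowSum v c) (v (K ∸ j) j)) (cong₂ _+_ (sym (hook-central nc)) (sym (hook-central nc)))))
        where
        l : ∀ r x → r + (x + x) + r ≡ (r + x) + (r + x)
        l = RS.solve-∀ ℚ-ring
      below : i ℕ.+ j < K → hook y p ≡ hook v p + hook v c
      below h = trans (cong₂ _+_ (cong₂ _+_ (row-low np) (φ-low h)) coly)
          (trans (l (rowSum v p) (v i j) (Sum f (suc i) (K ∸ j)) (v (K ∸ j) j) (rowSum v c))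
            (cong₂ _+_ (cong (rowSum v p + v i j +_) (sym colv)) (sym (hook-central nc))))
        where
        f g : ℕ → ℚ
        f k = v k j
        g k = y k j
        i<i′ : i < K ∸ j
        i<i′ = ℕ.m+n≤o⇒m≤o∸n (suc i) h
        l : ∀ r x s z r′ → r + x + (s + ((z + z) + r′)) ≡ (r + x + (s + z)) + (r′ + z)
        l = RS.solve-∀ ℚ-ring
        coly : colSum y p ≡ Sum f (suc i) (K ∸ j) + ((v (K ∸ j) j + v (K ∸ j) j) + rowSum v c)
        coly = trans (Sum-split g i<i′ (ℕ.<⇒≤ (row<col nc))) (cong₂ _+_
          (Sum-cong (suc i) (K ∸ j) λ k _ k< → φ-low (ℕ.<-≤-trans (ℕ.+-monoˡ-< j k<) (ℕ.≤-reflexive anti)))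
          (trans (Sum-cons g (row<col nc)) (cong₂ _+_ (φ-anti anti) (upper-half np n<j))))
        colv : colSum v p ≡ Sum f (suc i) (K ∸ j) + v (K ∸ j) j
        colv = trans (Sum-split f i<i′ (ℕ.<⇒≤ (row<col nc))) (cong (Sum f (suc i) (K ∸ j) +_) (trans (Sum-cons f (row<col nc))
          (trans (cong (v (K ∸ j) j +_) (Sum-zero (suc (K ∸ j)) j λ k k> _ → v-zero λ nk →
            ℕ.<⇒≱ (ℕ.≤-<-trans (ℕ.≤-reflexive (sym anti)) (ℕ.+-monoˡ-< j k>)) (row+col≤K nk))) (ℚ.+-identityʳ (v (K ∸ j) j)))))

    φ≡0⇒≡0 : ∀ {p} → Node p → y ∙ p ≡ 0ℚ → v ∙ p ≡ 0ℚ
    φ≡0⇒≡0 {i , j} np e = [ (λ h → trans (sym (φ-low h)) e) , (λ h → double-cancel (trans (sym (φ-anti h)) e)) ]′ (ℕ.m≤n⇒m<n∨m≡n (row+col≤K np))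

    ≡0⇒φ≡0 : ∀ {p} → Node p → v ∙ p ≡ 0ℚ → y ∙ p ≡ 0ℚ
    ≡0⇒φ≡0 {i , j} np e = [ (λ h → trans (φ-low h) e) , (λ h → trans (φ-anti h) (trans (cong₂ _+_ e e) refl)) ]′ (ℕ.m≤n⇒m<n∨m≡n (row+col≤K np))

    -- Between u and p the row of `v` vanishes, so `row-bound` at u accounts for the entire row sum
    -- of p. `first-in-col` is its mirror image.
    last-in-row : ∀ {p} → Node p → rowSum v p ≡ 0ℚ ⊎ Σ X λ u → F u × row u ≡ row p × col u < col p × lo p + rowSum v p ≤ℚ Out u
    last-in-row {i , j} np = go j (row<col np)
      where
      Last : ℕ → Set
      Last l = Sum (v i) (suc i) l ≡ 0ℚ ⊎ Σ X λ u → F u × row u ≡ i × col u < l × lo (i , j) + Sum (v i) (suc i) l ≤ℚ Out u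
      hit : ∀ l → i < l → F (i , l) → Last (suc l)
      hit l i<l f = inj₂ ((i , l) , f , refl , ℕ.≤-refl , ℚ.≤-trans
        (≤-eq (trans (cong (lo (i , j) +_) (Sum-snoc (v i) i<l)) (sym (ℚ.+-assoc (lo (i , j)) (Sum (v i) (suc i) l) (v i l)))))
        (ℚ.+-monoˡ-≤ (v i l) (row-bound v∈P (proj₁ f))))
      miss : ∀ l → i < l → ¬ F (i , l) → Last l → Last (suc l)
      miss l i<l ¬f = [ (λ e′ → inj₁ (trans e e′)) ,
          (λ { (u , fu , ru , cu , h) → inj₂ (u , fu , ru , ℕ.m<n⇒m<1+n cu , subst (λ z → lo (i , j) + z ≤ℚ Out u) (sym e) h) }) ]′
        where
        e : Sum (v i) (suc i) (suc l) ≡ Sum (v i) (suc i) l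
        e = trans (Sum-snoc (v i) i<l) (trans (cong (Sum (v i) (suc i) l +_) (¬F⇒0 ¬f)) (ℚ.+-identityʳ (Sum (v i) (suc i) l)))
      go : ∀ l → i < l → Last l
      go (suc l) (s≤s i≤l) = [ (λ i<l → case F? (i , l) of λ { (yes f) → hit l i<l f ; (no ¬f) → miss l i<l ¬f (go l i<l) }) ,
        (λ i≡l → inj₁ (Sum-empty (v i) (s≤s (ℕ.≤-reflexive (sym i≡l))))) ]′ (ℕ.m≤n⇒m<n∨m≡n i≤l)

    first-in-col : ∀ {p} → Node p → colSum v p ≡ 0ℚ ⊎ Σ X λ x → F x × col x ≡ col p × row p < row x × π x + colSum v p ≤ℚ up p
    first-in-col {i , j} np = go j i (ℕ.m≤m+n j i)
      where
      f : ℕ → ℚ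
      f c = v c j
      First : ℕ → Set
      First i = Sum f (suc i) j ≡ 0ℚ ⊎ Σ X λ x → F x × col x ≡ j × i < row x × π x + Sum f (suc i) j ≤ℚ up (i , j)
      hit : ∀ i → suc i < j → F (suc i , j) → First i
      hit i i<j fx = inj₂ ((suc i , j) , fx , refl , ℕ.≤-refl , ℚ.≤-trans
        (≤-eq (trans (cong (π (suc i , j) +_) (Sum-cons f i<j)) (sym (ℚ.+-assoc (π (suc i , j)) (f (suc i)) (Sum f (suc (suc i)) j)))))
        (col-bound v∈P (proj₁ fx)))
      miss : ∀ i → suc i < j → ¬ F (suc i , j) → First (suc i) → First i
      miss i i<j ¬f = [ (λ e′ → inj₁ (trans e e′)) ,
          (λ { (x , fx , cx , rx , h) → inj₂ (x , fx , cx , ℕ.<-trans (ℕ.n<1+n i) rx , subst (λ z → π x + z ≤ℚ up (i , j)) (sym e) h) }) ]′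
        where
        e : Sum f (suc i) j ≡ Sum f (suc (suc i)) j
        e = trans (Sum-cons f i<j) (trans (cong (_+ Sum f (suc (suc i)) j) (¬F⇒0 ¬f)) (ℚ.+-identityˡ (Sum f (suc (suc i)) j)))
      go : ∀ N i → j ≤ N ℕ.+ i → First i
      go zero i h = inj₁ (Sum-empty f (ℕ.m≤n⇒m≤1+n h))
      go (suc N) i h = case suc i ℕ.<? j of λ
        { (no i≮j) → inj₁ (Sum-empty f (ℕ.≮⇒≥ i≮j))
        ; (yes i<j) → case F? (suc i , j) of λ
            { (yes fx) → hit i i<j fx ; (no ¬f) → miss i i<j ¬f (go N (suc i) (subst (j ≤_) (sym (ℕ.+-suc N i)) h)) } }

    -- From a set of segments to the three conditions.

    module FromSegments (E : Seg) (E∈ : InRCs n E) (xE : IsXE n a E y) where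

      private
        E⊆R : ∀ {i j} → E i j ≡ true → InR n i j
        E⊆R = proj₁ (proj₁ E∈) _ _
        E-meet : ∀ {i j k l} → E i j ≡ true → E k l ≡ true → i ℕ.⊔ k ≤ j ℕ.⊓ l → E (i ℕ.⊔ k) (j ℕ.⊓ l) ≡ true
        E-meet = proj₂ (proj₁ E∈) _ _ _ _
        E-lam = proj₂ (proj₂ E∈)

      E-reflect : ∀ {i j} → E i j ≡ true → E (K ∸ j) (K ∸ i) ≡ true
      E-reflect {i} {j} e = proj₁ (proj₂ E∈) (K ∸ j) (K ∸ i)
        (trans (cong₂ E (KK (inR-row≤K (E⊆R e))) (KK (inR-col≤K (E⊆R e)))) e) (reflect-inR (E⊆R e))

      -- [K - j , j] is the intersection of [i , j] with its mirror image [K - j , K - i].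
      E-central : ∀ {p} → Node p → n < col p → E (row p) (col p) ≡ true → E (K ∸ col p) (col p) ≡ true
      E-central {i , j} np n<j e = subst₂ (λ α β → E α β ≡ true) (ℕ.m≤n⇒m⊔n≡n i≤) (ℕ.m≤n⇒m⊓n≡m j≤)
          (E-meet e (E-reflect e) (subst₂ _≤_ (sym (ℕ.m≤n⇒m⊔n≡n i≤)) (sym (ℕ.m≤n⇒m⊓n≡m j≤)) (ℕ.<⇒≤ (row<col (central-node np n<j)))))
        where
        i≤ : i ≤ K ∸ j
        i≤ = ℕ.m+n≤o⇒m≤o∸n i (row+col≤K np)
        j≤ : j ≤ K ∸ i
        j≤ = ℕ.m+n≤o⇒m≤o∸n j (subst (_≤ K) (ℕ.+-comm i j) (row+col≤K np))

      F⇒E : ∀ {p} → F p → E (row p) (col p) ≡ true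
      F⇒E {i , j} f with E i j in eq
      ... | true  = refl
      ... | false = ⊥-elim (F⇒≢0 f (φ≡0⇒≡0 (proj₁ f) (proj₁ xE i j (node-inR (proj₁ f)) eq)))

      E-sum : ∀ {i j} → i < j → E i j ≡ true → hook y (i , j) ≡ Sum ab i j
      E-sum {i} {j} i<j e = trans (sym (S-dA y i<j)) (trans (proj₂ xE i j e) (abarSum≡ i<j))

      -- At a central segment `hook-big` yields twice the type C hook, so the equation can be
      -- halved.
      central-hook : ∀ {p} → Node p → n < col p → E (row p) (col p) ≡ true → lo (K ∸ col p , col p) + hook v (K ∸ col p , col p) ≡ A n
      central-hook {i , j} np n<j e = double-cancel (trans (l (lo c) (hook v c)) (trans (cong ((lo c + lo c) +_)
          (trans (sym (hook-big nc n<j)) (E-sum (row<col nc) (E-central np n<j e)))) (ab-big nc n<j)))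
        where
        c : X
        c = K ∸ j , j
        nc = central-node np n<j
        l : ∀ o h → (o + h) + (o + h) ≡ (o + o) + (h + h)
        l = RS.solve-∀ ℚ-ring

      E-hook : ∀ {p} → Node p → E (row p) (col p) ≡ true → lo p + hook v p ≡ up p
      E-hook {p} np e = case col p ℕ.≤? n of λ
        { (yes h) → trans (cong (lo p +_) (trans (sym (hook-small np h)) (E-sum (row<col np) e))) (ab-small np h)
        ; (no ¬h) → big (ℕ.≰⇒> ¬h) }
        where
        big : n < col p → lo p + hook v p ≡ up p
        big n<j = trans (cancel-+ (A n) (trans (cong (_+ (lo p + hook v p)) (sym (central-hook np n<j e)))
            (trans (l (lo c) (hook v c) (lo p) (hook v p)) (trans (cong ((lo p + lo c) +_) (trans (sym (hook-big np n<j)) (E-sum (row<col np) e))) (ab-big np n<j)))))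
            (sym (up-big {p} n<j))
          where
          c : X
          c = K ∸ col p , col p
          l : ∀ o h o′ h′ → (o + h) + (o′ + h′) ≡ (o′ + o) + (h′ + h)
          l = RS.solve-∀ ℚ-ring

      -- A zero of v at a segment of E would leave a gap on its tight hook.
      E⇒F : ∀ {p} → Node p → E (row p) (col p) ≡ true → F p
      E⇒F {p} np e = go K p np e (ℕ.m≤m+n K (row p))
        where
        go : ∀ N p → Node p → E (row p) (col p) ≡ true → K ≤ N ℕ.+ row p → F p
        go zero p np e h = ⊥-elim (ℕ.<⇒≱ (ℕ.<-≤-trans (ℕ.m<m+n (row p) (ℕ.≤-<-trans z≤n (row<col np))) (row+col≤K np)) h)
        go (suc N) p@(i , j) np e h = case F? p of λ { (yes f) → f ; (no ¬f) → ⊥-elim (gap ¬f (last-in-row np) (first-in-col np)) }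
          where
          -- The induction goes through the rows by decreasing distance to K: the central segments
          -- used below have a larger row index than p.
          IH : ∀ q → Node q → E (row q) (col q) ≡ true → i < row q → F q
          IH q nq eq h′ = go N q nq eq (ℕ.≤-trans h (ℕ.≤-trans (ℕ.≤-reflexive (sym (ℕ.+-suc N i))) (ℕ.+-monoʳ-≤ N h′)))
          hook0 : ¬ F p → lo p + rowSum v p + colSum v p ≡ up p
          hook0 ¬f = trans (trans (l (lo p) (rowSum v p) (colSum v p)) (cong (λ z → lo p + (rowSum v p + z + colSum v p)) (sym (¬F⇒0 ¬f)))) (E-hook np e)
            where
            l : ∀ o r c → o + r + c ≡ o + (r + 0ℚ + c)
            l = RS.solve-∀ ℚ-ring
          gap : ¬ F p → rowSum v p ≡ 0ℚ ⊎ (Σ X λ u → F u × row u ≡ i × col u < j × lo p + rowSum v p ≤ℚ Out u) →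
                colSum v p ≡ 0ℚ ⊎ (Σ X λ x → F x × col x ≡ j × i < row x × π x + colSum v p ≤ℚ up p) → ⊥
          gap ¬f (inj₁ r0) (inj₁ c0) = <-irr (subst (lo p <ℚ_) (trans (sym (hook0 ¬f)) (trans (cong₂ (λ r c → lo p + r + c) r0 c0) (l (lo p)))) (lo<up np))
            where
            l : ∀ o → o + 0ℚ + 0ℚ ≡ o
            l = RS.solve-∀ ℚ-ring
          gap ¬f (inj₁ r0) (inj₂ (x , fx , _ , r< , hx)) = ≤⇒≯ (ℚ.≤-trans (lo≤π (proj₁ fx)) (by≤ hx
              (trans (l (lo p) (π x) (colSum v p)) (cong (π x +_) (trans (cong (λ r → lo p + r + colSum v p) (sym r0)) (hook0 ¬f)))))) (lo-strict {p} {x} np (proj₁ fx) r<)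
            where
            l : ∀ o q c → o + (q + c) ≡ q + (o + 0ℚ + c)
            l = RS.solve-∀ ℚ-ring
          -- The tight hook gives π x ≤ Out u. As u and x are not nested, they must be disjoint, but
          -- then up u < lo x.
          gap ¬f (inj₂ (u@(_ , j′) , fu , refl , c< , hu)) (inj₂ (x@(k , _) , fx , refl , r< , hx)) =
            [ (λ h → ≤⇒≯ (ℚ.≤-trans (lo≤π (proj₁ fx)) (ℚ.≤-trans πx≤ (π+x≤up (proj₁ fu))))
                  (up<lo {u} {x} (proj₁ fu) (proj₁ fx) (subst₂ _<_ (ℕ.m≤n⇒m⊓n≡m (ℕ.<⇒≤ c<)) (ℕ.m≤n⇒m⊔n≡n (ℕ.<⇒≤ r<)) h))) ,
              [ (λ { (h , _) → ℕ.<⇒≱ r< h }) , (λ { (_ , h) → ℕ.<⇒≱ c< h }) ]′ ]′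
              (E-lam i j′ k j (F⇒E fu) (F⇒E fx) (row+col≤K (proj₁ fu)) (row+col≤K (proj₁ fx)))
            where
            πx≤ : π x ≤ℚ Out u
            πx≤ = ℚ.≤-trans (by≤ hx (trans (l (lo p) (rowSum v p) (π x) (colSum v p)) (cong (π x +_) (hook0 ¬f)))) hu
              where
              l : ∀ o r q c → (o + r) + (q + c) ≡ q + (o + r + c)
              l = RS.solve-∀ ℚ-ring
          -- Already u reaches `up p`. For j′ ≤ n this exceeds `up u`.
          gap ¬f (inj₂ (u@(_ , j′) , fu , refl , c< , hu)) (inj₁ c0) = case n ℕ.<? j′ of λ { (yes n<j′) → far n<j′ ; (no n≮j′) → near (ℕ.≮⇒≥ n≮j′) }
            where
            up≤ : up p ≤ℚ Out u
            up≤ = subst (_≤ℚ Out u) (trans (sym (ℚ.+-identityʳ _)) (trans (cong (lo p + rowSum v p +_) (sym c0)) (hook0 ¬f))) hu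
            near : j′ ≤ n → ⊥
            near j′≤n = ≤⇒≯ (ℚ.≤-trans up≤ (π+x≤up (proj₁ fu))) (up-strict {u} {p} (proj₁ fu) j′≤n c<)
            far : n < j′ → ⊥
            far n<j′ = [ below , on ]′ (ℕ.m≤n⇒m<n∨m≡n (row+col≤K np))
              where
              n<j : n < j
              n<j = ℕ.<-trans n<j′ c<
              below : i ℕ.+ j < K → ⊥
              -- The central segment of column j lies below p and is positive, although the column
              -- sum is 0.
              below s = F⇒≢0 fc (Sum-terms-zero {λ c → v c j} (suc i) j (λ c → nonneg c) (≤-eq c0) (K ∸ j) (ℕ.m+n≤o⇒m≤o∸n (suc i) s) (row<col (proj₁ fc)))
                where
                fc : F (K ∸ j , j)
                fc = IH (K ∸ j , j) (central-node np n<j) (E-central np n<j e) (ℕ.m+n≤o⇒m≤o∸n (suc i) s)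
                nonneg : ∀ c → 0ℚ ≤ℚ v c j
                nonneg c = case node? (c , j) of λ { (yes nc) → v-nonneg nc ; (no ¬n) → ≤-eq (sym (v-zero ¬n)) }
              on : i ℕ.+ j ≡ K → ⊥
              -- On the antidiagonal the central segment of the column of u is used: it comes after
              -- u, which has exhausted `A n`, and yet is positive.
              on s = ≤⇒≯ (ℚ.≤-trans (π+x≤up (proj₁ fc)) (ℚ.≤-trans (≤-eq (trans (up-big {c} n<j′) (sym (up-big {p} n<j)))) up≤))
                         (ℚ.≤-<-trans (π-link (proj₁ fu) (proj₁ fc) (≺-row i< ℕ.≤-refl)) (π<Out fc))
                where
                c : X
                c = K ∸ j′ , j′
                i< : i < K ∸ j′
                i< = ℕ.m+n≤o⇒m≤o∸n (suc i) (ℕ.<-≤-trans (ℕ.+-monoʳ-< i c<) (row+col≤K np))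
                fc : F c
                fc = IH c (central-node (proj₁ fu) n<j′) (E-central (proj₁ fu) n<j′ (F⇒E fu)) i<

      segments⇒good : Good
      segments⇒good = record
        { hooks = λ f → E-hook (proj₁ f) (F⇒E f)
        ; laminar = λ { {i , j} {k , l} fp fq r< k≤j c< → [ (λ h → ℕ.<⇒≱ (subst₂ _<_ (ℕ.m≤n⇒m⊓n≡m (ℕ.<⇒≤ c<)) (ℕ.m≤n⇒m⊔n≡n (ℕ.<⇒≤ r<)) h) k≤j) ,
              [ (λ { (h , _) → ℕ.<⇒≱ r< h }) , (λ { (_ , h) → ℕ.<⇒≱ c< h }) ]′ ]′
              (E-lam i j k l (F⇒E fp) (F⇒E fq) (row+col≤K (proj₁ fp)) (row+col≤K (proj₁ fq))) }
        ; central = λ f n<j → E⇒F (central-node (proj₁ f) n<j) (E-central (proj₁ f) n<j (F⇒E f)) }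

    -- From the three conditions to a set of segments.

    module ToSegments (good : Good) where
      open Good good

      EP : ℕ → ℕ → Set
      EP i j = InR n i j × ¬ y i j ≡ 0ℚ

      EP? : ∀ i j → Dec (EP i j)
      EP? i j = ((1 ℕ.≤? i) ×-dec ((i ℕ.<? j) ×-dec (j ℕ.≤? 2 ℕ.* n))) ×-dec ¬? (y i j ℚ.≟ 0ℚ)

      E : Seg
      E i j = ⌊ EP? i j ⌋

      E⇒EP : ∀ {i j} → E i j ≡ true → EP i j
      E⇒EP {i} {j} = ⌊⌋-true⁻ (EP? i j)

      EP⇒E : ∀ {i j} → EP i j → E i j ≡ true
      EP⇒E {i} {j} = ⌊⌋-true (EP? i j)

      EP-reflect : ∀ {i j} → EP i j → EP (K ∸ j) (K ∸ i)
      EP-reflect (r , ne) = reflect-inR r , λ e → ne (trans (sym (φ-sym r)) e)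

      EP-unreflect : ∀ {i j} → i ≤ K → j ≤ K → EP (K ∸ j) (K ∸ i) → EP i j
      EP-unreflect i≤ j≤ h = subst₂ EP (KK i≤) (KK j≤) (EP-reflect h)

      EP⇒F : ∀ {i j} → EP i j → i ℕ.+ j ≤ K → F (i , j)
      EP⇒F {i} {j} (r , ne) s = case F? (i , j) of λ { (yes f) → f ; (no ¬f) → ⊥-elim (ne (≡0⇒φ≡0 (inR-node r s) (¬F⇒0 ¬f))) }

      F⇒EP : ∀ {i j} → F (i , j) → EP i j
      F⇒EP f = node-inR (proj₁ f) , λ e → F⇒≢0 f (φ≡0⇒≡0 (proj₁ f) e)

      nested : ∀ {i j k l} → F (i , j) → F (k , l) → i ℕ.⊔ k ≤ j ℕ.⊓ l → (k ≤ i × j ≤ l) ⊎ (i ≤ k × l ≤ j)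
      nested {i} {j} {k} {l} f f′ h =
        [ (λ i<k → [ (λ j<l → ⊥-elim (laminar f f′ i<k (ℕ.≤-trans (ℕ.m≤n⊔m i k) (ℕ.≤-trans h (ℕ.m⊓n≤m j l))) j<l)) ,
                     (λ l≤j → inj₂ (ℕ.<⇒≤ i<k , l≤j)) ]′ (ℕ.<-≤-connex j l)) ,
          (λ k≤i → [ (λ l<j → [ (λ k<i → ⊥-elim (laminar f′ f k<i (ℕ.≤-trans (ℕ.m≤m⊔n i k) (ℕ.≤-trans h (ℕ.m⊓n≤n j l))) l<j)) ,
                                (λ k≡i → inj₂ (ℕ.≤-reflexive (sym k≡i) , ℕ.<⇒≤ l<j)) ]′ (ℕ.m≤n⇒m<n∨m≡n k≤i)) ,
                     (λ j≤l → inj₁ (k≤i , j≤l)) ]′ (ℕ.<-≤-connex l j)) ]′ (ℕ.<-≤-connex i k)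

      F-meet : ∀ {i j k l} → F (i , j) → F (k , l) → i ℕ.⊔ k ≤ j ℕ.⊓ l → F (i ℕ.⊔ k , j ℕ.⊓ l)
      F-meet f f′ h = [ (λ { (k≤i , j≤l) → subst₂ (λ α β → F (α , β)) (sym (ℕ.m≥n⇒m⊔n≡m k≤i)) (sym (ℕ.m≤n⇒m⊓n≡m j≤l)) f }) ,
                        (λ { (i≤k , l≤j) → subst₂ (λ α β → F (α , β)) (sym (ℕ.m≤n⇒m⊔n≡n i≤k)) (sym (ℕ.m≥n⇒m⊓n≡n l≤j)) f′ }) ]′ (nested f f′ h)

      row≤K : ∀ {p} → Node p → row p ≤ K
      row≤K np = inR-row≤K (node-inR np)
      col≤K : ∀ {p} → Node p → col p ≤ K
      col≤K np = inR-col≤K (node-inR np)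

      -- The intersection of [i , j] with the mirror image of [k , l]. The central segment
      -- [K - l , l] lies in that image and is nested with [i , j]. If it contains [i , j], the
      -- intersection is [i , j]; otherwise reflection turns the intersection into that of
      -- [K - j , j] and [k , l].
      meet-mixed : ∀ {i j k l} → F (i , j) → F (k , l) → n < l → K ∸ l ≤ j → EP (i ℕ.⊔ (K ∸ l)) (j ℕ.⊓ (K ∸ k))
      meet-mixed {i} {j} {k} {l} f f′ n<l h = [ inner , outer ]′ (nested f fc (ℕ.⊓-glb (ℕ.⊔-lub (ℕ.<⇒≤ (row<col np)) h) (ℕ.⊔-lub (ℕ.≤-trans (row≤n np) (ℕ.<⇒≤ n<l)) (ℕ.<⇒≤ (row<col nc)))))
        where
        np = proj₁ f
        np′ = proj₁ f′
        fc = central f′ n<l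
        nc = proj₁ fc
        l≤ : l ≤ K ∸ k
        l≤ = ℕ.m+n≤o⇒m≤o∸n l (subst (_≤ K) (ℕ.+-comm k l) (row+col≤K np′))
        inner : K ∸ l ≤ i × j ≤ l → EP (i ℕ.⊔ (K ∸ l)) (j ℕ.⊓ (K ∸ k))
        inner (h₁ , h₂) = subst₂ EP (sym (ℕ.m≥n⇒m⊔n≡m h₁)) (sym (ℕ.m≤n⇒m⊓n≡m (ℕ.≤-trans h₂ l≤))) (F⇒EP f)
        outer : i ≤ K ∸ l × l ≤ j → EP (i ℕ.⊔ (K ∸ l)) (j ℕ.⊓ (K ∸ k))
        outer (h₁ , h₂) = EP-unreflect (subst (_≤ K) (sym (ℕ.m≤n⇒m⊔n≡n h₁)) (ℕ.m∸n≤m K l)) (ℕ.≤-trans (ℕ.m⊓n≤m j (K ∸ k)) (col≤K np))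
            (subst₂ EP (trans (cong ((K ∸ j) ℕ.⊔_) (sym (KK (row≤K np′)))) (sym (ℕ.∸-distribˡ-⊓-⊔ K j (K ∸ k))))
                       (trans (ℕ.m≥n⇒m⊓n≡n h₂) (sym (trans (cong (K ∸_) (ℕ.m≤n⇒m⊔n≡n h₁)) (KK (col≤K np′)))))
              (F⇒EP (F-meet (central f n<j) f′ (ℕ.⊓-glb (ℕ.⊔-lub (ℕ.≤-trans (K∸≤n n<j) (ℕ.<⇒≤ n<j)) (ℕ.≤-trans (ℕ.<⇒≤ (row<col np′)) h₂))
                                                           (ℕ.⊔-lub (ℕ.≤-trans (K∸≤n n<j) (ℕ.<⇒≤ n<l)) (ℕ.<⇒≤ (row<col np′)))))))
          where
          n<j : n < j
          n<j = ℕ.<-≤-trans n<l h₂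

      reflect-meet : ∀ {i j k l} → i ≤ K → j ≤ K → EP ((K ∸ j) ℕ.⊔ (K ∸ l)) ((K ∸ i) ℕ.⊓ (K ∸ k)) → k ≤ K → EP (i ℕ.⊔ k) (j ℕ.⊓ l)
      reflect-meet {i} {j} {k} {l} i≤ j≤ h k≤ = EP-unreflect (ℕ.⊔-lub i≤ k≤) (ℕ.≤-trans (ℕ.m⊓n≤m j l) j≤)
        (subst₂ EP (sym (ℕ.∸-distribˡ-⊓-⊔ K j l)) (sym (ℕ.∸-distribˡ-⊔-⊓ K i k)) h)

      -- `meet-mixed` needs a segment reaching beyond n. Either the mirror image of [k , l] does, or
      -- k > n, and then [i , j] does because k ≤ j.
      low-high : ∀ {i j k l} → F (i , j) → EP k l → K ≤ k ℕ.+ l → k ≤ j → EP (i ℕ.⊔ k) (j ℕ.⊓ l)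
      low-high {i} {j} {k} {l} f (r , ne) s k≤j = case n ℕ.<? K ∸ k of λ { (yes h) → wide h ; (no h) → narrow (ℕ.≮⇒≥ h) }
        where
        np = proj₁ f
        k≤K = inR-row≤K r
        l≤K = inR-col≤K r
        f′ : F (K ∸ l , K ∸ k)
        f′ = EP⇒F (EP-reflect (r , ne)) (high⇒low r s)
        wide : n < K ∸ k → EP (i ℕ.⊔ k) (j ℕ.⊓ l)
        wide h = subst₂ (λ α β → EP (i ℕ.⊔ α) (j ℕ.⊓ β)) (KK k≤K) (KK l≤K) (meet-mixed f f′ h (subst (_≤ j) (sym (KK k≤K)) k≤j))
        narrow : K ∸ k ≤ n → EP (i ℕ.⊔ k) (j ℕ.⊓ l)
        narrow h = reflect-meet (row≤K np) (col≤K np) (subst₂ EP (ℕ.⊔-comm (K ∸ l) (K ∸ j)) (ℕ.⊓-comm (K ∸ k) (K ∸ i)) (meet-mixed f′ f n<j (ℕ.∸-monoʳ-≤ K k≤j))) k≤K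
          where
          n<k : n < k
          n<k = ℕ.≰⇒> λ k≤n → ℕ.<⇒≱ (ℕ.≤-trans (ℕ.≤-reflexive (sym (trans (cong (_∸ n) K≡) (ℕ.m+n∸n≡m (suc n) n)))) (ℕ.∸-monoʳ-≤ K k≤n)) h
          n<j : n < j
          n<j = ℕ.<-≤-trans n<k k≤j

      EP-meet : ∀ {i j k l} → EP i j → EP k l → i ℕ.⊔ k ≤ j ℕ.⊓ l → EP (i ℕ.⊔ k) (j ℕ.⊓ l)
      EP-meet {i} {j} {k} {l} e e′ h = [ (λ s → [ ll s , lh s ]′ (ℕ.≤-total (k ℕ.+ l) K)) , (λ s → [ hl s , hh s ]′ (ℕ.≤-total (k ℕ.+ l) K)) ]′ (ℕ.≤-total (i ℕ.+ j) K)
        where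
        r = proj₁ e
        r′ = proj₁ e′
        Goal = EP (i ℕ.⊔ k) (j ℕ.⊓ l)
        ll : i ℕ.+ j ≤ K → k ℕ.+ l ≤ K → Goal
        ll s s′ = F⇒EP (F-meet (EP⇒F e s) (EP⇒F e′ s′) h)
        lh : i ℕ.+ j ≤ K → K ≤ k ℕ.+ l → Goal
        lh s s′ = low-high (EP⇒F e s) e′ s′ (ℕ.≤-trans (ℕ.m≤n⊔m i k) (ℕ.≤-trans h (ℕ.m⊓n≤m j l)))
        hl : K ≤ i ℕ.+ j → k ℕ.+ l ≤ K → Goal
        hl s s′ = subst₂ EP (ℕ.⊔-comm k i) (ℕ.⊓-comm l j) (low-high (EP⇒F e′ s′) e s (ℕ.≤-trans (ℕ.m≤m⊔n i k) (ℕ.≤-trans h (ℕ.m⊓n≤n j l))))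
        hh : K ≤ i ℕ.+ j → K ≤ k ℕ.+ l → Goal
        hh s s′ = reflect-meet (inR-row≤K r) (inR-col≤K r) (F⇒EP (F-meet (EP⇒F (EP-reflect e) (high⇒low r s)) (EP⇒F (EP-reflect e′) (high⇒low r′ s′))
            (subst₂ _≤_ (ℕ.∸-distribˡ-⊓-⊔ K j l) (ℕ.∸-distribˡ-⊔-⊓ K i k) (ℕ.∸-monoʳ-≤ K h)))) (inR-row≤K r′)

      -- Beyond column n the tight hooks at p and at its central segment are added, each with bound
      -- `A n`; this matches `ab-big`.
      low-sum : ∀ {p} → F p → hook y p ≡ Sum ab (row p) (col p)
      low-sum {p} f = case col p ℕ.≤? n of λ
        { (yes h) → cancel-+ (lo p) (trans (cong (lo p +_) (hook-small np h)) (trans (hooks f) (sym (ab-small np h))))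
        ; (no ¬h) → big (ℕ.≰⇒> ¬h) }
        where
        np = proj₁ f
        big : n < col p → hook y p ≡ Sum ab (row p) (col p)
        big n<j = cancel-+ (lo p + lo c) (trans (cong ((lo p + lo c) +_) (hook-big np n<j)) (trans (l (lo p) (lo c) (hook v p) (hook v c))
            (trans (cong₂ _+_ (trans (hooks f) (up-big {p} n<j)) (trans (hooks (central f n<j)) (up-big {c} n<j))) (sym (ab-big np n<j)))))
          where
          c : X
          c = K ∸ col p , col p
          l : ∀ o o′ h h′ → (o + o′) + (h + h′) ≡ (o + h) + (o′ + h′)
          l = RS.solve-∀ ℚ-ring

      EP-sum : ∀ {i j} → EP i j → hook y (i , j) ≡ Sum ab i j
      EP-sum {i} {j} e@(r , _) = [ (λ s → low-sum (EP⇒F e s)) ,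
        (λ s → trans (sym (hook-sym r)) (trans (low-sum (EP⇒F (EP-reflect e) (high⇒low r s))) (Sum-ab-sym r))) ]′ (ℕ.≤-total (i ℕ.+ j) K)

      good⇒segments : Σ Seg (λ E → InRCs n E × IsXE n a E (φ n v))
      good⇒segments = E ,
        (((λ i j e → proj₁ (E⇒EP e)) , (λ i j k l e e′ h → EP⇒E (EP-meet (E⇒EP e) (E⇒EP e′) h))) ,
         (λ i j e r → EP⇒E (EP-unreflect (inR-row≤K r) (inR-col≤K r) (E⇒EP e))) ,
         (λ i j k l e e′ s s′ → lam (EP⇒F (E⇒EP e) s) (EP⇒F (E⇒EP e′) s′))) ,
        (λ i j r e → off r e) , (λ i j e → trans (S-dA y (proj₁ (proj₂ (proj₁ (E⇒EP {i} {j} e)))))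
          (trans (EP-sum (E⇒EP e)) (sym (abarSum≡ (proj₁ (proj₂ (proj₁ (E⇒EP {i} {j} e))))))))
        where
        lam : ∀ {i j k l} → F (i , j) → F (k , l) → (j ℕ.⊓ l < i ℕ.⊔ k) ⊎ ((k ≤ i × j ≤ l) ⊎ (i ≤ k × l ≤ j))
        lam {i} {j} {k} {l} f f′ = case i ℕ.⊔ k ℕ.≤? j ℕ.⊓ l of λ { (yes h) → inj₂ (nested f f′ h) ; (no h) → inj₁ (ℕ.≰⇒> h) }
        off : ∀ {i j} → InR n i j → E i j ≡ false → y i j ≡ 0ℚ
        off {i} {j} r e = case y i j ℚ.≟ 0ℚ of λ { (yes h) → h ; (no ne) → case trans (sym e) (EP⇒E (r , ne)) of λ () }

theorem5p3 : (n : ℕ) → 1 ≤ n → (a : ℕ → ℕ) → (∀ i → 1 ≤ i → i ≤ n → 1 ≤ a i) →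
    (v : Pt) → IsVertex n a v →
    (IsSimple n a v ⇔ Σ Seg (λ E → InRCs n E × IsXE n a E (φ n v)))
theorem5p3 n _ a a-pos v (v∈P , _) = mk⇔
  (λ { (m , r , indep , gen , _) → ToSegments.good⇒segments (Simplicial.simple⇒good m r indep gen) })
  (λ { (E , E∈ , xE) → Converse.good⇒simple (FromSegments.segments⇒good E E∈ xE) })
  where open Setting.Point n a a-pos v v∈P
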